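{- Let $G$ be a word-representable split graph. Then $\mathcal{R}(G) = 3$ if and only if $G$ contains, as an induced subgraph, a graph isomorphic to one of the following: $F_0$; the even $k$-sun for some even $k \ge 4$; $F_1(k)$ for some odd $k \ge 5$; $F_2(k)$ for some odd $k\ge 5$.
   Context: For a word $w$ and letters $a,b$, $w|_{\{a,b\}}$ is the subsequence of $w$ of all occurrences of $a$ and $b$; $a,b$ alternate in $w$ if $w|_{\{a,b\}}$ is $abab\cdots$ or $baba\cdots$ (any length). A graph $G=(V,E)$ is word-representable if there is a word $w$ over $V$ such that for distinct $a,b\in V$, $ab\in E$ iff $a,b$ alternate in $w$. A word is $k$-uniform if each letter occurs exactly $k$ times; $\mathcal{R}(G)$ is the least $k$ such that a $k$-uniform word represents $G$. A split graph is a graph whose vertex set partitions into a clique and an independent set. In each graph below, the vertices listed in $C$ form a clique, the vertices in $I$ form an independent set, and the only remaining edges are given by the neighbourhoods $N(\cdot)$ of the vertices of $I$. $F_0$: $C=\{0,c_1,c_2,c_3,c_4\}$, $I=\{a_1,a_2,a_3\}$, $N(a_1)=\{0,c_2,c_3\}$, $N(a_2)=\{0,c_3,c_4\}$, $N(a_3)=\{0,c_1,c_4\}$. Even $k$-sun ($k\ge4$ even): $C=\{c_1,\dots,c_k\}$, $I=\{a_1,\dots,a_k\}$, $N(a_i)=\{c_i,c_{i+1}\}$ for $1\le i\le k-1$, $N(a_k)=\{c_1,c_k\}$. $F_1(k)$ ($k\ge5$ odd): $C=\{c_1,\dots,c_{k-1}\}$, $I=\{b_1,b_2,a_1,\dots,a_{k-2}\}$,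 $N(b_1)=\{c_1,\dots,c_{k-2}\}$, $N(b_2)=\{c_2,\dots,c_{k-1}\}$, $N(a_i)=\{c_i,c_{i+1}\}$ for $1\le i\le k-2$. $F_2(k)$ ($k\ge5$ odd): $C=\{c_1,\dots,c_k\}$, $I=\{b,a_1,\dots,a_{k-1}\}$, $N(b)=\{c_2,\dots,c_{k-1}\}$, $N(a_i)=\{c_i,c_{i+1}\}$ for $1\le i\le k-1$. -}

module Defs where

open import Data.Nat using (ℕ; zero; suc; _+_; _*_; _∸_; _≤_; _<_; _≡ᵇ_; _<ᵇ_)
open import Data.Bool using (Bool; true; false; not; _∧_; _∨_)
open import Data.Fin using (Fin; zero; suc; toℕ; splitAt; _≟_)
open import Data.Sum using (_⊎_; inj₁; inj₂)
open import Data.Product using (Σ; ∃; _×_; _,_)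
open import Data.List using (List; []; _∷_; filter; length)
open import Data.List.Membership.Propositional using (_∈_)
open import Data.Empty using (⊥-elim)
open import Relation.Nullary using (¬_; yes; no)
open import Relation.Nullary.Decidable using (_⊎-dec_)
open import Relation.Binary.PropositionalEquality using (_≡_; _≢_; refl)
open import Function.Bundles using (_⇔_)

record Graph : Set where
  field
    n      : ℕ
    adj    : Fin n → Fin n → Bool
    sym    : ∀ x y → adj x y ≡ adj y x
    irrefl : ∀ x → adj x x ≡ false
open Graph public

InducedSub : Graph → Graph → Set
InducedSub H G =
  Σ (Fin (n H) → Fin (n G)) λ f →
    (∀ i j → f i ≡ f j → i ≡ j) ×
    (∀ i j → adj G (f i) (f j) ≡ adj H i j)

IsSplit : Graph → Set
IsSplit G =
  Σ (Fin (n G) → Bool) λ S →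
    (∀ x y → x ≢ y → S x ≡ true → S y ≡ true → adj G x y ≡ true) ×
    (∀ x y → S x ≡ false → S y ≡ false → adj G x y ≡ false)

Word : ℕ → Set
Word m = List (Fin m)

restrict : ∀ {m} → Word m → Fin m → Fin m → Word m
restrict w a b = filter (λ x → (x ≟ a) ⊎-dec (x ≟ b)) w

alt : ∀ {m} → Fin m → Fin m → ℕ → Word m
alt a b zero    = []
alt a b (suc k) = a ∷ alt b a k

Alternate : ∀ {m} → Word m → Fin m → Fin m → Set
Alternate w a b = ∃ λ k → (restrict w a b ≡ alt a b k) ⊎ (restrict w a b ≡ alt b a k)

Represents : (G : Graph) → Word (n G) → Set
Represents G w = ∀ a b → a ≢ b → (adj G a b ≡ true) ⇔ Alternate w a b

occ : ∀ {m} → Fin m → Word m → ℕ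
occ a w = length (filter (_≟ a) w)

Uniform : ∀ {m} → ℕ → Word m → Set
Uniform k w = ∀ a → occ a w ≡ k

WordRepresentable : Graph → Set
WordRepresentable G = Σ (Word (n G)) λ w → (∀ a → a ∈ w) × Represents G w

RepNumberIs : Graph → ℕ → Set
RepNumberIs G k =
  (1 ≤ k) ×
  (Σ (Word (n G)) λ w → Uniform k w × Represents G w) ×
  (∀ j → 1 ≤ j → j < k → ¬ (Σ (Word (n G)) λ w → Uniform j w × Represents G w))

-- Split graphs from a neighbourhood description.
-- Vertices: Fin (p + q); first p = clique C, last q = independent set I;
-- N a c = true iff clique vertex c is a neighbour of independent vertex a.

cliqueAdj : ∀ {p} → Fin p → Fin p → Bool
cliqueAdj i j with i ≟ j
... | yes _ = false
... | no  _ = true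

splitAdj : ∀ p q → (Fin q → Fin p → Bool) → Fin (p + q) → Fin (p + q) → Bool
splitAdj p q N x y with splitAt p x | splitAt p y
... | inj₁ i | inj₁ j = cliqueAdj i j
... | inj₁ i | inj₂ a = N a i
... | inj₂ a | inj₁ i = N a i
... | inj₂ a | inj₂ b = false

private
  cliqueAdj-sym : ∀ {p} (i j : Fin p) → cliqueAdj i j ≡ cliqueAdj j i
  cliqueAdj-sym i j with i ≟ j | j ≟ i
  ... | yes _ | yes _ = refl
  ... | no  _ | no  _ = refl
  ... | yes refl | no ¬q = ⊥-elim (¬q refl)
  ... | no ¬p | yes refl = ⊥-elim (¬p refl)

  cliqueAdj-irr : ∀ {p} (i : Fin p) → cliqueAdj i i ≡ false
  cliqueAdj-irr i with i ≟ i
  ... | yes _ = refl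
  ... | no ¬p = ⊥-elim (¬p refl)

  splitAdj-sym : ∀ p q N x y → splitAdj p q N x y ≡ splitAdj p q N y x
  splitAdj-sym p q N x y with splitAt p x | splitAt p y
  ... | inj₁ i | inj₁ j = cliqueAdj-sym i j
  ... | inj₁ i | inj₂ a = refl
  ... | inj₂ a | inj₁ i = refl
  ... | inj₂ a | inj₂ b = refl

  splitAdj-irr : ∀ p q N x → splitAdj p q N x x ≡ false
  splitAdj-irr p q N x with splitAt p x
  ... | inj₁ i = cliqueAdj-irr i
  ... | inj₂ a = refl

splitGraph : ∀ p q → (Fin q → Fin p → Bool) → Graph
splitGraph p q N = record
  { n = p + q ; adj = splitAdj p q N
  ; sym = splitAdj-sym p q N ; irrefl = splitAdj-irr p q N }

-- F₀: clique index 0 = vertex 0, index t (1..4) = c_t; I index t = a_{t+1}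
NF₀ : Fin 3 → Fin 5 → Bool
NF₀ a c = mem a (toℕ c)
  where
  mem : Fin 3 → ℕ → Bool
  mem zero             j = (j ≡ᵇ 0) ∨ (j ≡ᵇ 2) ∨ (j ≡ᵇ 3)
  mem (suc zero)       j = (j ≡ᵇ 0) ∨ (j ≡ᵇ 3) ∨ (j ≡ᵇ 4)
  mem (suc (suc zero)) j = (j ≡ᵇ 0) ∨ (j ≡ᵇ 1) ∨ (j ≡ᵇ 4)

F₀ : Graph
F₀ = splitGraph 5 3 NF₀

-- even k-sun: clique index t = c_{t+1}, I index t = a_{t+1};
-- N(a_{t+1}) = {c_{t+1}, c_{t+2}} for t+1 ≤ k-1, and N(a_k) = {c_1, c_k}
NSun : ∀ k → Fin k → Fin k → Bool
NSun k a c = (toℕ c ≡ᵇ toℕ a) ∨ (toℕ c ≡ᵇ suc (toℕ a)) ∨ ((toℕ c ≡ᵇ 0) ∧ (suc (toℕ a) ≡ᵇ k))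

Sun : ℕ → Graph
Sun k = splitGraph k k (NSun k)

-- F₁(k): clique index t = c_{t+1} (t < k-1);
-- I index 0 = b₁, 1 = b₂, t+2 = a_{t+1}
NF₁ : ∀ k → Fin k → Fin (k ∸ 1) → Bool
NF₁ k zero          c = toℕ c <ᵇ (k ∸ 2)
NF₁ k (suc zero)    c = not (toℕ c ≡ᵇ 0)
NF₁ k (suc (suc a)) c = (toℕ c ≡ᵇ toℕ a) ∨ (toℕ c ≡ᵇ suc (toℕ a))

F₁ : ℕ → Graph
F₁ k = splitGraph (k ∸ 1) k (NF₁ k)

-- F₂(k): clique index t = c_{t+1} (t < k); I index 0 = b, t+1 = a_{t+1}
NF₂ : ∀ k → Fin k → Fin k → Bool
NF₂ k zero    c = (0 <ᵇ toℕ c) ∧ (suc (toℕ c) <ᵇ k)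
NF₂ k (suc a) c = (toℕ c ≡ᵇ toℕ a) ∨ (toℕ c ≡ᵇ suc (toℕ a))

F₂ : ℕ → Graph
F₂ k = splitGraph k k (NF₂ k)

{-# OPTIONS --safe #-}
-- Read a word through its prefix counts: two letters alternate iff their counts never differ by more than one, and
-- always in the same direction. The letters of the clique then follow each other cyclically, and a vertex x of the
-- independent set, compared with this rotation, is adjacent to the clique vertices outside an interval of the circle.
-- So its neighbours form a circular arc, and two arcs covering the circle would belong to adjacent vertices. Such a
-- family of arcs is realised by writing the clique three times around the circle, whence R(G) ≤ 3.
--
-- Writing the clique only twice offers two copies of each arc, and arcs that overlap (meet without being nested) must
-- not meet in the word. This is a system of equations modulo 2 on the choices of copies. If it is solvable, R(G) ≤ 2.
-- If not, a shortest odd closed walk is an induced cycle of the overlap graph. Three arcs give F₀. If some arc of the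
-- cycle contains another one, it contains all of them except its two neighbours, and the cycle gives F₁ or F₂;
-- otherwise the arcs go around the circle once and form an even sun.
--
-- Conversely, in a chord diagram of one of these graphs, the end points of a clique chord are told apart by the side
-- of a chord of the independent set on which they lie; this bit changes at each overlap and is otherwise transported
-- along the cycle, which contradicts the parity of its length.
module Submission where

open import Defs hiding (sym)
open import Data.Nat using (ℕ; zero; suc; _+_; _*_; _∸_; _≤_; _<_; z≤n; s≤s; s≤s⁻¹; _≤ᵇ_; _<ᵇ_; _≡ᵇ_; _⊔_; pred; NonZero; >-nonZero)
open import Data.Nat.DivMod using (_%_; _/_; m%n<n; m<n⇒m%n≡m; [m+n]%n≡m%n; [m+kn]%n≡m%n; n%n≡0; m≡m%n+[m/n]*n)
open import Data.Nat.Properties hiding (_≟_; _<?_; _≤?_)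
import Data.Nat.Properties as ℕ
open import Data.Bool using (Bool; true; false; not; _∧_; _∨_; _xor_; if_then_else_; T)
import Data.Bool.Properties as Bool
open import Data.Fin using (Fin; zero; suc; toℕ; fromℕ<; splitAt; join; _↑ˡ_; _↑ʳ_; _≟_)
open import Data.Fin.Properties using (toℕ<n; toℕ-injective; toℕ-fromℕ<; any?; all?; splitAt-↑ˡ; splitAt-↑ʳ; join-splitAt; ↑ˡ-injective; ↑ʳ-injective)
open import Data.Maybe using (Maybe; just; nothing)
open import Data.Maybe.Properties using (just-injective)
open import Data.Vec using (Vec; []; _∷_; lookup; replicate; zipWith; map; allFin)
open import Data.List using (List; []; _∷_; _++_; concatMap; filter; length)
import Data.List as List
open import Data.List.Properties using (∷-injectiveˡ; ∷-injectiveʳ)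
open import Data.List.Membership.Propositional using (_∈_)
open import Data.List.Membership.Propositional.Properties using (∈-allFin; ∈-cartesianProduct⁺)
open import Data.List.Relation.Unary.Any using (here; there)
open import Data.Product using (Σ; ∃; ∃₂; _×_; _,_; -,_; proj₁; proj₂; map₂)
open import Data.Sum using (_⊎_; inj₁; inj₂; [_,_]′; swap)
import Data.Sum as Sum
open import Data.Empty using (⊥; ⊥-elim)
open import Data.Unit using (⊤; tt)
open import Data.Nat.Induction using (<-rec)
open import Function using (_∘_; id; case_of_)
open import Function.Bundles using (_⇔_; mk⇔; Equivalence)
open import Relation.Nullary using (¬_; Dec; yes; no; does; contradiction)
open import Relation.Nullary.Decidable using (_×-dec_; _⊎-dec_; _→-dec_; ¬?; decidable-stable; map′; toWitness)
open import Relation.Unary using (Decidable)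
open import Relation.Binary.PropositionalEquality using (_≡_; _≢_; refl; sym; trans; cong; cong₂; subst; subst₂; module ≡-Reasoning)
open import Relation.Binary.Definitions using (Tri; tri<; tri≈; tri>)
open Equivalence using (to; from)

-- The overlap graph alone does not decide whether R(G) ≤ 2. Two overlapping arcs that meet in the
-- chosen unrolling need different copies, two that meet only one lap later need equal copies. So
-- the edges carry weights modulo 2, and the obstruction is a closed walk of odd weight, not of odd
-- length; this is why cycles of both parities occur among the forbidden graphs. Weight and length
-- are compared in two ways. Arcs through a common point obey a cocycle identity, so a cycle whose
-- arcs lie in one large arc, apart from its two neighbours, has weight equal to its length modulo
-- 2, and k is odd. Arcs that go around the circle once pass the origin of the cover at exactly one
-- overlap, the only one of weight 0, so k is even.
--
-- The arc of x comes from a drift. While the word is read, the number of clique letters minus m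
-- times the number of letters x stays between two extremes, -α and β. Whether the clique vertex at
-- position o alternates with x depends only on o, α and β, and an alternation of x with y would
-- follow from inequalities between their extremes.

-- Linear arithmetic over the natural numbers, by reflection

module Linear where

  open import Data.Integer using (ℤ; +_; -[1+_]; _⊖_)
  import Data.Integer as ℤ

  infixl 7 _:+_
  infixl 8 _:*_
  infix 6 _:≤_ _:<_ _:≡_
  infix 2 _⊢_

  data Expr (n : ℕ) : Set where
    var  : Fin n → Expr n
    con  : ℕ → Expr n
    _:+_ : Expr n → Expr n → Expr n
    _:*_ : ℕ → Expr n → Expr n

  data Formula (n : ℕ) : Set where
    _:≤_ _:<_ _:≡_ : Expr n → Expr n → Formula n
    :⊥ : Formula n

  record Sequent (n : ℕ) : Set where
    constructor _⊢_
    field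
      hyps : List (Formula n)
      goal : Formula n

  Ineq : ℕ → Set
  Ineq n = Expr n × Expr n

  ⟦_⟧ : ∀ {n} → Expr n → Vec ℕ n → ℕ
  ⟦ var i ⟧ ρ = lookup ρ i
  ⟦ con k ⟧ ρ = k
  ⟦ e :+ f ⟧ ρ = ⟦ e ⟧ ρ + ⟦ f ⟧ ρ
  ⟦ k :* e ⟧ ρ = k * ⟦ e ⟧ ρ

  ⟦_⟧F : ∀ {n} → Formula n → Vec ℕ n → Set
  ⟦ e :≤ f ⟧F ρ = ⟦ e ⟧ ρ ≤ ⟦ f ⟧ ρ
  ⟦ e :< f ⟧F ρ = ⟦ e ⟧ ρ < ⟦ f ⟧ ρ
  ⟦ e :≡ f ⟧F ρ = ⟦ e ⟧ ρ ≡ ⟦ f ⟧ ρ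
  ⟦ :⊥ ⟧F ρ = ⊥

  imp : ∀ {n} → List (Formula n) → Formula n → Vec ℕ n → Set
  imp [] g ρ = ⟦ g ⟧F ρ
  imp (h ∷ hs) g ρ = ⟦ h ⟧F ρ → imp hs g ρ

  ⟦_⟧S : ∀ {n} → Sequent n → Vec ℕ n → Set
  ⟦ hs ⊢ g ⟧S = imp hs g

  Holds : ∀ {n} → Vec ℕ n → List (Ineq n) → Set
  Holds ρ [] = ⊤
  Holds ρ ((e , f) ∷ cs) = ⟦ e ⟧ ρ ≤ ⟦ f ⟧ ρ × Holds ρ cs

  -- The constant term is the coefficient of an extra variable with value 1.
  dot : ∀ {n} → Vec ℕ n → Vec ℕ n → ℕ
  dot [] [] = 0
  dot (a ∷ as) (x ∷ xs) = a * x + dot as xs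

  unit : ∀ {n} → Fin n → Vec ℕ n
  unit {suc n} zero = 1 ∷ replicate n 0
  unit (suc i) = 0 ∷ unit i

  coeffs : ∀ {n} → Expr n → Vec ℕ (suc n)
  coeffs (var i) = 0 ∷ unit i
  coeffs {n} (con k) = k ∷ replicate n 0
  coeffs (e :+ f) = zipWith _+_ (coeffs e) (coeffs f)
  coeffs (k :* e) = map (k *_) (coeffs e)

  dot-zero : ∀ {n} (xs : Vec ℕ n) → dot (replicate n 0) xs ≡ 0
  dot-zero [] = refl
  dot-zero (x ∷ xs) = dot-zero xs

  dot-unit : ∀ {n} (i : Fin n) xs → dot (unit i) xs ≡ lookup xs i
  dot-unit zero (x ∷ xs) rewrite dot-zero xs | +-identityʳ x = +-identityʳ x
  dot-unit (suc i) (x ∷ xs) = dot-unit i xs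

  +-interchange : ∀ a b c d → (a + b) + (c + d) ≡ (a + c) + (b + d)
  +-interchange a b c d rewrite +-assoc a b (c + d) | +-assoc a c (b + d)
    | sym (+-assoc b c d) | sym (+-assoc c b d) | +-comm b c = refl

  dot-+ : ∀ {n} (as bs xs : Vec ℕ n) → dot (zipWith _+_ as bs) xs ≡ dot as xs + dot bs xs
  dot-+ [] [] [] = refl
  dot-+ (a ∷ as) (b ∷ bs) (x ∷ xs)
    rewrite dot-+ as bs xs | *-distribʳ-+ x a b = +-interchange (a * x) (b * x) _ _

  dot-* : ∀ {n} k (as xs : Vec ℕ n) → dot (map (k *_) as) xs ≡ k * dot as xs
  dot-* k [] [] = sym (*-zeroʳ k)
  dot-* k (a ∷ as) (x ∷ xs)
    rewrite dot-* k as xs | *-distribˡ-+ k (a * x) (dot as xs) | *-assoc k a x = refl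

  coeffs-sound : ∀ {n} (e : Expr n) ρ → dot (coeffs e) (1 ∷ ρ) ≡ ⟦ e ⟧ ρ
  coeffs-sound (var i) ρ = dot-unit i ρ
  coeffs-sound (con k) ρ rewrite dot-zero ρ | *-identityʳ k = +-identityʳ k
  coeffs-sound (e :+ f) ρ
    rewrite dot-+ (coeffs e) (coeffs f) (1 ∷ ρ) = cong₂ _+_ (coeffs-sound e ρ) (coeffs-sound f ρ)
  coeffs-sound (k :* e) ρ
    rewrite dot-* k (coeffs e) (1 ∷ ρ) = cong (k *_) (coeffs-sound e ρ)

  combine : ∀ {n} → List ℕ → List (Ineq n) → Ineq n
  combine (m ∷ ms) ((e , f) ∷ cs) with combine ms cs
  ... | l , r = m :* e :+ l , m :* f :+ r
  combine _ _ = con 0 , con 0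

  combine-sound : ∀ {n} ρ ms (cs : List (Ineq n)) → Holds ρ cs →
    ⟦ proj₁ (combine ms cs) ⟧ ρ ≤ ⟦ proj₂ (combine ms cs) ⟧ ρ
  combine-sound ρ [] cs h = z≤n
  combine-sound ρ (m ∷ ms) [] h = z≤n
  combine-sound ρ (m ∷ ms) ((e , f) ∷ cs) (p , h) =
    +-mono-≤ (*-monoʳ-≤ m p) (combine-sound ρ ms cs h)

  all≤ : ∀ {n} → Vec ℕ n → Vec ℕ n → Bool
  all≤ [] [] = true
  all≤ (a ∷ as) (b ∷ bs) = (a ≤ᵇ b) ∧ all≤ as bs

  ∧-split : ∀ a {b} → T (a ∧ b) → T a × T b
  ∧-split true t = tt , t

  all≤-sound : ∀ {n} (as bs xs : Vec ℕ n) → T (all≤ as bs) → dot as xs ≤ dot bs xs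
  all≤-sound [] [] [] _ = z≤n
  all≤-sound (a ∷ as) (b ∷ bs) (x ∷ xs) t with ∧-split (a ≤ᵇ b) t
  ... | p , q = +-mono-≤ (*-monoˡ-≤ x (≤ᵇ⇒≤ a b p)) (all≤-sound as bs xs q)

  -- The variables are natural numbers, so l ≤ r fails as soon as every coefficient of r is at most
  -- the one of l and the constant term is strictly smaller.
  absurd : ∀ {n} → Vec ℕ (suc n) → Vec ℕ (suc n) → Bool
  absurd (a ∷ as) (b ∷ bs) = (b <ᵇ a) ∧ all≤ bs as

  refutes : ∀ {n} → List ℕ → List (Ineq n) → Bool
  refutes ms cs with combine ms cs
  ... | l , r = absurd (coeffs l) (coeffs r)

  absurd-sound : ∀ {n} (as bs : Vec ℕ (suc n)) ρ → T (absurd as bs) → dot bs (1 ∷ ρ) < dot as (1 ∷ ρ)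
  absurd-sound (a ∷ as) (b ∷ bs) ρ t with ∧-split (b <ᵇ a) t
  ... | p , q rewrite *-identityʳ a | *-identityʳ b = +-mono-<-≤ (<ᵇ⇒< b a p) (all≤-sound bs as ρ q)

  refutes-sound : ∀ {n} ρ ms (cs : List (Ineq n)) → T (refutes ms cs) → ¬ Holds ρ cs
  refutes-sound ρ ms cs t h with combine ms cs | combine-sound ρ ms cs h
  ... | l , r | p = <⇒≱ (absurd-sound (coeffs l) (coeffs r) ρ t)
    (subst₂≤ (sym (coeffs-sound l ρ)) (sym (coeffs-sound r ρ)) p)
    where
    subst₂≤ : ∀ {a b c d : ℕ} → a ≡ c → b ≡ d → a ≤ b → c ≤ d
    subst₂≤ refl refl q = q

  -- Fourier–Motzkin elimination, only used to guess the multipliers.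
  -- A row stands for a₀ + Σ aᵢ xᵢ ≥ 0, with the multipliers that produced it.
  Row : ℕ → Set
  Row n = Vec ℤ n × List ℕ

  addMult : List ℕ → List ℕ → List ℕ
  addMult [] ys = ys
  addMult xs [] = xs
  addMult (x ∷ xs) (y ∷ ys) = (x + y) ∷ addMult xs ys

  rowComb : ∀ {n} → ℕ → Row n → ℕ → Row n → Row n
  rowComb k (v , ms) l (w , ns) =
    zipWith (λ a b → (+ k ℤ.* a) ℤ.+ (+ l ℤ.* b)) v w
    , addMult (List.map (k *_) ms) (List.map (l *_) ns)

  record Split (n : ℕ) : Set where
    constructor split
    field
      pos neg : List (ℕ × Row n)
      nil     : List (Row n)

  splitRows : ∀ {n} → List (Row (suc n)) → Split n
  splitRows [] = split [] [] []
  splitRows ((a ∷ v , ms) ∷ rs) with splitRows rs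
  ... | split ps ns zs with a
  ... | + zero     = split ps ns ((v , ms) ∷ zs)
  ... | + (suc k)  = split ((suc k , v , ms) ∷ ps) ns zs
  ... | -[1+ k ]   = split ps ((suc k , v , ms) ∷ ns) zs

  -- A row without negative entries holds for all natural numbers and cannot contribute to a
  -- contradiction.
  useful : ∀ {n} → Row n → Bool
  useful (v , ms) = some v
    where
    some : ∀ {n} → Vec ℤ n → Bool
    some [] = false
    some (-[1+ _ ] ∷ _) = true
    some (+ _ ∷ v) = some v

  keep : ∀ {n} → List (Row n) → List (Row n)
  keep [] = []
  keep (r ∷ rs) = if useful r then r ∷ keep rs else keep rs

  eliminate : ∀ {n} → List (Row (suc n)) → List (Row n)
  eliminate {n} rs with splitRows rs
  -- A row with a negative coefficient also survives alone, with the variable dropped: this is its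
  -- combination with the implicit fact that the variable is nonnegative.
  ... | split ps ns zs = keep (zs ++ List.map proj₂ ns ++ concatMap
      (λ (k , r) → List.map (λ (l , s) → rowComb l r k s) ns) ps)

  search : ∀ {n} → List (Row (n + 1)) → List ℕ
  search {zero} [] = []
  search {zero} ((-[1+ _ ] ∷ _ , ms) ∷ _) = ms
  search {zero} (_ ∷ rs) = search {zero} rs
  search {suc n} rs = search {n} (eliminate rs)

  -- With the constant term in the last place, it is what remains once all variables have been
  -- eliminated from the front.
  rotate : ∀ {n} → Vec ℤ (suc n) → Vec ℤ (n + 1)
  rotate {zero} v = v
  rotate {suc n} (a ∷ b ∷ v) = b ∷ rotate (a ∷ v)

  rows : ∀ {n} → List ℕ → List (Ineq n) → List (Row (n + 1))
  rows pre [] = []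
  rows pre ((e , f) ∷ cs) =
    (rotate (zipWith _⊖_ (coeffs f) (coeffs e)) , pre ++ 1 ∷ []) ∷ rows (0 ∷ pre) cs

  ineqs : ∀ {n} → Formula n → List (Ineq n) → List (Ineq n)
  ineqs (e :≤ f) cs = (e , f) ∷ cs
  ineqs (e :< f) cs = (con 1 :+ e , f) ∷ cs
  ineqs (e :≡ f) cs = (e , f) ∷ (f , e) ∷ cs
  ineqs :⊥ cs = (con 1 , con 0) ∷ cs

  ineqs-sound : ∀ {n} ρ (φ : Formula n) cs → ⟦ φ ⟧F ρ → Holds ρ cs → Holds ρ (ineqs φ cs)
  ineqs-sound ρ (e :≤ f) cs p h = p , h
  ineqs-sound ρ (e :< f) cs p h = p , h
  ineqs-sound ρ (e :≡ f) cs p h = ≤-reflexive p , ≤-reflexive (sym p) , h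
  ineqs-sound ρ :⊥ cs () h

  refutable : ∀ {n} → List (Ineq n) → Bool
  refutable cs = refutes (search (rows [] cs)) cs

  provable : ∀ {n} → List (Formula n) → Formula n → List (Ineq n) → Bool
  provable [] (e :≤ f) cs = refutable ((con 1 :+ f , e) ∷ cs)
  provable [] (e :< f) cs = refutable ((f , e) ∷ cs)
  provable [] (e :≡ f) cs = refutable ((con 1 :+ f , e) ∷ cs) ∧ refutable ((con 1 :+ e , f) ∷ cs)
  provable [] :⊥ cs = refutable cs
  provable (h ∷ hs) g cs = provable hs g (ineqs h cs)

  refute : ∀ {n} ρ (cs : List (Ineq n)) → T (refutable cs) → Holds ρ cs → ⊥
  refute ρ cs = refutes-sound ρ (search (rows [] cs)) cs

  provable-sound : ∀ {n} ρ (hs : List (Formula n)) g cs → T (provable hs g cs) → Holds ρ cs → imp hs g ρ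
  provable-sound ρ [] (e :≤ f) cs t h = ≮⇒≥ λ p → refute ρ _ t (p , h)
  provable-sound ρ [] (e :< f) cs t h = ≰⇒> λ p → refute ρ _ t (p , h)
  provable-sound ρ [] (e :≡ f) cs t h with ∧-split (refutable ((con 1 :+ f , e) ∷ cs)) t
  ... | t₁ , t₂ = ≤-antisym (≮⇒≥ λ p → refute ρ _ t₁ (p , h)) (≮⇒≥ λ p → refute ρ _ t₂ (p , h))
  provable-sound ρ [] :⊥ cs t h = refute ρ cs t h
  provable-sound ρ (φ ∷ hs) g cs t h = λ p → provable-sound ρ hs g (ineqs φ cs) t (ineqs-sound ρ φ cs p h)

  valid : ∀ {n} → Sequent n → Bool
  valid (hs ⊢ g) = provable hs g []

  vars : ∀ {n} → Vec (Expr n) n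
  vars {n} = map var (allFin n)

  Fun : ℕ → (A B : Set) → Set
  Fun zero A B = B
  Fun (suc n) A B = A → Fun n A B

  app : ∀ {n A B} → Fun n A B → Vec A n → B
  app f [] = f
  app f (x ∷ xs) = app (f x) xs

  All : ∀ n → (Vec ℕ n → Set) → Set
  All zero P = P []
  All (suc n) P = ∀ x → All n (λ xs → P (x ∷ xs))

  gen : ∀ n {P : Vec ℕ n → Set} → (∀ ρ → P ρ) → All n P
  gen zero f = f []
  gen (suc n) f = λ x → gen n (λ ρ → f (x ∷ ρ))

  -- The hidden argument is found by evaluation: when the search succeeds its type reduces to the
  -- unit type. Nonlinear terms such as `C x t * m` are passed as opaque variables.
  lia : ∀ n (f : Fun n (Expr n) (Sequent n)) {_ : T (valid (app f vars))} →
    All n (⟦ app f vars ⟧S)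
  lia n f {t} = gen n (λ ρ → provable-sound ρ (Sequent.hyps (app f vars)) (Sequent.goal (app f vars)) [] t tt)

open Linear using (lia; con; _:+_; _:*_; _:≤_; _:<_; _:≡_; :⊥; _⊢_)

-- Finite sums, and alternation in terms of prefix counts and occurrence times

infixl 4 _⇔∘_

_⇔∘_ : ∀ {A B C : Set} → A ⇔ B → B ⇔ C → A ⇔ C
f ⇔∘ g = mk⇔ (to g ∘ to f) (from f ∘ from g)

∑ : ∀ {n} → (Fin n → ℕ) → ℕ
∑ {zero} f = 0
∑ {suc n} f = f zero + ∑ (f ∘ suc)

∑-mono : ∀ {n} {f g : Fin n → ℕ} → (∀ i → f i ≤ g i) → ∑ f ≤ ∑ g
∑-mono {zero} p = z≤n
∑-mono {suc n} p = +-mono-≤ (p zero) (∑-mono (p ∘ suc))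

∑-cong : ∀ {n} {f g : Fin n → ℕ} → (∀ i → f i ≡ g i) → ∑ f ≡ ∑ g
∑-cong {zero} p = refl
∑-cong {suc n} p = cong₂ _+_ (p zero) (∑-cong (p ∘ suc))

∑-+ : ∀ {n} (f g : Fin n → ℕ) → ∑ (λ i → f i + g i) ≡ ∑ f + ∑ g
∑-+ {zero} f g = refl
∑-+ {suc n} f g rewrite ∑-+ (f ∘ suc) (g ∘ suc) = Linear.+-interchange (f zero) (g zero) _ _

∑-* : ∀ {n} k (f : Fin n → ℕ) → ∑ (λ i → f i * k) ≡ ∑ f * k
∑-* {zero} k f = refl
∑-* {suc n} k f rewrite ∑-* k (f ∘ suc) = sym (*-distribʳ-+ k (f zero) _)

∑-zero : ∀ {n} {f : Fin n → ℕ} → (∀ i → f i ≡ 0) → ∑ f ≡ 0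
∑-zero {zero} p = refl
∑-zero {suc n} p = cong₂ _+_ (p zero) (∑-zero (p ∘ suc))

term≤∑ : ∀ {n} (f : Fin n → ℕ) i → f i ≤ ∑ f
term≤∑ f zero = m≤m+n _ _
term≤∑ f (suc i) = ≤-trans (term≤∑ (f ∘ suc) i) (m≤n+m _ (f zero))

hit : ∀ {n} → Maybe (Fin n) → Fin n → ℕ
hit nothing a = 0
hit (just x) a with x ≟ a
... | yes _ = 1
... | no _ = 0

hit-self : ∀ {n} (a : Fin n) → hit (just a) a ≡ 1
hit-self a with a ≟ a
... | yes _ = refl
... | no ¬p = contradiction refl ¬p

hit-other : ∀ {n} {x a : Fin n} → x ≢ a → hit (just x) a ≡ 0
hit-other {x = x} {a} ¬p with x ≟ a
... | yes p = contradiction p ¬p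
... | no _ = refl

hit-miss : ∀ {n} (m : Maybe (Fin n)) {a} → m ≢ just a → hit m a ≡ 0
hit-miss nothing _ = refl
hit-miss (just x) ¬p = hit-other λ { refl → ¬p refl }

-- Words are spread over time slots, each holding at most one letter.
Slots : ℕ → Set
Slots n = ℕ → Maybe (Fin n)

push : ∀ {n} → Maybe (Fin n) → Word n → Word n
push nothing w = w
push (just x) w = x ∷ w

build : ∀ {n} → Slots n → ℕ → Word n
build g zero = []
build g (suc t) = push (g 0) (build (g ∘ suc) t)

count : ∀ {n} → Slots n → Fin n → ℕ → ℕ
count g a zero = 0
count g a (suc t) = hit (g 0) a + count (g ∘ suc) a t

count-step : ∀ {n} (g : Slots n) a t → count g a (suc t) ≡ count g a t + hit (g t) a
count-step g a zero = +-comm (hit (g 0) a) 0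
count-step g a (suc t) rewrite count-step (g ∘ suc) a t = sym (+-assoc (hit (g 0) a) _ _)

count-mono : ∀ {n} (g : Slots n) a {s t} → s ≤ t → count g a s ≤ count g a t
count-mono g a z≤n = z≤n
count-mono g a (s≤s p) = +-monoʳ-≤ (hit (g 0) a) (count-mono (g ∘ suc) a p)

count-hit : ∀ {n} (g : Slots n) {a t} → g t ≡ just a → count g a (suc t) ≡ suc (count g a t)
count-hit g {a} {t} eq rewrite count-step g a t | eq | hit-self a = +-comm (count g a t) 1

count-miss : ∀ {n} (g : Slots n) {a t} → g t ≢ just a → count g a (suc t) ≡ count g a t
count-miss g {a} {t} ne rewrite count-step g a t | hit-miss (g t) ne = +-identityʳ _

occ-build : ∀ {n} (g : Slots n) a t → occ a (build g t) ≡ count g a t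
occ-build g a zero = refl
occ-build g a (suc t) with g 0
... | nothing = occ-build (g ∘ suc) a t
... | just x with x ≟ a
...   | yes _ = cong suc (occ-build (g ∘ suc) a t)
...   | no _ = occ-build (g ∘ suc) a t

nth : ∀ {n} → Word n → Slots n
nth [] _ = nothing
nth (x ∷ w) zero = just x
nth (x ∷ w) (suc i) = nth w i

build-nth : ∀ {n} (w : Word n) → build (nth w) (length w) ≡ w
build-nth [] = refl
build-nth (x ∷ w) = cong (x ∷_) (build-nth w)

-- The prefix-count form of `restrict w a b ≡ alt a b k`. Unlike the equation of lists it is a
-- family of inequalities, which can be chained through the counts of other letters.
Leads : ∀ {n} → Slots n → ℕ → Fin n → Fin n → Set
Leads g l a b = ∀ t → t ≤ l → count g b t ≤ count g a t × count g a t ≤ suc (count g b t)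

module _ {n : ℕ} {P : Fin n → Set} (P? : Decidable P) where

  Pair : Fin n → Fin n → Set
  Pair a b = a ≢ b × P a × P b × (∀ {x} → P x → x ≡ a ⊎ x ≡ b)

  flip-pair : ∀ {a b} → Pair a b → Pair b a
  flip-pair (a≢b , pa , pb , p) = a≢b ∘ sym , pb , pa , swap ∘ p

  -- Reading one letter exchanges the roles of the two letters, as in `alt`: the lower bound for the
  -- tail becomes the upper bound for the whole word, and conversely.
  alt⇒leads : ∀ {a b} → Pair a b → ∀ l g k → filter P? (build g l) ≡ alt a b k → Leads g l a b
  alt⇒leads _ l g k eq zero _ = z≤n , z≤n
  alt⇒leads {a} {b} ab (suc l) g k eq (suc t) (s≤s t≤l) with g 0
  ... | nothing = alt⇒leads ab l (g ∘ suc) k eq t t≤l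
  ... | just c with P? c
  alt⇒leads {a} {b} ab@(a≢b , pa , pb , p) (suc l) g k eq (suc t) (s≤s t≤l) | just c | no ¬pc
    rewrite hit-other {x = c} {a} (λ { refl → ¬pc pa }) | hit-other {x = c} {b} (λ { refl → ¬pc pb })
    = alt⇒leads ab l (g ∘ suc) k eq t t≤l
  alt⇒leads {a} {b} ab@(a≢b , pa , pb , p) (suc l) g (suc k) eq (suc t) (s≤s t≤l) | just c | yes pc
    with p pc
  ... | inj₂ refl with () ← a≢b (sym (∷-injectiveˡ eq))
  ... | inj₁ refl rewrite hit-self a | hit-other a≢b
    with alt⇒leads (flip-pair ab) l (g ∘ suc) k (∷-injectiveʳ eq) t t≤l
  ... | q , r = r , s≤s q
  alt⇒leads ab (suc l) g zero () (suc t) (s≤s t≤l) | just c | yes pc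

  leads⇒alt : ∀ {a b} → Pair a b → ∀ l g → Leads g l a b → ∃ λ k → filter P? (build g l) ≡ alt a b k
  leads⇒alt ab zero g ld = 0 , refl
  leads⇒alt {a} {b} ab@(a≢b , pa , pb , p) (suc l) g ld = go (g 0) λ t t≤l → ld (suc t) (s≤s t≤l)
    where
    cnt = count (g ∘ suc)
    go : ∀ m → (∀ t → t ≤ l → hit m b + cnt b t ≤ hit m a + cnt a t × hit m a + cnt a t ≤ suc (hit m b + cnt b t)) →
      ∃ λ k → filter P? (push m (build (g ∘ suc) l)) ≡ alt a b k
    go nothing ld′ = leads⇒alt ab l (g ∘ suc) ld′
    go (just c) ld′ with P? c
    ... | no ¬pc = leads⇒alt ab l (g ∘ suc) λ t t≤l → subst₂
      (λ x y → y + cnt b t ≤ x + cnt a t × x + cnt a t ≤ suc (y + cnt b t))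
      (hit-other {x = c} {a} (λ { refl → ¬pc pa })) (hit-other {x = c} {b} (λ { refl → ¬pc pb })) (ld′ t t≤l)
    ... | yes pc with p pc
    ...   | inj₂ refl with () ← subst₂ (λ x y → x + 0 ≤ y + 0) (hit-self b) (hit-other (a≢b ∘ sym))
        (proj₁ (ld′ 0 z≤n))
    ...   | inj₁ refl with leads⇒alt (flip-pair ab) l (g ∘ suc) (λ t t≤l →
      let q , r = subst₂ (λ x y → y + cnt b t ≤ x + cnt a t × x + cnt a t ≤ suc (y + cnt b t))
                    (hit-self a) (hit-other a≢b) (ld′ t t≤l) in s≤s⁻¹ r , q)
    ...     | k , eq = suc k , cong (a ∷_) eq

alternate⇔leads : ∀ {n} (g : Slots n) l {a b} → a ≢ b →
  Alternate (build g l) a b ⇔ (Leads g l a b ⊎ Leads g l b a)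
alternate⇔leads g l {a} {b} a≢b = mk⇔
  (λ { (k , inj₁ eq) → inj₁ (alt⇒leads P? ab l g k eq)
     ; (k , inj₂ eq) → inj₂ (alt⇒leads P? (flip-pair P? ab) l g k eq) })
  (λ { (inj₁ ld) → map₂ inj₁ (leads⇒alt P? ab l g ld)
     ; (inj₂ ld) → map₂ inj₂ (leads⇒alt P? (flip-pair P? ab) l g ld) })
  where
  P? = λ x → (x ≟ a) ⊎-dec (x ≟ b)
  ab : Pair P? a b
  ab = a≢b , inj₁ refl , inj₂ refl , id

Interleave : ℕ → (ℕ → ℕ) → (ℕ → ℕ) → Set
Interleave k u v = (∀ i → i < k → u i < v i) × (∀ i → suc i < k → v i < u (suc i))

-- `u i` is the time of occurrence number i, counted from 0. The equivalence `rank` turns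
-- inequalities between times into inequalities between counts and back.
record Ranked {n} (g : Slots n) (l k : ℕ) (a : Fin n) (u : ℕ → ℕ) : Set where
  field
    rank   : ∀ i t → i < k → t ≤ l → u i < t ⇔ i < count g a t
    bound  : ∀ i → i < k → u i < l
    count≤ : ∀ t → t ≤ l → count g a t ≤ k

leads⇔interleave : ∀ {n} {g : Slots n} {l k a b u v} → Ranked g l k a u → Ranked g l k b v →
  (∀ i j → i < k → j < k → u i ≢ v j) → Leads g l a b ⇔ Interleave k u v
leads⇔interleave {g = g} {l} {k} {a} {b} {u} {v} A B u≢v = mk⇔
  (λ ld →
    (λ i i<k →
      let w = B.bound i i<k in
      ≤∧≢⇒< (s≤s⁻¹ (from (A.rank i (suc (v i)) i<k w)
        (≤-trans (to (B.rank i (suc (v i)) i<k w) ≤-refl) (proj₁ (ld (suc (v i)) w))))) (u≢v i i i<k i<k))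
    , λ i i<k →
      let w = A.bound (suc i) i<k
          j<k = <-trans ≤-refl i<k in
      ≤∧≢⇒< (s≤s⁻¹ (from (B.rank i (suc (u (suc i))) j<k w)
        (s≤s⁻¹ (≤-trans (to (A.rank (suc i) (suc (u (suc i))) i<k w) ≤-refl) (proj₂ (ld (suc (u (suc i))) w))))))
        (u≢v (suc i) i i<k j<k ∘ sym))
  (λ { (p , q) t t≤l → below p t t≤l (count g b t) refl , above q t t≤l (count g a t) refl })
  where
  module A = Ranked A
  module B = Ranked B
  below : (∀ i → i < k → u i < v i) → ∀ t → t ≤ l → ∀ c → count g b t ≡ c → c ≤ count g a t
  below p t t≤l zero eq = z≤n
  below p t t≤l (suc i) eq =
    let i<k = subst (_≤ k) eq (B.count≤ t t≤l) in
    to (A.rank i t i<k t≤l) (<-trans (p i i<k) (from (B.rank i t i<k t≤l) (≤-reflexive (sym eq))))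
  above : (∀ i → suc i < k → v i < u (suc i)) → ∀ t → t ≤ l → ∀ c → count g a t ≡ c → c ≤ suc (count g b t)
  above q t t≤l zero eq = z≤n
  above q t t≤l (suc zero) eq = s≤s z≤n
  above q t t≤l (suc (suc i)) eq =
    let i<k = subst (_≤ k) eq (A.count≤ t t≤l) in
    s≤s (to (B.rank i t (<-trans ≤-refl i<k) t≤l)
      (<-trans (q i i<k) (from (A.rank (suc i) t i<k t≤l) (≤-reflexive (sym eq)))))

alternate⇔interleave : ∀ {n} {g : Slots n} {l k a b u v} → a ≢ b → Ranked g l k a u → Ranked g l k b v →
  (∀ i j → i < k → j < k → u i ≢ v j) →
  Alternate (build g l) a b ⇔ (Interleave k u v ⊎ Interleave k v u)
alternate⇔interleave {g = g} {l} a≢b A B u≢v = alternate⇔leads g l a≢b ⇔∘ mk⇔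
  (Sum.map (to (leads⇔interleave A B u≢v)) (to (leads⇔interleave B A (λ i j p q → u≢v j i q p ∘ sym))))
  (Sum.map (from (leads⇔interleave A B u≢v)) (from (leads⇔interleave B A (λ i j p q → u≢v j i q p ∘ sym))))

occurrence : ∀ {n} (g : Slots n) a l i → i < count g a l → ∃ λ t → t < l × count g a t ≡ i × g t ≡ just a
occurrence g a (suc l) i i<c with count g a l ℕ.≤? i | (λ ne → count-miss g {a} {l} ne)
... | no ¬p | _ = let t , t<l , r = occurrence g a l i (≰⇒> ¬p) in t , <-trans t<l ≤-refl , r
... | yes p | miss with g l in eq
...   | nothing = contradiction (subst (i <_) (miss λ ()) i<c) (≤⇒≯ p)
...   | just x with x ≟ a
...     | no ne = contradiction (subst (i <_) (miss λ { refl → ne refl }) i<c) (≤⇒≯ p)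
...     | yes refl = l , ≤-refl , ≤-antisym p (s≤s⁻¹ (subst (i <_) (count-hit g eq) i<c)) , eq

record Timing {n} (w : Word n) (k : ℕ) : Set where
  field
    time  : Fin n → ℕ → ℕ
    incr  : ∀ a i j → i < j → j < k → time a i < time a j
    apart : ∀ {a b} i j → i < k → j < k → time a i ≡ time b j → a ≡ b
    alternate : ∀ a b → a ≢ b →
      Alternate w a b ⇔ (Interleave k (time a) (time b) ⊎ Interleave k (time b) (time a))

timing : ∀ {n} (w : Word n) k → Uniform k w → Timing w k
timing {n} w k uni = record
  { time = u
  ; incr = λ a i j i<j j<k → from (Ranked.rank (ranked a) i (u a j) (<-trans i<j j<k)
      (<⇒≤ (Ranked.bound (ranked a) j j<k)))
      (subst (i <_) (sym (proj₁ (u-spec a j j<k))) i<j)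
  ; apart = apart
  ; alternate = λ a b a≢b → subst (λ v → Alternate v a b ⇔ (Interleave k (u a) (u b) ⊎ Interleave k (u b) (u a)))
      (build-nth w)
      (alternate⇔interleave a≢b (ranked a) (ranked b) (λ i j p q → a≢b ∘ apart i j p q)) }
  where
  g = nth w
  l = length w
  total : ∀ a → count g a l ≡ k
  total a = trans (sym (occ-build g a l)) (trans (cong (occ a) (build-nth w)) (uni a))
  find : ∀ a i → i < k → ∃ λ t → t < l × count g a t ≡ i × g t ≡ just a
  find a i i<k = occurrence g a l i (subst (i <_) (sym (total a)) i<k)
  u : Fin n → ℕ → ℕ
  u a i with i ℕ.<? k
  ... | yes p = proj₁ (find a i p)
  ... | no _ = 0
  u-bound : ∀ a i → i < k → u a i < l
  u-bound a i i<k with i ℕ.<? k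
  ... | yes p = proj₁ (proj₂ (find a i p))
  ... | no ¬p = contradiction i<k ¬p
  u-spec : ∀ a i → i < k → count g a (u a i) ≡ i × g (u a i) ≡ just a
  u-spec a i i<k with i ℕ.<? k
  ... | yes p = proj₂ (proj₂ (find a i p))
  ... | no ¬p = contradiction i<k ¬p
  apart : ∀ {a b} i j → i < k → j < k → u a i ≡ u b j → a ≡ b
  apart {a} {b} i j i<k j<k eq =
    just-injective (trans (sym (proj₂ (u-spec a i i<k))) (trans (cong g eq) (proj₂ (u-spec b j j<k))))
  ranked : ∀ a → Ranked g l k a (u a)
  ranked a = record
    { rank = λ i t i<k t≤l → let eq , h = u-spec a i i<k in mk⇔
        (λ p → ≤-trans (≤-reflexive (sym (trans (count-hit g h) (cong suc eq)))) (count-mono g a p))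
        (λ p → ≰⇒> λ q → <⇒≱ p (subst (count g a t ≤_) eq (count-mono g a q)))
    ; bound = u-bound a
    ; count≤ = λ t t≤l → subst (count g a t ≤_) (total a) (count-mono g a t≤l) }

lex : ∀ {a b n r} s → a < b → r < n → a * n + r < b * n + s
lex {a} {b} {n} {r} s a<b r<n = begin-strict
  a * n + r <⟨ +-monoʳ-< (a * n) r<n ⟩
  a * n + n ≡⟨ +-comm (a * n) n ⟩
  suc a * n ≤⟨ *-monoˡ-≤ n a<b ⟩
  b * n     ≤⟨ m≤m+n _ s ⟩
  b * n + s ∎
  where open ≤-Reasoning

lex-inj : ∀ {a b n r s} → r < n → s < n → a * n + r ≡ b * n + s → a ≡ b × r ≡ s
lex-inj {a} {b} {n} {r} {s} r<n s<n eq with <-cmp a b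
... | tri< a<b _ _ = contradiction eq (<⇒≢ (lex s a<b r<n))
... | tri> _ _ b<a = contradiction (sym eq) (<⇒≢ (lex r b<a s<n))
... | tri≈ _ refl _ = refl , +-cancelˡ-≡ (a * n) r s eq

-- Ties between equal keys are broken by the index of the letter.
refine : ∀ {n} → (Fin n → ℕ → ℕ) → Fin n → ℕ → ℕ
refine {n} key a i = key a i * n + toℕ a

refine-< : ∀ {n} (key : Fin n → ℕ → ℕ) a i b j → key a i < key b j → refine key a i < refine key b j
refine-< key a i b j p = lex (toℕ b) p (toℕ<n a)

-- The occurrences are sorted by refined key without a sorting algorithm: the slot at time t holds
-- the letter one of whose refined keys is t, and all other slots stay empty. Later constructions
-- only have to choose keys.
wordFromKeys : ∀ {n} k (key : Fin n → ℕ → ℕ) → (∀ a i j → i < j → j < k → key a i < key a j) →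
  ∃ λ (w : Word n) → Uniform k w × (∀ a b → a ≢ b → Alternate w a b ⇔
    (Interleave k (refine key a) (refine key b) ⊎ Interleave k (refine key b) (refine key a)))
wordFromKeys {n} k key incr = build g l , uniform , λ a b a≢b →
  alternate⇔interleave a≢b (ranked a) (ranked b) (λ i j _ _ eq → a≢b (proj₁ (u-inj i j eq)))
  where
  u = refine key
  u-incr : ∀ a i j → i < j → j < k → u a i < u a j
  u-incr a i j i<j j<k = refine-< key a i a j (incr a i j i<j j<k)
  u-inj : ∀ {a b} i j → u a i ≡ u b j → a ≡ b × key a i ≡ key b j
  u-inj {a} {b} i j eq with lex-inj (toℕ<n a) (toℕ<n b) eq
  ... | p , q = toℕ-injective q , p
  here? : ∀ t a → Dec (∃ λ i → i < k × u a i ≡ t)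
  here? t a = ℕ.anyUpTo? (λ i → u a i ℕ.≟ t) k
  g : Slots n
  g t with any? (here? t)
  ... | yes (a , _) = just a
  ... | no _ = nothing
  g⇒ : ∀ t a → g t ≡ just a → ∃ λ i → i < k × u a i ≡ t
  g⇒ t a eq with any? (here? t)
  g⇒ t a refl | yes (.a , r) = r
  g⇐ : ∀ a i → i < k → g (u a i) ≡ just a
  g⇐ a i i<k with any? (here? (u a i))
  ... | yes (b , j , _ , eq) = cong just (proj₁ (u-inj j i eq))
  ... | no ¬p = contradiction (a , i , i<k , refl) ¬p
  l : ℕ
  l = suc (∑ (λ a → u a (pred k)))
  u-bound : ∀ a i → i < k → u a i < l
  u-bound a i i<k = s≤s (≤-trans (last i k i<k incr-a) (term≤∑ (λ a → u a (pred k)) a))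
    where
    incr-a = u-incr a
    last : ∀ i k → i < k → (∀ i j → i < j → j < k → u a i < u a j) → u a i ≤ u a (pred k)
    last i (suc k) (s≤s i≤k) inc with m≤n⇒m<n∨m≡n i≤k
    ... | inj₁ p = <⇒≤ (inc i k p ≤-refl)
    ... | inj₂ refl = ≤-refl
  ranks : ∀ a t → count g a t ≤ k × (∀ i → i < k → u a i < t ⇔ i < count g a t)
  ranks a zero = z≤n , λ i i<k → mk⇔ (λ ()) (λ ())
  ranks a (suc t) with here? t a | ranks a t
  ... | no ¬p | c≤k , r rewrite count-miss g {a} {t} (¬p ∘ g⇒ t a) = c≤k , λ i i<k →
      mk⇔ (λ q → to (r i i<k) (≤∧≢⇒< (s≤s⁻¹ q) λ eq → ¬p (i , i<k , eq)))
          (λ q → <-trans (from (r i i<k) q) ≤-refl)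
  ... | yes (j , j<k , refl) | c≤k , r = subst (_≤ k) (sym c≡) j<k , λ i i<k →
      mk⇔ (λ q → subst (i <_) (sym c≡) (s≤s (≮⇒≥ λ j<i → <⇒≱ (u-incr a j i j<i i<k) (s≤s⁻¹ q))))
          (λ q → s≤s (le i (s≤s⁻¹ (subst (i <_) c≡ q))))
    where
    j≤c : ∀ j′ → j′ ≤ j → j′ ≤ count g a (u a j)
    j≤c zero _ = z≤n
    j≤c (suc i) i<j = to (r i (<-trans i<j j<k)) (u-incr a i j i<j j<k)
    c≡ : count g a (suc (u a j)) ≡ suc j
    c≡ = trans (count-hit g (g⇐ a j j<k)) (cong suc (≤-antisym
      (≮⇒≥ λ p → <-irrefl refl (from (r j j<k) p)) (j≤c j ≤-refl)))
    le : ∀ i → i ≤ j → u a i ≤ u a j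
    le i i≤j with m≤n⇒m<n∨m≡n i≤j
    ... | inj₁ p = <⇒≤ (u-incr a i j p j<k)
    ... | inj₂ refl = ≤-refl
  ranked : ∀ a → Ranked g l k a (u a)
  ranked a = record
    { rank = λ i t i<k _ → proj₂ (ranks a t) i i<k
    ; bound = u-bound a
    ; count≤ = λ t _ → proj₁ (ranks a t) }
  uniform : Uniform k (build g l)
  uniform a = trans (occ-build g a l) (≤-antisym (proj₁ (ranks a l)) (k≤ k ≤-refl))
    where
    k≤ : ∀ k′ → k′ ≤ k → k′ ≤ count g a l
    k≤ zero _ = z≤n
    k≤ (suc i) p = to (proj₂ (ranks a l) i p) (u-bound a i p)

-- Circular arcs read off from a representing word, with the counting they need

when : Bool → ℕ → ℕ
when b k = if b then k else 0

𝟙 : Bool → ℕ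
𝟙 b = when b 1

𝟙-true : ∀ {b} → T b → 𝟙 b ≡ 1
𝟙-true {true} _ = refl

𝟙-false : ∀ {b} → ¬ T b → 𝟙 b ≡ 0
𝟙-false {false} _ = refl
𝟙-false {true} p = contradiction tt p

𝟙≤1 : ∀ b → 𝟙 b ≤ 1
𝟙≤1 true = ≤-refl
𝟙≤1 false = z≤n

∑-single : ∀ {n} {f : Fin n → ℕ} c → (∀ d → d ≢ c → f d ≡ 0) → ∑ f ≡ f c
∑-single {f = f} zero p = trans (cong (f zero +_) (∑-zero λ i → p (suc i) λ ())) (+-identityʳ _)
∑-single (suc c) p = cong₂ _+_ (p zero λ ()) (∑-single c λ d d≢c → p (suc d) λ { refl → d≢c refl })

-- Let `cum t` be the number of marked elements with position below t. By injectivity each position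
-- adds at most one, so `cum t ≤ t`; a missed position j makes this strict for all t > j, against
-- `cum m ≡ m`.
onto : ∀ {n} (S : Fin n → Bool) (pos : Fin n → ℕ) → let m = ∑ (𝟙 ∘ S) in
  (∀ {c} → S c ≡ true → pos c < m) →
  (∀ {c d} → S c ≡ true → S d ≡ true → pos c ≡ pos d → c ≡ d) →
  ∀ j → j < m → ∃ λ c → S c ≡ true × pos c ≡ j
onto {n} S pos pos< inj j j<m with any? (λ c → (S c Bool.≟ true) ×-dec (pos c ℕ.≟ j))
... | yes p = p
... | no ¬p = contradiction (≤-<-trans (≤-reflexive (sym cum-m)) cum-m<) (<-irrefl refl)
  where
  m = ∑ (𝟙 ∘ S)
  cum eqs : ℕ → ℕ
  cum t = ∑ λ v → when (S v) (𝟙 (pos v <ᵇ t))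
  eqs t = ∑ λ v → when (S v) (𝟙 (pos v ≡ᵇ t))
  cum-step : ∀ t → cum (suc t) ≡ cum t + eqs t
  cum-step t = trans (∑-cong λ v → step (S v) (pos v) t) (∑-+ (λ v → when (S v) (𝟙 (pos v <ᵇ t)))
      (λ v → when (S v) (𝟙 (pos v ≡ᵇ t))))
    where
    step : ∀ b p t → when b (𝟙 (p <ᵇ suc t)) ≡ when b (𝟙 (p <ᵇ t)) + when b (𝟙 (p ≡ᵇ t))
    step false p t = refl
    step true zero zero = refl
    step true zero (suc t) = refl
    step true (suc p) zero = refl
    step true (suc p) (suc t) = step true p t
  off : ∀ {v t} → ¬ (S v ≡ true × pos v ≡ t) → when (S v) (𝟙 (pos v ≡ᵇ t)) ≡ 0
  off {v} {t} ¬q with S v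
  ... | false = refl
  ... | true = 𝟙-false λ q → ¬q (refl , ≡ᵇ⇒≡ (pos v) t q)
  eqs≤1 : ∀ t → eqs t ≤ 1
  eqs≤1 t with any? (λ c → (S c Bool.≟ true) ×-dec (pos c ℕ.≟ t))
  ... | no ¬q = ≤-trans (≤-reflexive (∑-zero λ v → off λ q → ¬q (v , q))) z≤n
  ... | yes (c , sc , pc) = ≤-trans
      (≤-reflexive (∑-single c λ d d≢c → off λ { (sd , pd) → d≢c (inj sd sc (trans pd (sym pc))) })) one
    where
    one : when (S c) (𝟙 (pos c ≡ᵇ t)) ≤ 1
    one with S c
    ... | true = 𝟙≤1 _
    ... | false = z≤n
  cum≤ : ∀ t → cum t ≤ t
  cum≤ zero = ≤-reflexive (∑-zero λ v → none (S v) (pos v))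
    where
    none : ∀ b p → when b (𝟙 (p <ᵇ zero)) ≡ 0
    none true zero = refl
    none true (suc p) = refl
    none false p = refl
  cum≤ (suc t) = lia 4 (λ x y z t → x :≡ y :+ z ∷ y :≤ t ∷ z :≤ con 1 ∷ [] ⊢ x :≤ con 1 :+ t)
    (cum (suc t)) (cum t) (eqs t) t (cum-step t) (cum≤ t) (eqs≤1 t)
  cum< : ∀ k → cum (k + suc j) < k + suc j
  cum< zero = lia 4 (λ x y z t → x :≡ y :+ z ∷ y :≤ t ∷ z :≡ con 0 ∷ [] ⊢ x :< con 1 :+ t)
    (cum (suc j)) (cum j) (eqs j) j (cum-step j) (cum≤ j) (∑-zero λ v → off λ q → ¬p (v , q))
  cum< (suc k) = lia 4 (λ x y z t → x :≡ y :+ z ∷ y :< t ∷ z :≤ con 1 ∷ [] ⊢ x :< con 1 :+ t)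
    (cum (suc k + suc j)) (cum (k + suc j)) (eqs (k + suc j)) (k + suc j) (cum-step (k + suc j)) (cum< k)
        (eqs≤1 (k + suc j))
  cum-m< : cum m < m
  cum-m< = subst (λ t → cum t < t) (m∸n+n≡m j<m) (cum< (m ∸ suc j))
  cum-m : cum m ≡ m
  cum-m = ∑-cong λ v → full v
    where
    full : ∀ v → when (S v) (𝟙 (pos v <ᵇ m)) ≡ 𝟙 (S v)
    full v with S v in eq
    ... | true = 𝟙-true (<⇒<ᵇ (pos< eq))
    ... | false = refl

maxUpTo : (ℕ → ℕ) → ℕ → ℕ
maxUpTo f zero = f 0
maxUpTo f (suc l) = f (suc l) ⊔ maxUpTo f l

≤maxUpTo : ∀ f l t → t ≤ l → f t ≤ maxUpTo f l
≤maxUpTo f zero .zero z≤n = ≤-refl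
≤maxUpTo f (suc l) t t≤l with m≤n⇒m<n∨m≡n t≤l
... | inj₁ p = ≤-trans (≤maxUpTo f l t (s≤s⁻¹ p)) (m≤n⊔m (f (suc l)) _)
... | inj₂ refl = m≤m⊔n _ _

maxUpTo≤ : ∀ f l k → (∀ t → t ≤ l → f t ≤ k) → maxUpTo f l ≤ k
maxUpTo≤ f zero k p = p 0 z≤n
maxUpTo≤ f (suc l) k p = ⊔-lub (p (suc l) ≤-refl) (maxUpTo≤ f l k λ t q → p t (m≤n⇒m≤1+n q))

-- The clique vertices have positions 0, …, m − 1 on a circle; a vertex outside the clique is adjacent to
-- the clique vertices of a circular arc, given by an interval [b, e) of the universal cover.
-- no-cover says that no two of these arcs, regarded as closed arcs, cover the circle.
record ArcModel {n} (S : Fin n → Bool) (N : Fin n → Fin n → Bool) : Set where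
  field
    m        : ℕ
    pos      : Fin n → ℕ
    pos<     : ∀ {c} → S c ≡ true → pos c < m
    pos-inj  : ∀ {c d} → S c ≡ true → S d ≡ true → pos c ≡ pos d → c ≡ d
    at       : ∀ j → j < m → ∃ λ c → S c ≡ true × pos c ≡ j
    b e      : Fin n → ℕ
    b<       : ∀ {x} → b x < e x → b x < m
    b≤m      : ∀ x → b x ≤ m
    b≤e      : ∀ x → b x ≤ e x
    e≤       : ∀ x → e x ≤ b x + m
    member   : ∀ {x c} → S x ≡ false → S c ≡ true →
      (N x c ≡ true) ⇔ ((b x ≤ pos c × pos c < e x) ⊎ pos c + m < e x)
    no-cover : ∀ {x y} → S x ≡ false → S y ≡ false → x ≢ y → b y < e x → e y ≤ b x + m

-- The clique vertex at position o is adjacent when β - m ≤ o < m - α or β ≤ o < 2m - α, the two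
-- ways of alternating. One interval of the cover describes both windows; it starts at β or at β -
-- m, whichever is a position below m. If α + β reaches 2m, both windows are empty.
data ArcView (m α β : ℕ) : ℕ → ℕ → Set where
  empty : m + m ≤ α + β → ArcView m α β 0 0
  low   : ∀ {e} → α + β < m + m → β < m → e + α ≡ m + m → ArcView m α β β e
  high  : ∀ {b e} → α + β < m + m → b + m ≡ β → e + α ≡ m → ArcView m α β b e

arcView : ∀ m α β → ∃₂ (ArcView m α β)
arcView m α β with m + m ℕ.≤? α + β | β ℕ.<? m
... | yes p | _ = 0 , 0 , empty p
... | no p | yes q = β , m + m ∸ α , low (≰⇒> p) q (m∸n+n≡m (≤-trans (m≤m+n α β) (<⇒≤ (≰⇒> p))))
... | no p | no q = β ∸ m , m ∸ α , high (≰⇒> p) (m∸n+n≡m (≮⇒≥ q)) (m∸n+n≡m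
  (lia 3 (λ m α β → α :+ β :< m :+ m ∷ m :≤ β ∷ [] ⊢ α :≤ m) m α β (≰⇒> p) (≮⇒≥ q)))

view-member : ∀ {m α β b e o} → ArcView m α β b e → o < m →
  ((α + o < m × β ≤ m + o) ⊎ (α + o < m + m × β ≤ o)) ⇔ ((b ≤ o × o < e) ⊎ o + m < e)
view-member {m} {α} {β} {o = o} (empty p) o<m = mk⇔
  (λ { (inj₁ (q , r)) → contradiction q
         (lia 4 (λ m α β o → m :+ m :≤ α :+ β ∷ β :≤ m :+ o ∷ α :+ o :< m ∷ [] ⊢ :⊥) m α β o p r)
     ; (inj₂ (q , r)) → contradiction q
         (lia 4 (λ m α β o → m :+ m :≤ α :+ β ∷ β :≤ o ∷ α :+ o :< m :+ m ∷ [] ⊢ :⊥) m α β o p r) })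
  (λ { (inj₁ (_ , ())) ; (inj₂ ()) })
view-member {m} {α} {β} {e = e} {o} (low p q r) o<m = mk⇔
  (λ { (inj₁ (s , _)) → inj₂ (lia 4 (λ m α e o → α :+ o :< m ∷ e :+ α :≡ m :+ m ∷ [] ⊢ o :+ m :< e) m α e o s r)
     ; (inj₂ (s , t)) → inj₁ (t , lia 4 (λ m α e o → α :+ o :< m :+ m ∷ e :+ α :≡ m :+ m ∷ [] ⊢ o :< e) m α e o s
         r) })
  (λ { (inj₁ (s , t)) → inj₂ (lia 4 (λ m α e o → o :< e ∷ e :+ α :≡ m :+ m ∷ [] ⊢ α :+ o :< m :+ m) m α e o t r , s)
     ; (inj₂ s) → inj₁ (lia 4 (λ m α e o → o :+ m :< e ∷ e :+ α :≡ m :+ m ∷ [] ⊢ α :+ o :< m) m α e o s r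
                       , ≤-trans (<⇒≤ q) (m≤m+n m o)) })
view-member {m} {α} {b = b} {e} {o} (high p refl r) o<m = mk⇔
  (λ { (inj₁ (s , t)) → inj₁ (+-cancelʳ-≤ m b o (subst (b + m ≤_) (+-comm m o) t)
                             , lia 4 (λ m α e o → α :+ o :< m ∷ e :+ α :≡ m ∷ [] ⊢ o :< e) m α e o s r)
     ; (inj₂ (_ , s)) → contradiction o<m (≤⇒≯ (≤-trans (m≤n+m m b) s)) })
  (λ { (inj₁ (s , t)) → inj₁ (lia 4 (λ m α e o → o :< e ∷ e :+ α :≡ m ∷ [] ⊢ α :+ o :< m) m α e o t r
                             , subst (b + m ≤_) (+-comm o m) (+-monoˡ-≤ m s))
     ; (inj₂ s) → ⊥-elim (lia 4 (λ m α e o → o :+ m :< e ∷ e :+ α :≡ m ∷ [] ⊢ :⊥) m α e o s r) })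

view-bounds : ∀ {m α β b e} → ArcView m α β b e → m ≤ α + β → (b < e → b < m) × b ≤ m × b ≤ e × e ≤ b + m
view-bounds (empty p) _ = (λ ()) , z≤n , z≤n , z≤n
view-bounds {m} {α} {β} {e = e} (low p q r) s = (λ _ → q) , <⇒≤ q
  , lia 4 (λ m α β e → α :+ β :< m :+ m ∷ e :+ α :≡ m :+ m ∷ [] ⊢ β :≤ e) m α β e p r
  , lia 4 (λ m α β e → m :≤ α :+ β ∷ e :+ α :≡ m :+ m ∷ [] ⊢ e :≤ β :+ m) m α β e s r
view-bounds {m} {α} {b = b} {e} (high p refl r) s =
  (λ t → lia 4 (λ m α b e → b :< e ∷ e :+ α :≡ m ∷ [] ⊢ b :< m) m α b e t r)
  , lia 4 (λ m α b e → α :+ (b :+ m) :< m :+ m ∷ e :+ α :≡ m ∷ [] ⊢ b :≤ m) m α b e p r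
  , lia 4 (λ m α b e → α :+ (b :+ m) :< m :+ m ∷ e :+ α :≡ m ∷ [] ⊢ b :≤ e) m α b e p r
  , lia 4 (λ m α b e → e :+ α :≡ m ∷ [] ⊢ e :≤ b :+ m) m α b e r

-- The negated pairs say that neither vertex leads the other. If the closed arcs covered the circle,
-- the inequalities between their ends, rewritten with α and β, would be one of these pairs.
view-no-cover : ∀ {m α β b e α′ β′ b′ e′} → ArcView m α β b e → ArcView m α′ β′ b′ e′ →
  ¬ (β + α′ < m × β′ + α < m + m) → ¬ (β′ + α < m × β + α′ < m + m) → b′ < e → e′ ≤ b + m
view-no-cover (empty _) _ _ _ ()
view-no-cover v (empty _) _ _ _ = z≤n
view-no-cover {m} {α} {β} {e = e} {α′} {β′} {e′ = e′} (low p q r) (low p′ q′ r′) ¬s _ t = ≮⇒≥ λ u → ¬s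
  ( lia 4 (λ m α′ β e′ → β :+ m :< e′ ∷ e′ :+ α′ :≡ m :+ m ∷ [] ⊢ β :+ α′ :< m) m α′ β e′ u r′
  , lia 4 (λ m α β′ e → β′ :< e ∷ e :+ α :≡ m :+ m ∷ [] ⊢ β′ :+ α :< m :+ m) m α β′ e t r )
view-no-cover {m} {β = β} {α′ = α′} {e′ = e′} (low p q r) (high p′ q′ r′) _ _ _ =
  lia 4 (λ m α β e → e :+ α :≡ m ∷ [] ⊢ e :≤ β :+ m) m α′ β e′ r′
view-no-cover {m} {α} {b = b} {e} {α′} {β′} {e′ = e′} (high p refl r) (low p′ q′ r′) _ ¬s t = ≮⇒≥ λ u → ¬s
  ( lia 4 (λ m α β′ e → β′ :< e ∷ e :+ α :≡ m ∷ [] ⊢ β′ :+ α :< m) m α β′ e t r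
  , lia 4 (λ m α′ b e′ → b :+ m :< e′ ∷ e′ :+ α′ :≡ m :+ m ∷ [] ⊢ b :+ m :+ α′ :< m :+ m) m α′ b e′ u r′ )
view-no-cover {m} {b = b} {α′ = α′} {e′ = e′} (high p q r) (high p′ q′ r′) _ _ _ =
  lia 4 (λ m α b e → e :+ α :≡ m ∷ [] ⊢ e :≤ b :+ m) m α′ b e′ r′

∈⇒occ : ∀ {n} {a : Fin n} {w} → a ∈ w → 0 < occ a w
∈⇒occ {a = a} {x ∷ w} p with x ≟ a | p
... | yes _ | _ = s≤s z≤n
... | no ¬q | here refl = contradiction refl ¬q
... | no _ | there q = ∈⇒occ q

-- The hypotheses say that C = ⌊(P + o′) / m⌋.
module Quotient {P C o o′ m : ℕ} (hi : P ≤ C * m + o) (lo : C * m ≤ P + o′) (o+o′ : suc (o + o′) ≡ m) where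

  ≤C : ∀ A → A ≤ C ⇔ A * m ≤ P + o′
  ≤C A = mk⇔ (λ p → ≤-trans (*-monoˡ-≤ m p) lo)
    (λ p → s≤s⁻¹ (*-cancelʳ-< m A (suc C)
      (lia 6 (λ a P c o o′ m → a :≤ P :+ o′ ∷ P :≤ c :+ o ∷ con 1 :+ (o :+ o′) :≡ m ∷ [] ⊢ a :< m :+ c)
        (A * m) P (C * m) o o′ m p hi o+o′)))

  C≤ : ∀ A → C ≤ A ⇔ P ≤ A * m + o
  C≤ A = mk⇔ (λ p → ≤-trans hi (+-monoˡ-≤ o (*-monoˡ-≤ m p)))
    (λ p → s≤s⁻¹ (*-cancelʳ-< m C (suc A)
      (lia 6 (λ a P c o o′ m → P :≤ a :+ o ∷ c :≤ P :+ o′ ∷ con 1 :+ (o :+ o′) :≡ m ∷ [] ⊢ c :< m :+ a)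
        (A * m) P (C * m) o o′ m p lo o+o′)))

∸≤⇔ : ∀ a b c → (a ∸ b ≤ c) ⇔ (a ≤ b + c)
∸≤⇔ a b c = mk⇔ (λ p → ≤-trans (m≤n+m∸n a b) (+-monoʳ-≤ b p)) (m≤n+o⇒m∸n≤o a b)

module FromWord (G : Graph) (S : Fin (n G) → Bool)
  (clique : ∀ x y → x ≢ y → S x ≡ true → S y ≡ true → adj G x y ≡ true)
  (indep : ∀ x y → S x ≡ false → S y ≡ false → adj G x y ≡ false)
  (w : Word (n G)) (occurs : ∀ a → a ∈ w) (rep : Represents G w) where

  private
    V = Fin (n G)
    g = nth w
    l = length w

    C : V → ℕ → ℕ
    C = count g

    adj⇔ : ∀ {a b} → a ≢ b → adj G a b ≡ true ⇔ (Leads g l a b ⊎ Leads g l b a)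
    adj⇔ {a} {b} a≢b = rep a b a≢b ⇔∘
      subst (λ v → Alternate v a b ⇔ (Leads g l a b ⊎ Leads g l b a)) (build-nth w) (alternate⇔leads g l a≢b)

    first : ∀ v → ∃ λ t → t < l × C v t ≡ 0 × g t ≡ just v
    first v = occurrence g v l 0
      (subst (0 <_) (trans (cong (occ v) (sym (build-nth w))) (occ-build g v l)) (∈⇒occ (occurs v)))

    fo : V → ℕ
    fo v = proj₁ (first v)

    fo-inj : ∀ {u v} → fo u ≡ fo v → u ≡ v
    fo-inj {u} {v} eq = just-injective
      (trans (sym (proj₂ (proj₂ (proj₂ (first u))))) (trans (cong g eq) (proj₂ (proj₂ (proj₂ (first v))))))

    leads : ∀ {c d} → S c ≡ true → S d ≡ true → fo c < fo d → Leads g l c d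
    leads {c} {d} sc sd c<d with to (adj⇔ λ { refl → <-irrefl refl c<d })
        (clique c d (λ { refl → <-irrefl refl c<d }) sc sd)
    ... | inj₁ p = p
    ... | inj₂ p = contradiction (begin-strict
        0              <⟨ s≤s z≤n ⟩
        suc (C c (fo c)) ≡⟨ sym (count-hit g (proj₂ (proj₂ (proj₂ (first c))))) ⟩
        C c (suc (fo c)) ≤⟨ proj₁ (p (suc (fo c)) (proj₁ (proj₂ (first c)))) ⟩
        C d (suc (fo c)) ≤⟨ count-mono g d c<d ⟩
        C d (fo d)       ≡⟨ proj₁ (proj₂ (proj₂ (first d))) ⟩
        0              ∎) λ ()
      where open ≤-Reasoning

    early late : V → V → ℕ
    early c d = 𝟙 (fo d <ᵇ fo c)
    late c d = 𝟙 (fo c <ᵇ fo d)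

    m : ℕ
    m = ∑ (𝟙 ∘ S)

    -- The clock of the rotation: how many clique letters have been read up to time t.
    P : ℕ → ℕ
    P t = ∑ λ d → when (S d) (C d t)

    o o′ : V → ℕ
    o c = ∑ λ d → when (S d) (early c d)
    o′ c = ∑ λ d → when (S d) (late c d)

    trichotomy : ∀ c d → hit (just d) c + (early c d + late c d) ≡ 1
    trichotomy c d with <-cmp (fo c) (fo d)
    ... | tri≈ _ eq _ with refl ← fo-inj eq
        rewrite hit-self c | 𝟙-false (λ p → <-irrefl refl (<ᵇ⇒< (fo c) (fo c) p)) = refl
    ... | tri< p ¬eq ¬q
        rewrite hit-other {x = d} {c} (λ { refl → ¬eq refl }) | 𝟙-true (<⇒<ᵇ p) | 𝟙-false (¬q ∘ <ᵇ⇒< (fo d) (fo c)) =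
            refl
    ... | tri> ¬p ¬eq q
        rewrite hit-other {x = d} {c} (λ { refl → ¬eq refl }) | 𝟙-true (<⇒<ᵇ q) | 𝟙-false (¬p ∘ <ᵇ⇒< (fo c) (fo d)) =
            refl

    ∑-hit : ∀ {c} → S c ≡ true → ∑ (λ d → when (S d) (hit (just d) c)) ≡ 1
    ∑-hit {c} sc = trans (∑-single c λ d d≢c → off (S d) (hit-other d≢c))
      (trans (cong (λ s → when s (hit (just c) c)) sc) (hit-self c))
      where
      off : ∀ s {k} → k ≡ 0 → when s k ≡ 0
      off true eq = eq
      off false _ = refl

    when-+ : ∀ s j k → when s (j + k) ≡ when s j + when s k
    when-+ true j k = refl
    when-+ false j k = refl

    o+o′ : ∀ {c} → S c ≡ true → suc (o c + o′ c) ≡ m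
    o+o′ {c} sc = sym (begin
      m ≡⟨ ∑-cong (λ d → trans (cong (when (S d)) (sym (trichotomy c d)))
             (trans (when-+ (S d) (hit (just d) c) _) (cong (when (S d) (hit (just d) c) +_)
                 (when-+ (S d) (early c d) _)))) ⟩
      ∑ (λ d → when (S d) (hit (just d) c) + (when (S d) (early c d) + when (S d) (late c d)))
        ≡⟨ trans (∑-+ (λ d → when (S d) (hit (just d) c)) _)
            (cong₂ _+_ (∑-hit sc) (∑-+ (λ d → when (S d) (early c d)) (λ d → when (S d) (late c d)))) ⟩
      suc (o c + o′ c) ∎)
      where open ≡-Reasoning

    compare : ∀ {c d} → S c ≡ true → S d ≡ true → ∀ t → t ≤ l →
      C d t ≤ C c t + early c d × C c t ≤ C d t + late c d
    compare {c} {d} sc sd t t≤l with <-cmp (fo c) (fo d)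
    ... | tri≈ _ eq _ with refl ← fo-inj eq = m≤m+n _ _ , m≤m+n _ _
    ... | tri< p ¬eq ¬q rewrite 𝟙-true (<⇒<ᵇ p) = let q , r = leads sc sd p t t≤l in
        m≤n⇒m≤n+o _ q , subst (C c t ≤_) (+-comm 1 _) r
    ... | tri> ¬p ¬eq q rewrite 𝟙-true (<⇒<ᵇ q) = let p , r = leads sd sc q t t≤l in
        subst (C d t ≤_) (+-comm 1 _) r , m≤n⇒m≤n+o _ p

    -- Each clique letter is ahead of c or behind c by at most one, in the direction fixed by the
    -- first occurrences. Summing over the clique, this and `P-lo` determine the count of c as the
    -- integer part of (P t + o′ c) / m.
    P-hi : ∀ {c} → S c ≡ true → ∀ t → t ≤ l → P t ≤ C c t * m + o c
    P-hi {c} sc t t≤l = begin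
      P t ≤⟨ ∑-mono pointwise ⟩
      ∑ (λ d → 𝟙 (S d) * C c t + when (S d) (early c d)) ≡⟨ ∑-+ (λ d → 𝟙 (S d) * C c t)
          (λ d → when (S d) (early c d)) ⟩
      ∑ (λ d → 𝟙 (S d) * C c t) + o c ≡⟨ cong (_+ o c) (trans (∑-* (C c t) (𝟙 ∘ S)) (*-comm m _)) ⟩
      C c t * m + o c ∎
      where
      open ≤-Reasoning
      pointwise : ∀ d → when (S d) (C d t) ≤ 𝟙 (S d) * C c t + when (S d) (early c d)
      pointwise d with S d in sd
      ... | false = z≤n
      ... | true rewrite +-identityʳ (C c t) = proj₁ (compare sc sd t t≤l)

    P-lo : ∀ {c} → S c ≡ true → ∀ t → t ≤ l → C c t * m ≤ P t + o′ c
    P-lo {c} sc t t≤l = begin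
      C c t * m ≡⟨ trans (*-comm _ m) (sym (∑-* (C c t) (𝟙 ∘ S))) ⟩
      ∑ (λ d → 𝟙 (S d) * C c t) ≤⟨ ∑-mono pointwise ⟩
      ∑ (λ d → when (S d) (C d t) + when (S d) (late c d)) ≡⟨ ∑-+ (λ d → when (S d) (C d t))
          (λ d → when (S d) (late c d)) ⟩
      P t + o′ c ∎
      where
      open ≤-Reasoning
      pointwise : ∀ d → 𝟙 (S d) * C c t ≤ when (S d) (C d t) + when (S d) (late c d)
      pointwise d with S d in sd
      ... | false = z≤n
      ... | true rewrite +-identityʳ (C c t) = proj₂ (compare sc sd t t≤l)

    -- The extremes of the drift P t - m · C x t are -α and β. Both differences vanish at t = 0, so
    -- truncated subtraction does not change the maxima.
    α β : V → ℕ
    α x = maxUpTo (λ t → C x t * m ∸ P t) l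
    β x = maxUpTo (λ t → P t ∸ C x t * m) l

    α-bound : ∀ x t → t ≤ l → C x t * m ≤ P t + α x
    α-bound x t t≤l = to (∸≤⇔ _ _ _) (≤maxUpTo (λ t → C x t * m ∸ P t) l t t≤l)

    β-bound : ∀ x t → t ≤ l → P t ≤ C x t * m + β x
    β-bound x t t≤l = to (∸≤⇔ _ _ _) (≤maxUpTo (λ t → P t ∸ C x t * m) l t t≤l)

    α≤ : ∀ x k → (∀ t → t ≤ l → C x t * m ≤ P t + k) → α x ≤ k
    α≤ x k p = maxUpTo≤ _ l k λ t t≤l → from (∸≤⇔ _ _ _) (p t t≤l)

    β≤ : ∀ x k → (∀ t → t ≤ l → P t ≤ C x t * m + k) → β x ≤ k
    β≤ x k p = maxUpTo≤ _ l k λ t t≤l → from (∸≤⇔ _ _ _) (p t t≤l)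

    -- At the first occurrence of x the term `C x t * m` jumps by m while the clock stands still, so
    -- the drift takes two values at distance m.
    m≤α+β : ∀ {x} → S x ≡ false → m ≤ α x + β x
    m≤α+β {x} sx = lia 4 (λ m α β p → m :≤ p :+ α ∷ p :≤ β ∷ [] ⊢ m :≤ α :+ β) m (α x) (β x) (P t)
      (subst₂ (λ k p → k ≤ p + α x) (trans (cong (_* m) C-after) (+-identityʳ m)) same (α-bound x (suc t) t<l))
      (subst (λ k → P t ≤ k * m + β x) C-before (β-bound x t (<⇒≤ t<l)))
      where
      t = fo x
      t<l = proj₁ (proj₂ (first x))
      C-before = proj₁ (proj₂ (proj₂ (first x)))
      gt = proj₂ (proj₂ (proj₂ (first x)))
      C-after : C x (suc t) ≡ 1
      C-after = trans (count-hit g gt) (cong suc C-before)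
      same : P (suc t) ≡ P t
      same = ∑-cong λ d → still d
        where
        still : ∀ d → when (S d) (C d (suc t)) ≡ when (S d) (C d t)
        still d with S d in sd
        ... | false = refl
        ... | true = count-miss g λ eq → case trans (sym sx) (trans (cong S (just-injective (trans (sym gt) eq))) sd)
            of λ ()

    module Q {c} (sc : S c ≡ true) t (t≤l : t ≤ l) = Quotient {P t} {C c t} {o c} {o′ c} {m} (P-hi sc t t≤l)
        (P-lo sc t t≤l) (o+o′ sc)
    module Q⁺ {c} (sc : S c ≡ true) t (t≤l : t ≤ l) = Quotient {P t + m} {suc (C c t)} {o c} {o′ c} {m}
      (lia 4 (λ p c o m → p :≤ c :+ o ∷ [] ⊢ p :+ m :≤ m :+ c :+ o) (P t) (C c t * m) (o c) m (P-hi sc t t≤l))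
      (lia 4 (λ p c o m → c :≤ p :+ o ∷ [] ⊢ m :+ c :≤ p :+ m :+ o) (P t) (C c t * m) (o′ c) m (P-lo sc t t≤l))
      (o+o′ sc)

    -- As the count of c is an integer part of the clock, comparing it with the count of x at all
    -- times amounts to bounding the drift of x, hence only its two extremes.
    clique-first : ∀ {x c} → S c ≡ true → Leads g l c x ⇔ (α x + o c < m × β x ≤ m + o c)
    clique-first {x} {c} sc = mk⇔
      (λ ld →
        lia 4 (λ α o o′ m → α :≤ o′ ∷ con 1 :+ (o :+ o′) :≡ m ∷ [] ⊢ α :+ o :< m) (α x) (o c) (o′ c) m
          (α≤ x (o′ c) λ t t≤l → to (Q.≤C sc t t≤l (C x t)) (proj₁ (ld t t≤l))) (o+o′ sc)
        , β≤ x (m + o c) λ t t≤l →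
            lia 4 (λ p x m o → p :≤ m :+ x :+ o ∷ [] ⊢ p :≤ x :+ (m :+ o)) (P t) (C x t * m) m (o c)
              (to (Q.C≤ sc t t≤l (suc (C x t))) (proj₂ (ld t t≤l))))
      (λ { (p , q) t t≤l →
        from (Q.≤C sc t t≤l (C x t))
          (lia 6 (λ x p α o o′ m → x :≤ p :+ α ∷ α :+ o :< m ∷ con 1 :+ (o :+ o′) :≡ m ∷ [] ⊢ x :≤ p :+ o′)
            (C x t * m) (P t) (α x) (o c) (o′ c) m (α-bound x t t≤l) p (o+o′ sc))
        , from (Q.C≤ sc t t≤l (suc (C x t)))
          (lia 5 (λ x p β o m → p :≤ x :+ β ∷ β :≤ m :+ o ∷ [] ⊢ p :≤ m :+ x :+ o)
            (C x t * m) (P t) (β x) (o c) m (β-bound x t t≤l) q) })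

    clique-second : ∀ {x c} → S c ≡ true → Leads g l x c ⇔ (α x + o c < m + m × β x ≤ o c)
    clique-second {x} {c} sc = mk⇔
      (λ ld →
        lia 4 (λ α o o′ m → α :≤ m :+ o′ ∷ con 1 :+ (o :+ o′) :≡ m ∷ [] ⊢ α :+ o :< m :+ m) (α x) (o c) (o′ c) m
          (α≤ x (m + o′ c) λ t t≤l →
            lia 4 (λ p x m o → x :≤ p :+ m :+ o ∷ [] ⊢ x :≤ p :+ (m :+ o)) (P t) (C x t * m) m (o′ c)
              (to (Q⁺.≤C sc t t≤l (C x t)) (proj₂ (ld t t≤l)))) (o+o′ sc)
        , β≤ x (o c) λ t t≤l → to (Q.C≤ sc t t≤l (C x t)) (proj₁ (ld t t≤l)))
      (λ { (p , q) t t≤l →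
        from (Q.C≤ sc t t≤l (C x t)) (≤-trans (β-bound x t t≤l) (+-monoʳ-≤ _ q))
        , from (Q⁺.≤C sc t t≤l (C x t))
          (lia 6 (λ x p α o o′ m → x :≤ p :+ α ∷ α :+ o :< m :+ m ∷ con 1 :+ (o :+ o′) :≡ m ∷ [] ⊢ x :≤ p :+ m :+ o′)
            (C x t * m) (P t) (α x) (o c) (o′ c) m (α-bound x t t≤l) p (o+o′ sc)) })

    -- Chaining the two drifts through the clock, these bounds would put the count of x between that
    -- of y and one more, so x and y would alternate.
    gap : ∀ {x y} → S x ≡ false → S y ≡ false → x ≢ y → ¬ (β x + α y < m × β y + α x < m + m)
    gap {x} {y} sx sy x≢y (p , q) with () ← trans (sym (indep x y sx sy)) (from (adj⇔ x≢y) (inj₁ λ t t≤l →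
        s≤s⁻¹ (*-cancelʳ-< m (C y t) (suc (C x t))
          (lia 6 (λ x y p α β m → y :≤ p :+ α ∷ p :≤ x :+ β ∷ β :+ α :< m ∷ [] ⊢ y :< m :+ x)
            (C x t * m) (C y t * m) (P t) (α y) (β x) m (α-bound y t t≤l) (β-bound x t t≤l) p))
        , s≤s⁻¹ (*-cancelʳ-< m (C x t) (suc (suc (C y t)))
          (lia 6 (λ x y p α β m → x :≤ p :+ α ∷ p :≤ y :+ β ∷ β :+ α :< m :+ m ∷ [] ⊢ x :< m :+ (m :+ y))
            (C x t * m) (C y t * m) (P t) (α x) (β y) m (α-bound x t t≤l) (β-bound y t t≤l) q))))

    o< : ∀ {c} → S c ≡ true → o c < m
    o< {c} sc = subst (o c <_) (o+o′ sc) (s≤s (m≤m+n _ _))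

    o-mono : ∀ {c d} → S c ≡ true → fo c < fo d → o c < o d
    o-mono {c} {d} sc c<d = begin
      suc (o c) ≡⟨ cong (_+ o c) (sym (∑-hit sc)) ⟩
      ∑ (λ e → when (S e) (hit (just e) c)) + o c ≡⟨ sym (∑-+ (λ e → when (S e) (hit (just e) c))
          (λ e → when (S e) (early c e))) ⟩
      ∑ (λ e → when (S e) (hit (just e) c) + when (S e) (early c e)) ≤⟨ ∑-mono pointwise ⟩
      o d ∎
      where
      open ≤-Reasoning
      pointwise : ∀ e → when (S e) (hit (just e) c) + when (S e) (early c e) ≤ when (S e) (early d e)
      pointwise e with S e
      ... | false = z≤n
      ... | true with e ≟ c
      ...   | yes refl rewrite 𝟙-true (<⇒<ᵇ c<d) | 𝟙-false (λ p → <-irrefl refl (<ᵇ⇒< (fo c) (fo c) p)) = ≤-refl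
      ...   | no _ with fo e ℕ.<? fo c
      ...     | yes p rewrite 𝟙-true (<⇒<ᵇ (<-trans p c<d)) = 𝟙≤1 _
      ...     | no ¬p rewrite 𝟙-false (¬p ∘ <ᵇ⇒< (fo e) (fo c)) = z≤n

    o-inj : ∀ {c d} → S c ≡ true → S d ≡ true → o c ≡ o d → c ≡ d
    o-inj {c} {d} sc sd eq with <-cmp (fo c) (fo d)
    ... | tri≈ _ p _ = fo-inj p
    ... | tri< p _ _ = contradiction eq (<⇒≢ (o-mono sc p))
    ... | tri> _ _ p = contradiction (sym eq) (<⇒≢ (o-mono sd p))

    arc : V → ℕ × ℕ
    arc x with S x
    ... | true = 0 , 0
    ... | false = let b , e , _ = arcView m (α x) (β x) in b , e

    view : ∀ {x} → S x ≡ false → ArcView m (α x) (β x) (proj₁ (arc x)) (proj₂ (arc x))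
    view {x} sx with S x
    view {x} refl | false = proj₂ (proj₂ (arcView m (α x) (β x)))

    bounds : ∀ x → let b , e = arc x in (b < e → b < m) × b ≤ m × b ≤ e × e ≤ b + m
    bounds x with S x in sx
    ... | true = (λ ()) , z≤n , z≤n , z≤n
    ... | false = view-bounds (proj₂ (proj₂ (arcView m (α x) (β x)))) (m≤α+β sx)

    member : ∀ {x c} → S x ≡ false → S c ≡ true →
      (adj G x c ≡ true) ⇔ ((proj₁ (arc x) ≤ o c × o c < proj₂ (arc x)) ⊎ o c + m < proj₂ (arc x))
    member {x} {c} sx sc = adj⇔ (λ { refl → case trans (sym sx) sc of λ () })
      ⇔∘ mk⇔ (λ { (inj₁ p) → inj₂ (to (clique-second sc) p) ; (inj₂ p) → inj₁ (to (clique-first sc) p) })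
             (λ { (inj₁ p) → inj₂ (from (clique-first sc) p) ; (inj₂ p) → inj₁ (from (clique-second sc) p) })
      ⇔∘ view-member (view sx) (o< sc)

  arcModel : ArcModel S (adj G)
  arcModel = record
    { m = m ; pos = o ; pos< = o< ; pos-inj = o-inj ; at = onto S o o< o-inj
    ; b = proj₁ ∘ arc ; e = proj₂ ∘ arc
    ; b< = λ {x} → proj₁ (bounds x)
    ; b≤m = λ x → proj₁ (proj₂ (bounds x))
    ; b≤e = λ x → proj₁ (proj₂ (proj₂ (bounds x)))
    ; e≤ = λ x → proj₂ (proj₂ (proj₂ (bounds x)))
    ; member = member
    ; no-cover = λ sx sy x≢y → view-no-cover (view sx) (view sy) (gap sx sy x≢y) (gap sy sx (x≢y ∘ sym)) }

-- Three laps: a 3-uniform word from any arc model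

lex-≤ : ∀ {a b n r s} → a ≤ b → r < s → a * n + r < b * n + s
lex-≤ {n = n} a≤b r<s = +-mono-≤-< (*-monoˡ-≤ n a≤b) r<s

⨆ : ∀ {n} → (Fin n → ℕ) → ℕ
⨆ {zero} f = 0
⨆ {suc n} f = f zero ⊔ ⨆ (f ∘ suc)

≤⨆ : ∀ {n} (f : Fin n → ℕ) i → f i ≤ ⨆ f
≤⨆ f zero = m≤m⊔n _ _
≤⨆ f (suc i) = ≤-trans (≤⨆ (f ∘ suc) i) (m≤n⊔m (f zero) _)

⨆≤ : ∀ {n} (f : Fin n → ℕ) k → (∀ i → f i ≤ k) → ⨆ f ≤ k
⨆≤ {zero} f k p = z≤n
⨆≤ {suc n} f k p = ⊔-lub (p zero) (⨆≤ (f ∘ suc) k (p ∘ suc))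

no-iff : ∀ {A : Set} {b} → b ≡ false → ¬ A → (b ≡ true) ⇔ A
no-iff refl ¬a = mk⇔ (λ ()) (λ a → contradiction a ¬a)

yes-iff : ∀ {A : Set} {b} → b ≡ true → A → (b ≡ true) ⇔ A
yes-iff eq a = mk⇔ (λ _ → a) (λ _ → eq)

¬true : ∀ {b} → ¬ b ≡ true → b ≡ false
¬true {false} _ = refl
¬true {true} p = contradiction refl p

true≢false : ∀ {b} → b ≡ true → ¬ b ≡ false
true≢false refl ()

module KeyOrder (G : Graph) (k : ℕ) (1<k : 1 < k) (key : Fin (n G) → ℕ → ℕ) (first< : ∀ v → key v 0 < key v 1) where

  Alt : Fin (n G) → Fin (n G) → Set
  Alt a b = Interleave k (refine key a) (refine key b) ⊎ Interleave k (refine key b) (refine key a)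

  Good : Fin (n G) → Fin (n G) → Set
  Good x y = (adj G x y ≡ true) ⇔ Alt x y

  good-sym : ∀ {x y} → Good x y → Good y x
  good-sym {x} {y} g = mk⇔ (swap ∘ to g ∘ trans (Graph.sym G x y)) (trans (Graph.sym G y x) ∘ from g ∘ swap)

  alt-from : ∀ {x y f g} → key x ≡ f → key y ≡ g → Interleave k f g → Alt x y
  alt-from {x} {y} refl refl (p , q) = inj₁
    ((λ i i<k → refine-< key x i y i (p i i<k)) , λ i i<k → refine-< key y i x (suc i) (q i i<k))

  private
    ¬interleave : ∀ {a b} i → i < k → key b i < key a i → ¬ Interleave k (refine key a) (refine key b)
    ¬interleave {a} {b} i i<k q (p , _) = <-asym (p i i<k) (refine-< key b i a i q)

  ¬alt : ∀ {x y f g} → key x ≡ f → key y ≡ g → ∀ i j → i < k → j < k → f i < g i → g j < f j → ¬ Alt x y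
  ¬alt {x} {y} refl refl i j p q r s (inj₁ t) = ¬interleave {x} {y} j q s t
  ¬alt {x} {y} refl refl i j p q r s (inj₂ t) = ¬interleave {y} {x} i p r t

  ¬alt-first : ∀ {x y f g} → key x ≡ f → key y ≡ g → f 1 < g 0 → ¬ Alt x y
  ¬alt-first {x} {y} refl refl r (inj₁ (_ , t)) = <-asym (t 0 1<k) (refine-< key x 1 y 0 r)
  ¬alt-first {x} {y} refl refl r (inj₂ t) = ¬interleave {y} {x} 0 (<-trans (s≤s z≤n) 1<k) (<-trans (first< x) r) t

three : ℕ → ℕ → ℕ → ℕ → ℕ
three x y z 0 = x
three x y z 1 = y
three x y z _ = z

interleave₃ : ∀ {x y z x′ y′ z′} → x < x′ → x′ < y → y < y′ → y′ < z → z < z′ →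
  Interleave 3 (three x y z) (three x′ y′ z′)
interleave₃ p q r s t =
  (λ { 0 _ → p ; 1 _ → r ; 2 _ → t ; (suc (suc (suc _))) (s≤s (s≤s (s≤s ()))) })
  , λ { 0 _ → q ; 1 _ → s ; (suc (suc _)) (s≤s (s≤s (s≤s ()))) }

-- The clique is written three times around the circle. A vertex whose arc is the interval [b, e) with
-- e ≤ m is inserted at m + b, 2m and 2m + e; one whose arc wraps around at E, e and 2m + b, where E is a
-- common point of the complements of all wrapping arcs. The occurrences sharing the points E and 2m are
-- ordered so as to prevent alternation within either kind, and no-cover prevents it between the kinds.
module ThreeUniform (G : Graph) (S : Fin (n G) → Bool)
  (clique : ∀ x y → x ≢ y → S x ≡ true → S y ≡ true → adj G x y ≡ true)
  (indep : ∀ x y → S x ≡ false → S y ≡ false → adj G x y ≡ false)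
  (A : ArcModel S (adj G)) where

  open ArcModel A

  private
    V = Fin (n G)
    N = n G

    abstract
      E : ℕ
      E = ⨆ (λ y → if S y then 0 else e y ∸ m)

      e-m≤E : ∀ {y} → S y ≡ false → e y ∸ m ≤ E
      e-m≤E {y} sy = ≤-trans (≤-reflexive (sym (cong (λ s → if s then 0 else e y ∸ m) sy)))
        (≤⨆ (λ y → if S y then 0 else e y ∸ m) y)

      -- If x wraps, then b y ≤ m < e x for every y, so `no-cover` applies to all y at once and
      -- bounds each e y - m by b x.
      E≤b : ∀ {x} → S x ≡ false → m < e x → E ≤ b x
      E≤b {x} sx m<e = ⨆≤ _ (b x) pointwise
        where
        pointwise : ∀ y → (if S y then 0 else e y ∸ m) ≤ b x
        pointwise y with S y in sy
        ... | true = z≤n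
        ... | false with x ≟ y
        ...   | yes refl = m≤n+o⇒m∸n≤o (e x) m (subst (e x ≤_) (+-comm (b x) m) (e≤ x))
        ...   | no x≢y with b y ℕ.<? e x
        ...     | yes p = m≤n+o⇒m∸n≤o (e y) m (subst (e y ≤_) (+-comm (b x) m) (no-cover sx sy x≢y p))
        ...     | no ¬p = contradiction (b≤m y) (<⇒≱ (<-≤-trans m<e (≮⇒≥ ¬p)))

      R Z : ℕ
      R = suc (m + m) * N
      Z = 3 * N

      -- Point p of the unrolled circle offers the offsets 0, ..., 2R. Clique letters take the last
      -- one, so an arc end at p comes just before the clique letter at p. The first Z keys are
      -- reserved for vertices without neighbours.
      κ : ℕ → ℕ → ℕ
      κ p r = Z + (p * suc (R + R) + r)

      κ-< : ∀ {p q r s} → p < q → r ≤ R + R → κ p r < κ q s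
      κ-< {s = s} p<q r≤ = +-monoʳ-< Z (lex s p<q (s≤s r≤))

      κ-≤ : ∀ {p q r s} → p ≤ q → r < s → κ p r < κ q s
      κ-≤ p≤q r<s = +-monoʳ-< Z (lex-≤ p≤q r<s)

      ρ : ℕ → V → ℕ
      ρ p v = p * N + toℕ v

      ρ< : ∀ {p} v → p ≤ m + m → ρ p v < R
      ρ< {p} v p≤ = <-≤-trans (lex {p} {suc (m + m)} {N} 0 (s≤s p≤) (toℕ<n v)) (≤-reflexive (+-identityʳ R))

      1≤R : V → 1 ≤ R
      1≤R v = <-≤-trans (≤-<-trans z≤n (toℕ<n v)) (m≤m+n N _)

      Z≤κ : ∀ p r → Z ≤ κ p r
      Z≤κ p r = m≤m+n Z _

      tag<Z : ∀ (v : V) i → i < 3 → toℕ v * 3 + i < Z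
      tag<Z v i i<3 = <-≤-trans (lex 0 (toℕ<n v) i<3) (≤-reflexive (trans (+-identityʳ _) (*-comm N 3)))

      ρ̄ : ℕ → V → ℕ
      ρ̄ p v = R ∸ ρ p v

      ρ̄< : ∀ {p} v → ρ̄ p v < R + R
      ρ̄< {p} v = ≤-<-trans (m∸n≤m R (ρ p v)) (m<m+n R (1≤R v))

      ρ̄-anti : ∀ {p q x y} → ρ q y < ρ p x → ρ p x < R → ρ̄ p x < ρ̄ q y
      ρ̄-anti q<p p<R = ∸-monoʳ-< q<p (<⇒≤ p<R)

      ρ-tri : ∀ {x y} p q → x ≢ y → (p ≤ q × ρ p x < ρ q y) ⊎ (q ≤ p × ρ q y < ρ p x)
      ρ-tri {x} {y} p q x≢y with <-cmp p q
      ... | tri< r _ _ = inj₁ (<⇒≤ r , lex _ r (toℕ<n x))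
      ... | tri> _ _ r = inj₂ (<⇒≤ r , lex _ r (toℕ<n y))
      ... | tri≈ _ refl _ with <-cmp (toℕ x) (toℕ y)
      ...   | tri< r _ _ = inj₁ (≤-refl , +-monoʳ-< (p * N) r)
      ...   | tri> _ _ r = inj₂ (≤-refl , +-monoʳ-< (p * N) r)
      ...   | tri≈ _ r _ = contradiction (toℕ-injective r) x≢y

    data Kind (v : V) : (ℕ → ℕ) → Set where
      cl : S v ≡ true →
        Kind v (three (κ (pos v) (R + R)) (κ (m + pos v) (R + R)) (κ (m + m + pos v) (R + R)))
      -- Three consecutive copies in front of all arcs and clique letters alternate with no other
      -- letter.
      em : S v ≡ false → e v ≤ b v → Kind v (λ i → toℕ v * 3 + i)
      int : S v ≡ false → b v < e v → e v ≤ m →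
        Kind v (three (κ (m + b v) (R + ρ (b v) v)) (κ (m + m) (ρ̄ (b v) v)) (κ (m + m + e v) 0))
      wr : S v ≡ false → b v < m → m < e v →
        Kind v (three (κ E (ρ̄ (e v) v)) (κ (e v) (ρ (e v) v)) (κ (m + m + b v) 1))

    kind : ∀ v → ∃ (Kind v)
    kind v with S v in sv | b v ℕ.<? e v | e v ℕ.≤? m
    ... | true | _ | _ = -, cl sv
    ... | false | no p | _ = -, em sv (≮⇒≥ p)
    ... | false | yes p | yes q = -, int sv p q
    ... | false | yes p | no q = -, wr sv (b< p) (≰⇒> q)

    key : V → ℕ → ℕ
    key v = proj₁ (kind v)

    e≤2m : ∀ {v} → b v < m → e v ≤ m + m
    e≤2m {v} p = ≤-trans (e≤ v) (+-monoˡ-≤ m (<⇒≤ p))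

    pos-m : ∀ {p} → p < m → p < m + p × 1 ≤ m
    pos-m {p} p<m = lia 2 (λ p m → p :< m ∷ [] ⊢ p :< m :+ p) p m p<m , ≤-trans (s≤s z≤n) p<m

    steps : ∀ {v f} → Kind v f → (f 0 < f 1) × (f 1 < f 2)
    steps {v} (cl sv) = let p = pos< sv in
        κ-< (proj₁ (pos-m p)) ≤-refl
      , κ-< (lia 2 (λ p m → p :< m ∷ [] ⊢ m :+ p :< m :+ m :+ p) (pos v) m p) ≤-refl
    steps {v} (em sv p) = +-monoʳ-< (toℕ v * 3) ≤-refl , +-monoʳ-< (toℕ v * 3) ≤-refl
    steps {v} (int sv p q) =
        κ-< (+-monoʳ-< m (b< p)) (+-monoʳ-≤ R (<⇒≤ (ρ< v (≤-trans (b≤m v) (m≤m+n m m)))))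
      , κ-< (lia 3 (λ b e m → b :< e ∷ [] ⊢ m :+ m :< m :+ m :+ e) (b v) (e v) m p) (<⇒≤ (ρ̄< _))
    steps {v} (wr sv p q) =
        κ-< (≤-<-trans (E≤b sv q) (<-trans p q)) (<⇒≤ (ρ̄< _))
      , κ-< (lia 3 (λ b e m → b :< m ∷ e :≤ b :+ m ∷ [] ⊢ e :< m :+ m :+ b) (b v) (e v) m p (e≤ v))
            (≤-trans (<⇒≤ (ρ< v (e≤2m p))) (m≤m+n R R))

    incr : ∀ v i j → i < j → j < 3 → key v i < key v j
    incr v 0 1 _ _ = proj₁ (steps (proj₂ (kind v)))
    incr v 0 2 _ _ = <-trans (proj₁ (steps (proj₂ (kind v)))) (proj₂ (steps (proj₂ (kind v))))
    incr v 1 2 _ _ = proj₂ (steps (proj₂ (kind v)))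
    incr v (suc (suc i)) 2 (s≤s (s≤s ())) _
    incr v (suc i) 1 (s≤s ()) _
    incr v _ (suc (suc (suc _))) _ (s≤s (s≤s (s≤s ())))

    0<3 : 0 < 3
    0<3 = s≤s z≤n
    1<3 : 1 < 3
    1<3 = s≤s (s≤s z≤n)
    2<3 : 2 < 3
    2<3 = s≤s (s≤s (s≤s z≤n))

    open KeyOrder G 3 1<3 key (λ v → proj₁ (steps (proj₂ (kind v))))

    em-before : ∀ {x y g} → S x ≡ false → e x ≤ b x → x ≢ y → Kind y g → toℕ x < toℕ y ⊎ Z ≤ g 0 → toℕ x * 3 + 1 < g 0
    em-before {x} sx p x≢y k (inj₂ q) = <-≤-trans (tag<Z x 1 1<3) q
    em-before {x} sx p x≢y (em _ _) (inj₁ q) = lex 0 q 1<3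
    em-before {x} sx p x≢y (cl _) (inj₁ q) = <-≤-trans (tag<Z x 1 1<3) (Z≤κ _ _)
    em-before {x} sx p x≢y (int _ _ _) (inj₁ q) = <-≤-trans (tag<Z x 1 1<3) (Z≤κ _ _)
    em-before {x} sx p x≢y (wr _ _ _) (inj₁ q) = <-≤-trans (tag<Z x 1 1<3) (Z≤κ _ _)

    clique-clique : ∀ {x y} → S x ≡ true → S y ≡ true → pos x < pos y →
      Interleave 3 (three (κ (pos x) (R + R)) (κ (m + pos x) (R + R)) (κ (m + m + pos x) (R + R)))
                   (three (κ (pos y) (R + R)) (κ (m + pos y) (R + R)) (κ (m + m + pos y) (R + R)))
    clique-clique {x} {y} sx sy p = interleave₃
      (κ-< p ≤-refl)
      (κ-< (m≤n⇒m≤n+o (pos x) (pos< sy)) ≤-refl)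
      (κ-< (+-monoʳ-< m p) ≤-refl)
      (κ-< (lia 3 (λ m x y → y :< m ∷ [] ⊢ m :+ y :< m :+ m :+ x) m (pos x) (pos y) (pos< sy)) ≤-refl)
      (κ-< (+-monoʳ-< (m + m) p) ≤-refl)

    R+ρ< : ∀ {p} v → p ≤ m + m → R + ρ p v < R + R
    R+ρ< v p = +-monoʳ-< R (ρ< v p)

    clique-good : ∀ {c x f g} → c ≢ x → Kind c f → S c ≡ true → Kind x g → key c ≡ f → key x ≡ g → Good c x
    clique-good {c} {x} c≢x (em sc′ _) sc _ _ _ = contradiction sc′ (true≢false sc)
    clique-good {c} {x} c≢x (int sc′ _ _) sc _ _ _ = contradiction sc′ (true≢false sc)
    clique-good {c} {x} c≢x (wr sc′ _ _) sc _ _ _ = contradiction sc′ (true≢false sc)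
    clique-good {c} {x} c≢x (cl sc) _ (cl sx) kc kx with <-cmp (pos c) (pos x)
    ... | tri< p _ _ = yes-iff (clique c x c≢x sc sx) (alt-from kc kx (clique-clique sc sx p))
    ... | tri≈ _ p _ = contradiction (pos-inj sc sx p) c≢x
    ... | tri> _ _ p = yes-iff (clique c x c≢x sc sx) (swap (alt-from kx kc (clique-clique sx sc p)))
    clique-good {c} {x} c≢x K@(cl sc) _ (em sx p) kc kx = good-sym {x} {c} (no-iff
      (¬true λ q → case to (member sx sc) q of λ
        { (inj₁ (r , s)) → <⇒≱ (≤-<-trans r s) p
        ; (inj₂ r) → <⇒≱ (≤-<-trans (m≤n+m m (pos c)) r) (≤-trans p (b≤m x)) })
      (¬alt-first kx kc (em-before sx p (c≢x ∘ sym) K (inj₂ (Z≤κ _ _)))))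
    clique-good {c} {x} c≢x (cl sc) _ (int sx p q) kc kx = good-sym {x} {c} (go (b x ℕ.≤? pos c) (pos c ℕ.<? e x))
      where
      o = pos c
      o<m = pos< sc
      go : Dec (b x ≤ o) → Dec (o < e x) → Good x c
      go (yes r) (yes s) = yes-iff (from (member sx sc) (inj₁ (r , s))) (swap (alt-from kc kx (interleave₃
        (κ-< (m≤n⇒m≤n+o (b x) o<m) ≤-refl)
        (κ-≤ (+-monoʳ-≤ m r) (R+ρ< x (≤-trans (b≤m x) (m≤m+n m m))))
        (κ-< (+-monoʳ-< m o<m) ≤-refl)
        (κ-≤ (m≤m+n (m + m) o) (ρ̄< x))
        (κ-< (+-monoʳ-< (m + m) s) ≤-refl))))
      go (no ¬r) _ = no-iff
        (¬true λ t → case to (member sx sc) t of λ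
          { (inj₁ (r , _)) → ¬r r ; (inj₂ s) → <⇒≱ (≤-<-trans (m≤n+m m o) s) q })
        (¬alt-first kc kx (κ-< (+-monoʳ-< m (≰⇒> ¬r)) ≤-refl) ∘ swap)
      go _ (no ¬s) = no-iff
        (¬true λ t → case to (member sx sc) t of λ
          { (inj₁ (_ , s)) → ¬s s ; (inj₂ s) → <⇒≱ (≤-<-trans (m≤n+m m o) s) q })
        (¬alt kc kx 0 2 0<3 2<3 (κ-< (m≤n⇒m≤n+o (b x) o<m) ≤-refl)
          (κ-≤ (+-monoʳ-≤ (m + m) (≮⇒≥ ¬s)) (≤-trans (1≤R x) (m≤m+n R R))) ∘ swap)
    clique-good {c} {x} c≢x (cl sc) _ (wr sx p q) kc kx =
      good-sym {x} {c} (go (b x ℕ.≤? pos c) (pos c + m ℕ.<? e x))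
      where
      o = pos c
      o<m = pos< sc
      1<2R : 1 < R + R
      1<2R = +-mono-≤ (1≤R x) (1≤R x)
      e≤E+m : e x ≤ E + m
      e≤E+m = subst (e x ≤_) (+-comm m E) (≤-trans (m≤n+m∸n (e x) m) (+-monoʳ-≤ m (e-m≤E sx)))
      go : Dec (b x ≤ o) → Dec (o + m < e x) → Good x c
      go (yes r) _ = yes-iff (from (member sx sc) (inj₁ (r , <-trans o<m q))) (alt-from kx kc (interleave₃
        (κ-≤ (≤-trans (E≤b sx q) r) (ρ̄< x))
        (κ-< (<-trans o<m q) ≤-refl)
        (κ-≤ (lia 4 (λ e b o m → e :≤ b :+ m ∷ b :≤ o ∷ [] ⊢ e :≤ m :+ o) (e x) (b x) o m (e≤ x) r)
             (<-≤-trans (ρ< x (e≤2m p)) (m≤m+n R R)))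
        (κ-< (lia 3 (λ b o m → o :< m ∷ [] ⊢ m :+ o :< m :+ m :+ b) (b x) o m o<m) ≤-refl)
        (κ-≤ (+-monoʳ-≤ (m + m) r) 1<2R)))
      go (no ¬r) (yes s) = yes-iff (from (member sx sc) (inj₂ s)) (swap (alt-from kc kx (interleave₃
        (κ-< (lia 4 (λ e E o m → e :≤ E :+ m ∷ o :+ m :< e ∷ [] ⊢ o :< E) (e x) E o m e≤E+m s) ≤-refl)
        (κ-≤ (m≤n⇒m≤n+o o (≤-trans (E≤b sx q) (<⇒≤ p))) (ρ̄< x))
        (κ-< (subst (_< e x) (+-comm o m) s) ≤-refl)
        (κ-≤ (m≤n⇒m≤n+o o (e≤2m p)) (<-≤-trans (ρ< x (e≤2m p)) (m≤m+n R R)))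
        (κ-< (+-monoʳ-< (m + m) (≰⇒> ¬r)) ≤-refl))))
      go (no ¬r) (no ¬s) = no-iff
        (¬true λ t → case to (member sx sc) t of λ { (inj₁ (r , _)) → ¬r r ; (inj₂ s) → ¬s s })
        (¬alt kx kc 1 2 1<3 2<3
          (κ-≤ (subst (e x ≤_) (+-comm o m) (≮⇒≥ ¬s)) (<-≤-trans (ρ< x (e≤2m p)) (m≤m+n R R)))
          (κ-< (+-monoʳ-< (m + m) (≰⇒> ¬r)) ≤-refl))

    -- Intervals open in the order given by `ρ` and pass the shared point 2m in the reverse order,
    -- which already excludes alternation.
    int-int : ∀ {x y f g} → S x ≡ false → S y ≡ false → b x ≤ b y → ρ (b x) x < ρ (b y) y →
      key x ≡ three (κ (m + b x) (R + ρ (b x) x)) (κ (m + m) (ρ̄ (b x) x)) f →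
      key y ≡ three (κ (m + b y) (R + ρ (b y) y)) (κ (m + m) (ρ̄ (b y) y)) g → Good x y
    int-int {x} {y} sx sy p q kx ky = no-iff (indep x y sx sy)
      (¬alt kx ky 0 1 0<3 1<3 (κ-≤ (+-monoʳ-≤ m p) (+-monoʳ-< R q))
        (κ-≤ ≤-refl (ρ̄-anti q (ρ< y (≤-trans (b≤m y) (m≤m+n m m))))))

    wr-wr : ∀ {x y f g} → S x ≡ false → S y ≡ false → b y < m → e x ≤ e y → ρ (e x) x < ρ (e y) y →
      key x ≡ three (κ E (ρ̄ (e x) x)) (κ (e x) (ρ (e x) x)) f →
      key y ≡ three (κ E (ρ̄ (e y) y)) (κ (e y) (ρ (e y) y)) g → Good x y
    wr-wr {x} {y} sx sy by p q kx ky = no-iff (indep x y sx sy)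
      (¬alt kx ky 1 0 1<3 0<3 (κ-≤ p q) (κ-≤ ≤-refl (ρ̄-anti q (ρ< y (e≤2m by)))))

    -- If e y ≤ b x, then x is first at the beginning and y is first at the end; the offsets 0 and 1
    -- decide the case e y = b x. Otherwise `no-cover` gives e x ≤ b y + m, and x occurs twice
    -- before y appears.
    wr-int : ∀ {x y} → x ≢ y → (Kx : S x ≡ false) → b x < m → m < e x → (Ky : S y ≡ false) → b y < e y →
      key x ≡ three (κ E (ρ̄ (e x) x)) (κ (e x) (ρ (e x) x)) (κ (m + m + b x) 1) →
      key y ≡ three (κ (m + b y) (R + ρ (b y) y)) (κ (m + m) (ρ̄ (b y) y)) (κ (m + m + e y) 0) → Good x y
    wr-int {x} {y} x≢y sx p q sy r kx ky with b x ℕ.<? e y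
    ... | no ¬s = no-iff (indep x y sx sy)
      (¬alt kx ky 0 2 0<3 2<3 (κ-< (≤-<-trans (E≤b sx q) (m≤n⇒m≤n+o (b y) p)) (<⇒≤ (ρ̄< _)))
        (κ-≤ (+-monoʳ-≤ (m + m) (≮⇒≥ ¬s)) ≤-refl))
    ... | yes s = no-iff (indep x y sx sy) (¬alt-first kx ky
      (κ-≤ (subst (e x ≤_) (+-comm (b y) m) (no-cover sy sx (x≢y ∘ sym) s)) (<-≤-trans (ρ< x (e≤2m p)) (m≤m+n R _))))

    em-good : ∀ {x y g} → x ≢ y → S x ≡ false → e x ≤ b x → S y ≡ false → Kind y g →
      key x ≡ (λ i → toℕ x * 3 + i) → key y ≡ g → Good x y
    em-good {x} {y} x≢y sx p sy K@(em _ q) kx ky = no-iff (indep x y sx sy)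
      (case <-cmp (toℕ x) (toℕ y) of λ
        { (tri< r _ _) → ¬alt-first kx ky (em-before sx p x≢y K (inj₁ r))
        ; (tri≈ _ r _) → contradiction (toℕ-injective r) x≢y
        ; (tri> _ _ r) → ¬alt-first ky kx (em-before sy q (x≢y ∘ sym) (em sx p) (inj₁ r)) ∘ swap })
    em-good {x} {y} x≢y sx p sy K@(cl _) kx ky = no-iff (indep x y sx sy)
        (¬alt-first kx ky (em-before sx p x≢y K (inj₂ (Z≤κ _ _))))
    em-good {x} {y} x≢y sx p sy K@(int _ _ _) kx ky = no-iff (indep x y sx sy)
        (¬alt-first kx ky (em-before sx p x≢y K (inj₂ (Z≤κ _ _))))
    em-good {x} {y} x≢y sx p sy K@(wr _ _ _) kx ky = no-iff (indep x y sx sy)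
        (¬alt-first kx ky (em-before sx p x≢y K (inj₂ (Z≤κ _ _))))

    good : ∀ {x y f g} → x ≢ y → Kind x f → Kind y g → key x ≡ f → key y ≡ g → Good x y
    good x≢y K@(cl sx) L kx ky = clique-good x≢y K sx L kx ky
    good {x} {y} x≢y K L@(cl sy) kx ky = good-sym {y} {x} (clique-good (x≢y ∘ sym) L sy K ky kx)
    good x≢y (em sx p) L@(em sy _) kx ky = em-good x≢y sx p sy L kx ky
    good x≢y (em sx p) L@(int sy _ _) kx ky = em-good x≢y sx p sy L kx ky
    good x≢y (em sx p) L@(wr sy _ _) kx ky = em-good x≢y sx p sy L kx ky
    good {x} {y} x≢y K@(int sx _ _) (em sy q) kx ky = good-sym {y} {x} (em-good (x≢y ∘ sym) sy q sx K ky kx)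
    good {x} {y} x≢y K@(wr sx _ _) (em sy q) kx ky = good-sym {y} {x} (em-good (x≢y ∘ sym) sy q sx K ky kx)
    good {x} {y} x≢y (int sx _ _) (int sy _ _) kx ky with ρ-tri (b x) (b y) x≢y
    ... | inj₁ (p , q) = int-int sx sy p q kx ky
    ... | inj₂ (p , q) = good-sym {y} {x} (int-int sy sx p q ky kx)
    good {x} {y} x≢y (wr sx bx _) (wr sy by _) kx ky with ρ-tri (e x) (e y) x≢y
    ... | inj₁ (p , q) = wr-wr sx sy by p q kx ky
    ... | inj₂ (p , q) = good-sym {y} {x} (wr-wr sy sx bx p q ky kx)
    good x≢y (wr sx p q) (int sy r _) kx ky = wr-int x≢y sx p q sy r kx ky
    good {x} {y} x≢y (int sx r _) (wr sy p q) kx ky = good-sym {y} {x} (wr-int (x≢y ∘ sym) sy p q sx r ky kx)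

  threeUniform : ∃ λ w → Uniform 3 w × Represents G w
  threeUniform = let w , uni , alternates = wordFromKeys 3 key incr in
    w , uni , λ x y x≢y → let g = good x≢y (proj₂ (kind x)) (proj₂ (kind y)) refl refl
                              a = alternates x y x≢y in mk⇔ (from a ∘ to g) (from g ∘ to a)

-- Overlapping arcs and their relative position in the cover

module ArcFacts {n} {S : Fin n → Bool} {N : Fin n → Fin n → Bool} (A : ArcModel S N) where

  open ArcModel A

  record Overlap (x y : Fin n) : Set where
    constructor overlapping
    field
      left    : S x ≡ false
      right   : S y ≡ false
      common  : ∃ λ c → S c ≡ true × N x c ≡ true × N y c ≡ true
      onlyˡ   : ∃ λ c → S c ≡ true × N x c ≡ true × N y c ≡ false
      onlyʳ   : ∃ λ c → S c ≡ true × N x c ≡ false × N y c ≡ true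

  overlap-sym : ∀ {x y} → Overlap x y → Overlap y x
  overlap-sym (overlapping l r (c , s , p , q) (c′ , s′ , p′ , q′) (c″ , s″ , p″ , q″)) =
    overlapping r l (c , s , q , p) (c″ , s″ , q″ , p″) (c′ , s′ , q′ , p′)

  overlap? : ∀ x y → Dec (Overlap x y)
  overlap? x y = map′ (λ (l , r , p , q , t) → overlapping l r p q t) (λ (overlapping l r p q t) → l , r , p , q , t)
    ((S x Bool.≟ false) ×-dec (S y Bool.≟ false)
      ×-dec any? (λ c → (S c Bool.≟ true) ×-dec (N x c Bool.≟ true) ×-dec (N y c Bool.≟ true))
      ×-dec any? (λ c → (S c Bool.≟ true) ×-dec (N x c Bool.≟ true) ×-dec (N y c Bool.≟ false))
      ×-dec any? (λ c → (S c Bool.≟ true) ×-dec (N x c Bool.≟ false) ×-dec (N y c Bool.≟ true)))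

  overlap-irrefl : ∀ {x y} → Overlap x y → x ≢ y
  overlap-irrefl (overlapping _ _ _ (_ , _ , p , q) _) refl = true≢false p q

  Inside : Fin n → Fin n → Set
  Inside x c = (b x ≤ pos c × pos c < e x) ⊎ pos c + m < e x

  Start Last : Fin n → Fin n → Set
  Start x c = S c ≡ true × pos c ≡ b x
  Last x c = S c ≡ true × (suc (pos c) ≡ e x ⊎ suc (pos c + m) ≡ e x)

  startVertex : ∀ {x} → b x < e x → ∃ (Start x)
  startVertex {x} p = at (b x) (b< p)

  lastVertex : ∀ {x} → b x < e x → ∃ (Last x)
  lastVertex {x} p with e x ℕ.≤? m
  lastVertex {x} p | yes q with e x in eq
  ... | suc k = let c , s , r = at k q in c , s , inj₁ (cong suc r)
  lastVertex {x} p | no q =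
    let c , s , r = at (e x ∸ suc m)
          (lia 4 (λ b e m k → b :< m ∷ e :≤ b :+ m ∷ k :+ (con 1 :+ m) :≡ e ∷ [] ⊢ k :< m)
            (b x) (e x) m (e x ∸ suc m) (b< p) (e≤ x) (m∸n+n≡m (≰⇒> q)))
    in c , s , inj₂ (trans (cong (λ k → suc (k + m)) r) (trans (sym (+-suc _ m)) (m∸n+n≡m (≰⇒> q))))

  -- In the second case the arc of y starts one lap later.
  data Precedes (x y : Fin n) : Set where
    near : b x < b y → b y < e x → e x < e y → Precedes x y
    far  : b x < b y + m → b y + m < e x → e x < e y + m → Precedes x y

  -- Overlapping arcs whose intervals meet unshifted need different copies in the doubled clique; the other overlapping
  -- arcs meet after a shift by one lap, so they need equal copies.
  meets : Fin n → Fin n → Bool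
  meets x y = (b y <ᵇ e x) ∧ (b x <ᵇ e y)

  meets-true : ∀ {x y} → b y < e x → b x < e y → meets x y ≡ true
  meets-true {x} {y} p q with b y <ᵇ e x | <⇒<ᵇ p | b x <ᵇ e y | <⇒<ᵇ q
  ... | true | _ | true | _ = refl

  meets-false : ∀ {x y} → ¬ (b y < e x × b x < e y) → meets x y ≡ false
  meets-false {x} {y} p with b y <ᵇ e x in eq | b x <ᵇ e y in eq′
  ... | false | _ = refl
  ... | true | false = refl
  ... | true | true = contradiction (<ᵇ⇒< (b y) (e x) (subst T (sym eq) tt) , <ᵇ⇒< (b x) (e y)
      (subst T (sym eq′) tt)) p

  meets-sym : ∀ x y → meets x y ≡ meets y x
  meets-sym x y = Bool.∧-comm (b y <ᵇ e x) (b x <ᵇ e y)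

  nonemptyˡ : ∀ {x y} → Precedes x y → b x < e x
  nonemptyˡ (near p q r) = <-trans p q
  nonemptyˡ (far p q r) = <-trans p q

  nonemptyʳ : ∀ {x y} → Precedes x y → b y < e y
  nonemptyʳ (near p q r) = <-trans q r
  nonemptyʳ {x} {y} (far p q r) = +-cancelʳ-< m (b y) (e y) (<-trans q r)

  start-in : ∀ {x c} → b x < e x → Start x c → Inside x c
  start-in {x} p (_ , eq) rewrite eq = inj₁ (≤-refl , p)

  last-in : ∀ {x c} → b x < e x → Last x c → Inside x c
  last-in p (_ , inj₁ eq) = inj₁ (s≤s⁻¹ (subst (_ <_) (sym eq) p) , ≤-reflexive eq)
  last-in p (_ , inj₂ eq) = inj₂ (≤-reflexive eq)

  module _ {x y} (sx : S x ≡ false) (sy : S y ≡ false) (x≢y : x ≢ y) where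

    startʳ-inˡ : ∀ {c} → Precedes x y → Start y c → Inside x c
    startʳ-inˡ (near p q r) (_ , eq) rewrite eq = inj₁ (<⇒≤ p , q)
    startʳ-inˡ (far p q r) (_ , eq) rewrite eq = inj₂ q

    -- Arcs meeting both unshifted and one lap later would cover the circle.
    far-b : b y + m < e x → ¬ b x < e y
    far-b p q = <⇒≱ p (no-cover sy sx (x≢y ∘ sym) q)

    startˡ-outʳ : ∀ {c} → Precedes x y → Start x c → ¬ Inside y c
    startˡ-outʳ (near p q r) (_ , eq) (inj₁ (s , t)) rewrite eq = <⇒≱ p s
    startˡ-outʳ (near p q r) (_ , eq) (inj₂ s) rewrite eq = <⇒≱ s (no-cover sx sy x≢y q)
    startˡ-outʳ (far p q r) (_ , eq) (inj₁ (s , t)) rewrite eq = far-b q t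
    startˡ-outʳ (far p q r) (_ , eq) (inj₂ s) rewrite eq =
      lia 5 (λ b e b′ e′ m → b′ :+ m :< e ∷ e :≤ b :+ m ∷ b :+ m :< e′ ∷ e′ :≤ b′ :+ m ∷ [] ⊢ :⊥)
        (b x) (e x) (b y) (e y) m q (e≤ x) s (e≤ y)

    lastˡ-inʳ : ∀ {c} → Precedes x y → Last x c → Inside y c
    lastˡ-inʳ (near p q r) (_ , inj₁ eq) rewrite sym eq = inj₁ (s≤s⁻¹ q , <-trans ≤-refl r)
    lastˡ-inʳ (near p q r) (_ , inj₂ eq) rewrite sym eq = inj₂ (<-trans ≤-refl r)
    lastˡ-inʳ {c} (far p q r) (sc , inj₁ eq) rewrite sym eq = contradiction (pos< sc)
        (≤⇒≯ (≤-trans (m≤n+m m (b y)) (s≤s⁻¹ q)))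
    lastˡ-inʳ {c} (far p q r) (_ , inj₂ eq) rewrite sym eq =
      inj₁ (+-cancelʳ-≤ m (b y) (pos c) (s≤s⁻¹ q) , +-cancelʳ-< m (pos c) (e y) (<-trans ≤-refl r))

    lastʳ-outˡ : ∀ {c} → Precedes x y → Last y c → ¬ Inside x c
    lastʳ-outˡ (near p q r) (_ , inj₁ eq) (inj₁ (s , t)) rewrite sym eq = <⇒≱ t (s≤s⁻¹ r)
    lastʳ-outˡ (near p q r) (_ , inj₁ eq) (inj₂ s) rewrite sym eq = <⇒≱ s (≤-trans (s≤s⁻¹ r) (m≤m+n _ m))
    lastʳ-outˡ {c} (near p q r) (_ , inj₂ eq) (inj₁ (s , t)) =
      lia 4 (λ o m b e → con 1 :+ (o :+ m) :≡ e ∷ e :≤ b :+ m ∷ b :≤ o ∷ [] ⊢ :⊥)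
        (pos c) m (b x) (e y) eq (no-cover sx sy x≢y q) s
    lastʳ-outˡ (near p q r) (_ , inj₂ eq) (inj₂ s) rewrite sym eq = <⇒≱ s (s≤s⁻¹ r)
    lastʳ-outˡ (far p q r) (_ , inj₁ eq) (inj₁ (s , t)) = far-b q (subst (b x <_) eq (s≤s s))
    lastʳ-outˡ (far p q r) (_ , inj₁ eq) (inj₂ s) rewrite sym eq = <⇒≱ s (s≤s⁻¹ r)
    lastʳ-outˡ (far p q r) (_ , inj₂ eq) (inj₁ (s , t)) = far-b q (subst (b x <_) eq (s≤s (≤-trans s (m≤m+n _ m))))
    lastʳ-outˡ (far p q r) (_ , inj₂ eq) (inj₂ s) = far-b q
      (subst (b x <_) eq (s≤s (≤-trans (b≤m x) (m≤n+m m _))))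

    precedes⇒overlap : Precedes x y → Overlap x y
    precedes⇒overlap p =
      let c , C = startVertex (nonemptyʳ p)
          c′ , C′ = startVertex (nonemptyˡ p)
          c″ , C″ = lastVertex (nonemptyʳ p)
      in overlapping sx sy
        (c , proj₁ C , from (member sx (proj₁ C)) (startʳ-inˡ p C) , from (member sy (proj₁ C))
            (start-in (nonemptyʳ p) C))
        (c′ , proj₁ C′ , from (member sx (proj₁ C′)) (start-in (nonemptyˡ p) C′)
          , ¬true (startˡ-outʳ p C′ ∘ to (member sy (proj₁ C′))))
        (c″ , proj₁ C″ , ¬true (lastʳ-outˡ p C″ ∘ to (member sx (proj₁ C″)))
          , from (member sy (proj₁ C″)) (last-in (nonemptyʳ p) C″))

  inside-nonempty : ∀ {x c} → Inside x c → b x < e x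
  inside-nonempty (inj₁ (p , q)) = ≤-<-trans p q
  inside-nonempty {x} {c} (inj₂ p) = ≤-<-trans (≤-trans (b≤m x) (m≤n+m m (pos c))) p

  nested-near : ∀ {x y c} → b x ≤ b y → e y ≤ e x → Inside y c → Inside x c
  nested-near p q (inj₁ (r , s)) = inj₁ (≤-trans p r , <-≤-trans s q)
  nested-near p q (inj₂ r) = inj₂ (<-≤-trans r q)

  inside : ∀ {x c} → S x ≡ false → S c ≡ true → N x c ≡ true → Inside x c
  inside sx sc = to (member sx sc)

  -- The interval of x ends before that of y starts, so a common neighbour lies in the second lap of
  -- y. Hence y reaches the start of x one lap later; it does not reach the end, or it would contain
  -- x.
  far-precedes : ∀ {x y} → Overlap x y → e x ≤ b y → Precedes y x
  far-precedes {x} {y} (overlapping sx sy (c , sc , xc , yc) (d , sd , xd , yd) _) p =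
    far (m≤n⇒m≤o+n (b x) (b< (inside-nonempty (inside sy sc yc)))) start-before (≰⇒> λ q → true≢false (nested q) yd)
    where
    ex<m : e x < suc m
    ex<m = s≤s (≤-trans p (b≤m y))
    start-before : b x + m < e y
    start-before with inside sx sc xc | inside sy sc yc
    ... | inj₁ (r , s) | inj₁ (t , _) = contradiction (≤-<-trans t s) (≤⇒≯ p)
    ... | inj₁ (r , s) | inj₂ t = ≤-<-trans (+-monoˡ-≤ m r) t
    ... | inj₂ r | _ = contradiction (≤-<-trans (m≤n+m m (pos c)) r) (≤⇒≯ (s≤s⁻¹ ex<m))
    nested : e x + m ≤ e y → N y d ≡ true
    nested q with inside sx sd xd
    ... | inj₁ (r , s) = from (member sy sd) (inj₂ (<-≤-trans (+-monoˡ-< m s) q))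
    ... | inj₂ r = contradiction (≤-<-trans (m≤n+m m (pos d)) r) (≤⇒≯ (s≤s⁻¹ ex<m))

  overlap⇒precedes : ∀ {x y} → Overlap x y → Precedes x y ⊎ Precedes y x
  overlap⇒precedes {x} {y} O@(overlapping sx sy _ (c , sc , xc , yc) (d , sd , xd , yd)) with b y ℕ.<? e x | b x ℕ.<?
      e y
  ... | no p | _ = inj₂ (far-precedes O (≮⇒≥ p))
  ... | _ | no q = inj₁ (far-precedes (overlap-sym O) (≮⇒≥ q))
  ... | yes p | yes q = go (<-cmp (b x) (b y)) (<-cmp (e x) (e y))
    where
    y⊆x : b x ≤ b y → e y ≤ e x → Precedes x y ⊎ Precedes y x
    y⊆x r s = contradiction xd (true≢false (from (member sx sd) (nested-near r s (inside sy sd yd))))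
    x⊆y : b y ≤ b x → e x ≤ e y → Precedes x y ⊎ Precedes y x
    x⊆y r s = contradiction yc (true≢false (from (member sy sc) (nested-near r s (inside sx sc xc))))
    go : Tri (b x < b y) (b x ≡ b y) (b y < b x) → Tri (e x < e y) (e x ≡ e y) (e y < e x) → Precedes x y ⊎ Precedes
        y x
    go (tri< r _ _) (tri< s _ _) = inj₁ (near r p s)
    go (tri> _ _ r) (tri> _ _ s) = inj₂ (near r q s)
    go (tri< r _ _) (tri≈ _ s _) = y⊆x (<⇒≤ r) (≤-reflexive (sym s))
    go (tri< r _ _) (tri> _ _ s) = y⊆x (<⇒≤ r) (<⇒≤ s)
    go (tri≈ _ r _) (tri> _ _ s) = y⊆x (≤-reflexive r) (<⇒≤ s)
    go (tri≈ _ r _) (tri≈ _ s _) = y⊆x (≤-reflexive r) (≤-reflexive (sym s))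
    go (tri≈ _ r _) (tri< s _ _) = x⊆y (≤-reflexive (sym r)) (<⇒≤ s)
    go (tri> _ _ r) (tri≈ _ s _) = x⊆y (<⇒≤ r) (≤-reflexive s)
    go (tri> _ _ r) (tri< s _ _) = x⊆y (<⇒≤ r) (<⇒≤ s)

-- Two laps: a 2-uniform word from a solution of the parity equations

two : ℕ → ℕ → ℕ → ℕ
two x y 0 = x
two x y _ = y

interleave₂ : ∀ {x y x′ y′} → x < x′ → x′ < y → y < y′ → Interleave 2 (two x y) (two x′ y′)
interleave₂ p q r =
  (λ { 0 _ → p ; 1 _ → r ; (suc (suc _)) (s≤s (s≤s ())) }) , λ { 0 _ → q ; (suc _) (s≤s (s≤s ())) }

-- On a circle of length T cut at L, an arc from O to C contributes its end points in the order in which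
-- they appear after the cut.
data Ends (L T O C : ℕ) : ℕ → ℕ → Set where
  straight : C < L → Ends L T O C O C
  wrapped  : ∀ {C′} → C ≡ C′ + T → L ≤ C → Ends L T O C C′ O

-- The ways in which two arcs with O < O′ fail to cross on the circle: the second lies inside the
-- first, is disjoint from it, or starts after it and swallows its whole next copy.
data Apart (T O C O′ C′ : ℕ) : Set where
  nested   : C′ < C → Apart T O C O′ C′
  disjoint : C < O′ → C′ < O + T → Apart T O C O′ C′
  around   : C < O′ → C + T < C′ → Apart T O C O′ C′

Crossing : (u v u′ v′ : ℕ) → Set
Crossing u v u′ v′ = u ≤ u′ × u′ ≤ v × v ≤ v′

apart⇒¬crossing : ∀ {L T O C O′ C′ u v u′ v′} → O < C → C < O + T → O < O′ → O′ < L → Apart T O C O′ C′ →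
  Ends L T O C u v → Ends L T O′ C′ u′ v′ → ¬ Crossing u v u′ v′ × ¬ Crossing u′ v′ u v
apart⇒¬crossing {O = O} {C} {O′} {C′} p q r l (nested a) (straight s) (straight s′) =
  (λ (i , j , k) → <⇒≱ a k) , (λ (i , j , k) → <⇒≱ r i)
apart⇒¬crossing p q r l (disjoint a b) (straight s) (straight s′) = (λ (i , j , k) → <⇒≱ a j) ,
    (λ (i , j , k) → <⇒≱ r i)
apart⇒¬crossing p q r l (around a b) (straight s) (straight s′) = (λ (i , j , k) → <⇒≱ a j) ,
    (λ (i , j , k) → <⇒≱ r i)
apart⇒¬crossing p q r l (nested a) (straight s) (wrapped eq t) = contradiction (≤-<-trans t a) (<-asym s)
apart⇒¬crossing {T = T} {O = O} p q r l (disjoint a b) (straight s) (wrapped {c} refl t) =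
  (λ (i , j , k) → <⇒≱ (+-cancelʳ-< T c O b) i) , (λ (i , j , k) → <⇒≱ a k)
apart⇒¬crossing {T = T} {C = C} p q r l (around a b) (straight s) (wrapped {c} refl t) =
  (λ (i , j , k) → <⇒≱ (+-cancelʳ-< T C c b) j) , (λ (i , j , k) → <⇒≱ (<-trans p (+-cancelʳ-< T C c b)) i)
apart⇒¬crossing {T = T} {O = O} p q r l _ (wrapped {c} refl t) (straight s) =
  (λ (i , j , k) → <⇒≱ r j) , (λ (i , j , k) → <⇒≱ (<-trans (+-cancelʳ-< T c O q) r) i)
apart⇒¬crossing {T = T} p q r l (nested a) (wrapped {c} refl t) (wrapped {c′} refl t′) =
  (λ (i , j , k) → <⇒≱ (+-cancelʳ-< T c′ c a) i) , (λ (i , j , k) → <⇒≱ r k)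
apart⇒¬crossing p q r l (disjoint a _) (wrapped refl t) (wrapped refl t′) = contradiction (<-trans a l) (≤⇒≯ t)
apart⇒¬crossing p q r l (around a _) (wrapped refl t) (wrapped refl t′) = contradiction (<-trans a l) (≤⇒≯ t)

-- The clique is written twice around the circle, so that an arc has two copies, and the colour of a vertex
-- selects one of them: its ends are the two occurrences of the vertex.
module TwoUniform (G : Graph) (S : Fin (n G) → Bool)
  (clique : ∀ x y → x ≢ y → S x ≡ true → S y ≡ true → adj G x y ≡ true)
  (indep : ∀ x y → S x ≡ false → S y ≡ false → adj G x y ≡ false)
  (A : ArcModel S (adj G))
  (colour : Fin (n G) → Bool)
  (proper : ∀ {x y} → ArcFacts.Overlap A x y → colour x xor colour y ≡ ArcFacts.meets A x y) where

  open ArcModel A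
  open ArcFacts A

  private
    V = Fin (n G)
    N = n G

    shift : Bool → ℕ
    shift false = 0
    shift true = m

    shift≤ : ∀ s → shift s ≤ m
    shift≤ true = ≤-refl
    shift≤ false = z≤n

    open-at close-at : V → ℕ
    open-at x = b x + shift (colour x)
    close-at x = e x + shift (colour x)

    abstract
      -- Length first, index second, so that no two arcs tie. At a common point all closings come
      -- before all openings, shorter arcs close first, and longer ones open first (`late`); thus
      -- shared end points never create a crossing.
      δ : V → ℕ
      δ x = (e x ∸ b x) * N + suc (toℕ x)

      H Z T′ : ℕ
      H = suc (suc m * N)
      Z = 2 * N
      T′ = (m + m) * suc (H + H)

      δ<H : ∀ x → δ x < H
      δ<H x = s≤s (≤-trans (+-mono-≤ (*-monoˡ-≤ N (m≤n+o⇒m∸n≤o (e x) (b x) (e≤ x))) (toℕ<n x))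
          (≤-reflexive (+-comm (m * N) N)))

      0<δ : ∀ x → 0 < δ x
      0<δ x = subst (0 <_) (sym (+-suc _ _)) (s≤s z≤n)

      δ-mono : ∀ {x y} → e x ∸ b x < e y ∸ b y → δ x < δ y
      δ-mono {x} {y} p = subst₂ _<_ (sym (+-suc _ _)) (sym (+-suc _ _)) (s≤s (lex (toℕ y) p (toℕ<n x)))

      δ-inj : ∀ {x y} → δ x ≡ δ y → x ≡ y
      δ-inj {x} {y} eq = toℕ-injective (proj₂ (lex-inj {e x ∸ b x} {e y ∸ b y} (toℕ<n x) (toℕ<n y)
        (suc-injective (trans (sym (+-suc _ _)) (trans eq (+-suc _ _))))))

      κ : ℕ → ℕ → ℕ
      κ p r = Z + (p * suc (H + H) + r)

      κ-< : ∀ {p q r s} → p < q → r ≤ H + H → κ p r < κ q s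
      κ-< {s = s} p<q r≤ = +-monoʳ-< Z (lex s p<q (s≤s r≤))

      κ-≤ : ∀ {p q r s} → p ≤ q → r < s → κ p r < κ q s
      κ-≤ p≤q r<s = +-monoʳ-< Z (lex-≤ p≤q r<s)

      κ-lap : ∀ p r → κ (p + (m + m)) r ≡ κ p r + T′
      κ-lap p r rewrite *-distribʳ-+ (suc (H + H)) p (m + m) =
        lia 4 (λ z p t r → [] ⊢ z :+ (p :+ t :+ r) :≡ z :+ (p :+ r) :+ t) Z (p * suc (H + H)) T′ r

      Z≤κ : ∀ p r → Z ≤ κ p r
      Z≤κ p r = m≤m+n Z _

      tag<Z : ∀ (v : V) i → i < 2 → toℕ v * 2 + i < Z
      tag<Z v i i<2 = <-≤-trans (lex 0 (toℕ<n v) i<2) (≤-reflexive (trans (+-identityʳ _) (*-comm N 2)))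

      late : V → ℕ
      late x = H + H ∸ δ x

      late<2H : ∀ x → late x < H + H
      late<2H x = ∸-monoʳ-< {o = 0} (0<δ x) (<⇒≤ (<-≤-trans (δ<H x) (m≤m+n H H)))

      δ<late : ∀ x y → δ x < late y
      δ<late x y = <-≤-trans (δ<H x) (≤-trans (≤-reflexive (sym (m+n∸n≡m H H))) (∸-monoʳ-≤ (H + H) (<⇒≤ (δ<H y))))

      late-anti : ∀ {x y} → δ y < δ x → late x < late y
      late-anti {x} p = ∸-monoʳ-< p (<⇒≤ (<-≤-trans (δ<H x) (m≤m+n H H)))

    δ≤2H : ∀ x → δ x < H + H
    δ≤2H x = <-≤-trans (δ<H x) (m≤m+n H H)

    data Kind (v : V) : (ℕ → ℕ) → Set where
      cl : S v ≡ true → Kind v (two (κ (pos v) (H + H)) (κ (m + pos v) (H + H)))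
      em : S v ≡ false → e v ≤ b v → Kind v (λ i → toℕ v * 2 + i)
      arc : ∀ {s t} → S v ≡ false → b v < e v →
        Ends (κ (m + m) 0) T′ (κ (open-at v) (late v)) (κ (close-at v) (δ v)) s t → Kind v (two s t)

    ends : ∀ v → ∃₂ (Ends (κ (m + m) 0) T′ (κ (open-at v) (late v)) (κ (close-at v) (δ v)))
    ends v with close-at v ℕ.<? m + m
    ... | yes p = -, -, straight (κ-< p (<⇒≤ (δ≤2H v)))
    ... | no p = κ (close-at v ∸ (m + m)) (δ v) , -, wrapped
        (trans (cong (λ k → κ k (δ v)) (sym (m∸n+n≡m (≮⇒≥ p)))) (κ-lap _ _))
        (<⇒≤ (κ-≤ (≮⇒≥ p) (0<δ v)))

    kind : ∀ v → ∃ (Kind v)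
    kind v with S v in sv | b v ℕ.<? e v
    ... | true | _ = -, cl sv
    ... | false | no p = -, em sv (≮⇒≥ p)
    ... | false | yes p = -, arc sv p (proj₂ (proj₂ (ends v)))

    key : V → ℕ → ℕ
    key v = proj₁ (kind v)

    O C : V → ℕ
    O v = κ (open-at v) (late v)
    C v = κ (close-at v) (δ v)

    O<C : ∀ {v} → b v < e v → O v < C v
    O<C {v} p = κ-< (+-monoˡ-< (shift (colour v)) p) (<⇒≤ (late<2H v))

    C<O+T : ∀ {v} → b v < e v → C v < O v + T′
    C<O+T {v} p = subst (C v <_) (κ-lap _ _) (κ-<
      (lia 4 (λ b e s m → b :< m ∷ e :≤ b :+ m ∷ [] ⊢ e :+ s :< b :+ s :+ (m :+ m)) (b v) (e v) (shift (colour v)) m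
          (b< p) (e≤ v))
      (<⇒≤ (δ≤2H v)))

    steps : ∀ {v f} → Kind v f → f 0 < f 1
    steps {v} (cl sv) = κ-< (lia 2 (λ p m → p :< m ∷ [] ⊢ p :< m :+ p) (pos v) m (pos< sv)) ≤-refl
    steps {v} (em _ _) = +-monoʳ-< (toℕ v * 2) ≤-refl
    steps (arc _ p (straight _)) = O<C p
    steps {v} (arc _ p (wrapped {c} eq _)) = +-cancelʳ-< T′ c (O v) (subst (_< O v + T′) eq (C<O+T p))

    incr : ∀ v i j → i < j → j < 2 → key v i < key v j
    incr v zero 1 _ _ = steps (proj₂ (kind v))
    incr v (suc i) 1 (s≤s ()) _
    incr v _ (suc (suc _)) _ (s≤s (s≤s ()))

    open KeyOrder G 2 ≤-refl key (λ v → steps (proj₂ (kind v)))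

    refine-≤ : ∀ {x y} i j → refine key x i < refine key y j → key x i ≤ key y j
    refine-≤ {x} {y} i j p = ≮⇒≥ λ q → <-asym p (refine-< key y j x i q)

    interleave⇒crossing : ∀ {x y s t s′ t′} → key x ≡ two s t → key y ≡ two s′ t′ →
      Interleave 2 (refine key x) (refine key y) → Crossing s t s′ t′
    interleave⇒crossing {x} {y} kx ky (p , q) =
      subst₂ _≤_ (cong (λ f → f 0) kx) (cong (λ f → f 0) ky) (refine-≤ {x} {y} 0 0 (p 0 (s≤s z≤n)))
      , subst₂ _≤_ (cong (λ f → f 0) ky) (cong (λ f → f 1) kx) (refine-≤ {y} {x} 0 1 (q 0 ≤-refl))
      , subst₂ _≤_ (cong (λ f → f 1) kx) (cong (λ f → f 1) ky) (refine-≤ {x} {y} 1 1 (p 1 ≤-refl))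

    Z≤end : ∀ {y s t} → Ends (κ (m + m) 0) T′ (O y) (C y) s t → Z ≤ s
    Z≤end (straight _) = Z≤κ _ _
    Z≤end (wrapped {c} eq q) = +-cancelʳ-≤ T′ Z c (subst (Z + T′ ≤_) eq
      (≤-trans (+-monoˡ-≤ T′ (Z≤κ 0 0)) (≤-trans (≤-reflexive (sym (κ-lap 0 0))) q)))

    em-before : ∀ {x y g} → x ≢ y → Kind y g → toℕ x < toℕ y ⊎ Z ≤ g 0 → toℕ x * 2 + 1 < g 0
    em-before {x} _ _ (inj₂ q) = <-≤-trans (tag<Z x 1 ≤-refl) q
    em-before {x} x≢y (em _ _) (inj₁ q) = lex 0 q ≤-refl
    em-before {x} x≢y (cl _) (inj₁ _) = <-≤-trans (tag<Z x 1 ≤-refl) (Z≤κ _ _)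
    em-before {x} x≢y (arc _ _ E) (inj₁ q) = <-≤-trans (tag<Z x 1 ≤-refl) (Z≤end E)

    clique-clique : ∀ {x y} → S x ≡ true → S y ≡ true → pos x < pos y →
      Interleave 2 (two (κ (pos x) (H + H)) (κ (m + pos x) (H + H))) (two (κ (pos y) (H + H)) (κ (m + pos y) (H + H)))
    clique-clique {x} {y} sx sy p = interleave₂
      (κ-< p ≤-refl) (κ-< (m≤n⇒m≤n+o (pos x) (pos< sy)) ≤-refl) (κ-< (+-monoʳ-< m p) ≤-refl)

    module CliqueArc {c x} (sc : S c ≡ true) (sx : S x ≡ false) (p : b x < e x) where

      o = pos c
      o<m = pos< sc

      outside : ¬ (b x ≤ o × o < e x) → ¬ o + m < e x → adj G x c ≡ false
      outside q r = ¬true λ t → [ q , r ]′ (to (member sx sc) t)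

      alt-xc : ∀ {s t} → key c ≡ two (κ o (H + H)) (κ (m + o) (H + H)) → key x ≡ two s t →
        adj G x c ≡ true → s < κ o (H + H) → κ o (H + H) < t → t < κ (m + o) (H + H) → Good x c
      alt-xc kc kx q u v w = yes-iff q (alt-from kx kc (interleave₂ u v w))

      alt-cx : ∀ {s t} → key c ≡ two (κ o (H + H)) (κ (m + o) (H + H)) → key x ≡ two s t →
        adj G x c ≡ true → κ o (H + H) < s → s < κ (m + o) (H + H) → κ (m + o) (H + H) < t → Good x c
      alt-cx {s} {t} kc kx q u v w = yes-iff q (swap (alt-from kc kx (interleave₂ u v w)))

      a = open-at x
      f = close-at x
      c₀ = κ o (H + H)
      c₁ = κ (m + o) (H + H)
      Kc = key c ≡ two c₀ c₁

      e≤2m : e x ≤ m + m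
      e≤2m = ≤-trans (e≤ x) (+-monoˡ-≤ m (b≤m x))

      before : ∀ {P} → a ≤ P → O x < κ P (H + H)
      before q = κ-≤ q (late<2H x)

      before′ : ∀ {P} → f ≤ P → C x < κ P (H + H)
      before′ q = κ-≤ q (δ≤2H x)

      after : ∀ {P} → P < a → κ P (H + H) < O x
      after q = κ-< q ≤-refl

      after′ : ∀ {P} → P < f → κ P (H + H) < C x
      after′ q = κ-< q ≤-refl

      lap-before : ∀ {c′ P} → C x ≡ c′ + T′ → f ≤ P + (m + m) → c′ < κ P (H + H)
      lap-before {c′} eq q = +-cancelʳ-< T′ c′ _ (subst₂ _<_ eq (κ-lap _ (H + H)) (before′ q))

      lap-after : ∀ {c′ P} → C x ≡ c′ + T′ → P + (m + m) < f → κ P (H + H) < c′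
      lap-after {c′} eq q = +-cancelʳ-< T′ _ c′ (subst₂ _<_ (κ-lap _ (H + H)) eq (after′ q))

      unshifted : a ≡ b x → f ≡ e x → ∀ {t} → Kc → key x ≡ two (O x) t → t ≡ C x →
        Dec (b x ≤ o) → Dec (o < e x) → Dec (o + m < e x) → Good x c
      unshifted a≡ f≡ kc kx refl (yes u) (yes v) _ = alt-xc kc kx (from (member sx sc) (inj₁ (u , v)))
        (before (subst (_≤ o) (sym a≡) u))
        (after′ (subst (o <_) (sym f≡) v))
        (before′ (lia 5 (λ f e b o m → f :≡ e ∷ e :≤ b :+ m ∷ b :≤ o ∷ [] ⊢ f :≤ m :+ o) f (e x) (b x) o m f≡ (e≤ x)
            u))
      unshifted a≡ f≡ kc kx refl (yes u) (no v) _ = no-iff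
        (outside (v ∘ proj₂) λ w → v (≤-<-trans (m≤m+n o m) w))
        (¬alt-first kx kc (before′ (subst (_≤ o) (sym f≡) (≮⇒≥ v))))
      unshifted a≡ f≡ kc kx refl (no u) _ (yes w) = alt-cx kc kx (from (member sx sc) (inj₂ w))
        (after (subst (o <_) (sym a≡) (≰⇒> u)))
        (before (lia 4 (λ a b o m → a :≡ b ∷ b :≤ m ∷ [] ⊢ a :≤ m :+ o) a (b x) o m a≡ (b≤m x)))
        (after′ (lia 4 (λ f e o m → f :≡ e ∷ o :+ m :< e ∷ [] ⊢ m :+ o :< f) f (e x) o m f≡ w))
      unshifted a≡ f≡ kc kx refl (no u) _ (no w) = no-iff (outside (u ∘ proj₁) w)
        (¬alt kc kx 0 1 (s≤s z≤n) ≤-refl (after (subst (o <_) (sym a≡) (≰⇒> u)))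
          (before′ (lia 4 (λ f e o m → f :≡ e ∷ e :≤ o :+ m ∷ [] ⊢ f :≤ m :+ o) f (e x) o m f≡ (≮⇒≥ w))) ∘ swap)

      shifted : a ≡ b x + m → f ≡ e x + m → f < m + m → ∀ {t} → Kc → key x ≡ two (O x) t → t ≡ C x →
        Dec (b x ≤ o) → Dec (o < e x) → Good x c
      shifted a≡ f≡ f< kc kx refl (yes u) (yes v) = alt-cx kc kx (from (member sx sc) (inj₁ (u , v)))
        (after (lia 4 (λ a b o m → a :≡ b :+ m ∷ o :< m ∷ [] ⊢ o :< a) a (b x) o m a≡ o<m))
        (before (lia 4 (λ a b o m → a :≡ b :+ m ∷ b :≤ o ∷ [] ⊢ a :≤ m :+ o) a (b x) o m a≡ u))
        (after′ (lia 4 (λ f e o m → f :≡ e :+ m ∷ o :< e ∷ [] ⊢ m :+ o :< f) f (e x) o m f≡ v))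
      shifted a≡ f≡ f< kc kx refl (no u) _ = no-iff
        (outside (u ∘ proj₁) λ w → lia 4 (λ f e o m → f :≡ e :+ m ∷ f :< m :+ m ∷ o :+ m :< e ∷ [] ⊢ :⊥) f (e x) o m
            f≡ f< w)
        (¬alt-first kc kx (after (lia 4 (λ a b o m → a :≡ b :+ m ∷ o :< b ∷ [] ⊢ m :+ o :< a) a (b x) o m a≡
            (≰⇒> u))) ∘ swap)
      shifted a≡ f≡ f< kc kx refl _ (no v) = no-iff
        (outside (v ∘ proj₂) λ w → v (≤-<-trans (m≤m+n o m) w))
        (¬alt kc kx 0 1 (s≤s z≤n) ≤-refl (after (lia 4 (λ a b o m → a :≡ b :+ m ∷ o :< m ∷ [] ⊢ o :< a) a (b x) o m
            a≡ o<m))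
          (before′ (lia 4 (λ f e o m → f :≡ e :+ m ∷ e :≤ o ∷ [] ⊢ f :≤ m :+ o) f (e x) o m f≡ (≮⇒≥ v))) ∘ swap)

      shifted-wrapped : a ≡ b x + m → f ≡ e x + m → m + m ≤ f → ∀ {c′} → C x ≡ c′ + T′ → Kc → key x ≡ two c′ (O x) →
        Dec (b x ≤ o) → Dec (o + m < e x) → Good x c
      shifted-wrapped a≡ f≡ f≥ eq kc kx (yes u) _ = alt-xc kc kx
        (from (member sx sc) (inj₁ (u , lia 4 (λ f e o m → f :≡ e :+ m ∷ m :+ m :≤ f ∷ o :< m ∷ [] ⊢ o :< e) f (e x)
            o m f≡ f≥ o<m)))
        (lap-before eq (lia 5 (λ f e b o m → f :≡ e :+ m ∷ e :≤ b :+ m ∷ b :≤ o ∷ [] ⊢ f :≤ o :+ (m :+ m)) f (e x)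
            (b x) o m f≡ (e≤ x) u))
        (after (lia 4 (λ a b o m → a :≡ b :+ m ∷ o :< m ∷ [] ⊢ o :< a) a (b x) o m a≡ o<m))
        (before (lia 4 (λ a b o m → a :≡ b :+ m ∷ b :≤ o ∷ [] ⊢ a :≤ m :+ o) a (b x) o m a≡ u))
      shifted-wrapped a≡ f≡ f≥ eq kc kx (no u) (yes w) = alt-cx kc kx (from (member sx sc) (inj₂ w))
        (lap-after eq (lia 4 (λ f e o m → f :≡ e :+ m ∷ o :+ m :< e ∷ [] ⊢ o :+ (m :+ m) :< f) f (e x) o m f≡ w))
        (lap-before eq (lia 4 (λ f e o m → f :≡ e :+ m ∷ e :≤ m :+ m ∷ [] ⊢ f :≤ m :+ o :+ (m :+ m)) f (e x) o m f≡
            e≤2m))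
        (after (lia 4 (λ a b o m → a :≡ b :+ m ∷ o :< b ∷ [] ⊢ m :+ o :< a) a (b x) o m a≡ (≰⇒> u)))
      shifted-wrapped a≡ f≡ f≥ eq kc kx (no u) (no w) = no-iff (outside (u ∘ proj₁) w)
        (¬alt kx kc 0 1 (s≤s z≤n) ≤-refl
          (lap-before eq (lia 4 (λ f e o m → f :≡ e :+ m ∷ e :≤ o :+ m ∷ [] ⊢ f :≤ o :+ (m :+ m)) f (e x) o m f≡
              (≮⇒≥ w)))
          (after (lia 4 (λ a b o m → a :≡ b :+ m ∷ o :< b ∷ [] ⊢ m :+ o :< a) a (b x) o m a≡ (≰⇒> u))))

      cut : C x < κ (m + m) 0 → f < m + m
      cut q = ≰⇒> λ r → <-asym q (κ-≤ r (0<δ x))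

      cut′ : κ (m + m) 0 ≤ C x → m + m ≤ f
      cut′ q = ≮⇒≥ λ r → <⇒≱ (κ-< r (<⇒≤ (δ≤2H x))) q

      arc-good : ∀ {s t} → Kc → key x ≡ two s t → Ends (κ (m + m) 0) T′ (O x) (C x) s t →
        (a ≡ b x × f ≡ e x) ⊎ (a ≡ b x + m × f ≡ e x + m) → Good x c
      arc-good kc kx (straight q) (inj₁ (a≡ , f≡)) =
        unshifted a≡ f≡ kc kx refl (b x ℕ.≤? o) (o ℕ.<? e x) (o + m ℕ.<? e x)
      arc-good kc kx (straight q) (inj₂ (a≡ , f≡)) = shifted a≡ f≡ (cut q) kc kx refl (b x ℕ.≤? o) (o ℕ.<? e x)
      -- An unshifted arc ends before 2m, since e ≤ b + m and b < m, so the cut cannot split it.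
      arc-good kc kx (wrapped eq q) (inj₁ (a≡ , f≡)) = ⊥-elim
        (lia 4 (λ f e b m → f :≡ e ∷ m :+ m :≤ f ∷ b :< m ∷ e :≤ b :+ m ∷ [] ⊢ :⊥) f (e x) (b x) m f≡ (cut′ q) (b< p)
            (e≤ x))
      arc-good kc kx (wrapped eq q) (inj₂ (a≡ , f≡)) =
        shifted-wrapped a≡ f≡ (cut′ q) eq kc kx (b x ℕ.≤? o) (o + m ℕ.<? e x)

    placed : ∀ x → (open-at x ≡ b x × close-at x ≡ e x) ⊎ (open-at x ≡ b x + m × close-at x ≡ e x + m)
    placed x with colour x
    ... | false = inj₁ (+-identityʳ _ , +-identityʳ _)
    ... | true = inj₂ (refl , refl)

    module ArcArc {x y} (sx : S x ≡ false) (sy : S y ≡ false) (x≢y : x ≢ y) (px : b x < e x) (py : b y < e y) where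

      colours : Precedes x y ⊎ Precedes y x → colour x xor colour y ≡ meets x y
      colours (inj₁ p) = proper (precedes⇒overlap sx sy x≢y p)
      colours (inj₂ p) = proper (overlap-sym (precedes⇒overlap sy sx (x≢y ∘ sym) p))

      near-clash : b x < b y → b y < e x → e x < e y → ¬ colour x xor colour y ≡ false
      near-clash p q r eq = true≢false (trans (colours (inj₁ (near p q r)))
          (meets-true {x} {y} q (<-trans (<-trans p q) r))) eq

      far-clash : b x < b y + m → b y + m < e x → e x < e y + m → ¬ colour x xor colour y ≡ true
      far-clash p q r eq = true≢false eq (trans (colours (inj₁ (far p q r)))
        (meets-false {x} {y} λ (_ , t) → <⇒≱ q (no-cover sy sx (x≢y ∘ sym) t)))

      far-clash′ : b y < b x + m → b x + m < e y → e y < e x + m → ¬ colour x xor colour y ≡ true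
      far-clash′ p q r eq = true≢false eq (trans (colours (inj₂ (far p q r)))
        (meets-false {x} {y} λ (t , _) → <⇒≱ q (no-cover sx sy x≢y t)))

      -- With equal colours the arcs would be staggered unshifted, with different colours one lap
      -- apart; each is an overlap whose equation demands the other choice of colours.
      staggered : open-at x < open-at y → open-at y < close-at x → ¬ close-at x < close-at y
      staggered p q r with colour x | colour y | near-clash | far-clash
      ... | false | false | nc | _ = nc (+-cancelʳ-< 0 _ _ p) (+-cancelʳ-< 0 _ _ q) (+-cancelʳ-< 0 _ _ r) refl
      ... | true | true | nc | _ = nc (+-cancelʳ-< m _ _ p) (+-cancelʳ-< m _ _ q) (+-cancelʳ-< m _ _ r) refl
      ... | false | true | _ | fc = fc (subst (_< b y + m) (+-identityʳ _) p) (subst (b y + m <_) (+-identityʳ _) q)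
          (subst (_< e y + m) (+-identityʳ _) r) refl
      ... | true | false | _ | _ = lia 3 (λ bx by m → bx :+ m :< by :+ con 0 ∷ by :< m ∷ [] ⊢ :⊥) (b x) (b y) m p
          (b< py)

      -- The crossing of y with the next copy of x, a full turn later. It can only occur with x
      -- unshifted and y shifted, and then y overlaps x one lap later and needs the same colour.
      staggered′ : open-at x + (m + m) < close-at y → ¬ close-at y < close-at x + (m + m)
      staggered′ p q with colour x | colour y | far-clash′
      ... | _ | false | _ = lia 5 (λ bx by ey m s → bx :+ s :+ (m :+ m) :< ey :+ con 0 ∷ ey :≤ by :+ m ∷ by :< m ∷ []
          ⊢ :⊥)
          (b x) (b y) (e y) m _ p (e≤ y) (b< py)
      ... | true | true | _ = lia 4 (λ bx by ey m → bx :+ m :+ (m :+ m) :< ey :+ m ∷ ey :≤ by :+ m ∷ by :< m ∷ [] ⊢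
          :⊥)
          (b x) (b y) (e y) m p (e≤ y) (b< py)
      ... | false | true | fc = fc
          (m≤n⇒m≤o+n (b x) (b< py))
          (lia 3 (λ b e m → b :+ con 0 :+ (m :+ m) :< e :+ m ∷ [] ⊢ b :+ m :< e) (b x) (e y) m p)
          (lia 3 (λ b e m → e :+ m :< b :+ con 0 :+ (m :+ m) ∷ [] ⊢ e :< b :+ m) (e x) (e y) m q) refl

      len : ∀ v → b v < e v → close-at v ≡ open-at v + (e v ∸ b v)
      len v p = lia 4 (λ b e s k → k :+ b :≡ e ∷ [] ⊢ e :+ s :≡ b :+ s :+ k) (b v) (e v) (shift (colour v))
          (e v ∸ b v)
        (m∸n+n≡m (<⇒≤ p))

      Earlier : Set
      Earlier = open-at x < open-at y ⊎ (open-at x ≡ open-at y × δ y < δ x)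

      earlier-O : Earlier → O x < O y
      earlier-O (inj₁ p) = κ-< p (<⇒≤ (late<2H x))
      earlier-O (inj₂ (p , q)) = κ-≤ (≤-reflexive p) (late-anti q)

      shorter : Earlier → close-at y ≤ close-at x → δ y < δ x
      shorter (inj₁ p) q = δ-mono
        (lia 6 (λ a a′ f f′ k k′ → a :< a′ ∷ f′ :≤ f ∷ f :≡ a :+ k ∷ f′ :≡ a′ :+ k′ ∷ [] ⊢ k′ :< k)
          (open-at x) (open-at y) (close-at x) (close-at y) (e x ∸ b x) (e y ∸ b y) p q (len x px) (len y py))
      shorter (inj₂ (_ , p)) _ = p

      no-longer : Earlier → close-at x < close-at y → open-at x < open-at y
      no-longer (inj₁ p) _ = p
      no-longer (inj₂ (p , r)) q = contradiction r (<⇒≯ (δ-mono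
        (lia 6 (λ a a′ f f′ k k′ → a :≡ a′ ∷ f :< f′ ∷ f :≡ a :+ k ∷ f′ :≡ a′ :+ k′ ∷ [] ⊢ k :< k′)
          (open-at x) (open-at y) (close-at x) (close-at y) (e x ∸ b x) (e y ∸ b y) p q (len x px) (len y py))))

      -- `staggered` excludes the first partial crossing. If y extends beyond the next opening of x,
      -- `staggered′` forces it beyond the closing too.
      apart : Earlier → Apart T′ (O x) (C x) (O y) (C y)
      apart E with open-at y ℕ.<? close-at x | close-at x ℕ.<? close-at y | open-at x + (m + m) ℕ.<? close-at y
      ... | yes p | yes q | _ = contradiction q (staggered (no-longer E q) p)
      ... | yes p | no q | _ = nested (κ-≤ (≮⇒≥ q) (shorter E (≮⇒≥ q)))
      ... | no p | _ | no q = disjoint (κ-≤ (≮⇒≥ p) (δ<late x y))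
          (subst (C y <_) (κ-lap _ _) (κ-≤ (≮⇒≥ q) (δ<late y x)))
      ... | no p | _ | yes q = around (κ-≤ (≮⇒≥ p) (δ<late x y))
          (subst (_< C y) (κ-lap _ _) (κ-≤ (≮⇒≥ (staggered′ q)) (δ-mono
          (lia 7 (λ a a′ f f′ k k′ m → a :+ (m :+ m) :< f′ ∷ f :+ (m :+ m) :≤ f′ ∷ a′ :< a :+ (m :+ m) ∷ f :≡ a :+ k
              ∷ f′ :≡ a′ :+ k′ ∷ [] ⊢ k :< k′)
            (open-at x) (open-at y) (close-at x) (close-at y) (e x ∸ b x) (e y ∸ b y) m q (≮⇒≥ (staggered′ q)) a′<
            (len x px) (len y py)))))
        where
        a′< : open-at y < open-at x + (m + m)
        a′< = <-≤-trans (+-mono-<-≤ (b< py) (shift≤ (colour y))) (m≤n+m (m + m) (open-at x))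

      good : ∀ {s t s′ t′} → Earlier → key x ≡ two s t → key y ≡ two s′ t′ →
        Ends (κ (m + m) 0) T′ (O x) (C x) s t → Ends (κ (m + m) 0) T′ (O y) (C y) s′ t′ → Good x y
      good E kx ky X Y = no-iff (indep x y sx sy) λ
        { (inj₁ p) → proj₁ ¬cross (interleave⇒crossing {x} {y} kx ky p)
        ; (inj₂ p) → proj₂ ¬cross (interleave⇒crossing {y} {x} ky kx p) }
        where
        O<L : O y < κ (m + m) 0
        O<L = κ-< (+-mono-<-≤ (b< py) (shift≤ (colour y))) (<⇒≤ (late<2H y))
        ¬cross = apart⇒¬crossing (O<C px) (C<O+T px) (earlier-O E) O<L (apart E) X Y

    earlier : ∀ {x y} → x ≢ y → (open-at x < open-at y ⊎ (open-at x ≡ open-at y × δ y < δ x))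
      ⊎ (open-at y < open-at x ⊎ (open-at y ≡ open-at x × δ x < δ y))
    earlier {x} {y} x≢y with <-cmp (open-at x) (open-at y) | <-cmp (δ x) (δ y)
    ... | tri< p _ _ | _ = inj₁ (inj₁ p)
    ... | tri> _ _ p | _ = inj₂ (inj₁ p)
    ... | tri≈ _ p _ | tri< q _ _ = inj₂ (inj₂ (sym p , q))
    ... | tri≈ _ p _ | tri> _ _ q = inj₁ (inj₂ (p , q))
    ... | tri≈ _ p _ | tri≈ _ q _ = contradiction (δ-inj q) x≢y

    clique-good : ∀ {c x f g} → c ≢ x → Kind c f → S c ≡ true → Kind x g → key c ≡ f → key x ≡ g → Good c x
    clique-good c≢x (em sc′ _) sc _ _ _ = contradiction sc′ (true≢false sc)
    clique-good c≢x (arc sc′ _ _) sc _ _ _ = contradiction sc′ (true≢false sc)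
    clique-good {c} {x} c≢x (cl sc) _ (cl sx) kc kx with <-cmp (pos c) (pos x)
    ... | tri< p _ _ = yes-iff (clique c x c≢x sc sx) (alt-from kc kx (clique-clique sc sx p))
    ... | tri≈ _ p _ = contradiction (pos-inj sc sx p) c≢x
    ... | tri> _ _ p = yes-iff (clique c x c≢x sc sx) (swap (alt-from kx kc (clique-clique sx sc p)))
    clique-good {c} {x} c≢x K@(cl sc) _ (em sx p) kc kx = good-sym {x} {c} (no-iff
      (¬true λ q → <⇒≱ (inside-nonempty (to (member sx sc) q)) p)
      (¬alt-first kx kc (em-before (c≢x ∘ sym) K (inj₂ (Z≤κ _ _)))))
    clique-good {c} {x} c≢x (cl sc) _ (arc sx p E) kc kx =
      good-sym {x} {c} (CliqueArc.arc-good sc sx p kc kx E (placed x))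

    em-good : ∀ {x y g} → x ≢ y → S x ≡ false → e x ≤ b x → S y ≡ false → Kind y g →
      key x ≡ (λ i → toℕ x * 2 + i) → key y ≡ g → Good x y
    em-good {x} {y} x≢y sx p sy K@(em _ q) kx ky = no-iff (indep x y sx sy)
      (case <-cmp (toℕ x) (toℕ y) of λ
        { (tri< r _ _) → ¬alt-first kx ky (em-before x≢y K (inj₁ r))
        ; (tri≈ _ r _) → contradiction (toℕ-injective r) x≢y
        ; (tri> _ _ r) → ¬alt-first ky kx (em-before (x≢y ∘ sym) (em sx p) (inj₁ r)) ∘ swap })
    em-good {x} {y} x≢y sx p sy (cl sy′) kx ky = contradiction sy (true≢false sy′)
    em-good {x} {y} x≢y sx p sy K@(arc _ _ E) kx ky =
      no-iff (indep x y sx sy) (¬alt-first kx ky (em-before x≢y K (inj₂ (Z≤end E))))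

    good : ∀ {x y f g} → x ≢ y → Kind x f → Kind y g → key x ≡ f → key y ≡ g → Good x y
    good x≢y K@(cl sx) L kx ky = clique-good x≢y K sx L kx ky
    good {x} {y} x≢y K L@(cl sy) kx ky = good-sym {y} {x} (clique-good (x≢y ∘ sym) L sy K ky kx)
    good x≢y (em sx p) L@(em sy _) kx ky = em-good x≢y sx p sy L kx ky
    good x≢y (em sx p) L@(arc sy _ _) kx ky = em-good x≢y sx p sy L kx ky
    good {x} {y} x≢y K@(arc sx _ _) (em sy q) kx ky = good-sym {y} {x} (em-good (x≢y ∘ sym) sy q sx K ky kx)
    good {x} {y} x≢y (arc sx p X) (arc sy q Y) kx ky with earlier x≢y
    ... | inj₁ E = ArcArc.good sx sy x≢y p q E kx ky X Y
    ... | inj₂ E = good-sym {y} {x} (ArcArc.good sy sx (x≢y ∘ sym) q p E ky kx Y X)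

  twoUniform : ∃ λ w → Uniform 2 w × Represents G w
  twoUniform = let w , uni , alternates = wordFromKeys 2 key incr in
    w , uni , λ x y x≢y → let g = good x≢y (proj₂ (kind x)) (proj₂ (kind y)) refl refl
                              a = alternates x y x≢y in mk⇔ (from a ∘ to g) (from g ∘ to a)

-- Signed graphs: a potential modulo 2, or an induced cycle of odd weight

xor-shift : ∀ a b c → (a xor b) xor (a xor c) ≡ b xor c
xor-shift true true c = refl
xor-shift true false true = refl
xor-shift true false false = refl
xor-shift false b c = refl

xor-split : ∀ a b c → a xor b ≡ true → a xor c ≡ true ⊎ b xor c ≡ true
xor-split true b false _ = inj₁ refl
xor-split true false true _ = inj₂ refl
xor-split false true false _ = inj₂ refl
xor-split false true true _ = inj₁ refl

parity : ℕ → Bool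
parity zero = false
parity (suc k) = not (parity k)

parity-true : ∀ k → parity k ≡ true → ∃ λ m → k ≡ suc (2 * m)
parity-false : ∀ k → parity k ≡ false → ∃ λ m → k ≡ 2 * m
parity-true (suc k) eq = map₂ (cong suc) (parity-false k (trans (sym (Bool.not-involutive _)) (cong not eq)))
parity-false zero eq = 0 , refl
parity-false (suc k) eq with parity-true k (trans (sym (Bool.not-involutive _)) (cong not eq))
... | m , refl = suc m , cong suc (sym (+-suc m (m + 0)))

parity-2* : ∀ m → parity (2 * m) ≡ false
parity-2* zero = refl
parity-2* (suc m) rewrite +-suc m (m + 0) | Bool.not-involutive (parity (2 * m)) = parity-2* m

σ : (ℕ → Bool) → ℕ → ℕ → Bool
σ f i zero = false
σ f i (suc d) = f i xor σ f (suc i) d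

σ-split : ∀ f i a c → σ f i (a + c) ≡ σ f i a xor σ f (i + a) c
σ-split f i zero c rewrite +-identityʳ i = refl
σ-split f i (suc a) c rewrite σ-split f (suc i) a c | +-suc i a = sym (Bool.xor-assoc (f i) (σ f (suc i) a) _)

σ-snoc : ∀ f i d → σ f i (suc d) ≡ σ f i d xor f (i + d)
σ-snoc f i d = trans (cong (σ f i) (+-comm 1 d))
  (trans (σ-split f i d 1) (cong (σ f i d xor_) (Bool.xor-identityʳ (f (i + d)))))

σ-cong : ∀ {f g} i d → (∀ t → t < d → f (i + t) ≡ g (i + t)) → σ f i d ≡ σ g i d
σ-cong i zero eq = refl
σ-cong {f} {g} i (suc d) eq = cong₂ _xor_
  (subst (λ j → f j ≡ g j) (+-identityʳ i) (eq 0 (s≤s z≤n)))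
  (σ-cong (suc i) d λ t t<d → subst (λ j → f j ≡ g j) (+-suc i t) (eq (suc t) (s≤s t<d)))

σ-rotate : ∀ f k → (∀ i → f (i + k) ≡ f i) → ∀ i → σ f i k ≡ σ f 0 k
σ-rotate f k per zero = refl
σ-rotate f k per (suc i) = trans (cancel (f i) _ _ (trans (σ-snoc f i k)
    (trans (cong (σ f i k xor_) (per i)) (Bool.xor-comm (σ f i k) (f i))))) (σ-rotate f k per i)
  where
  cancel : ∀ a b c → a xor b ≡ a xor c → b ≡ c
  cancel false b c eq = eq
  cancel true b c eq = Bool.not-injective eq

σ-true : ∀ f i d → (∀ t → t < d → f (i + t) ≡ true) → σ f i d ≡ parity d
σ-true f i zero eq = refl
σ-true f i (suc d) eq rewrite subst (λ j → f j ≡ true) (+-identityʳ i) (eq 0 (s≤s z≤n)) =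
  cong not (σ-true f (suc i) d λ t t<d → subst (λ j → f j ≡ true) (+-suc i t) (eq (suc t) (s≤s t<d)))

σ-reverse : ∀ f g i d → (∀ t → t < d → g (i + t) ≡ f (d ∸ suc t)) → σ g i d ≡ σ f 0 d
σ-reverse f g i zero eq = refl
σ-reverse f g i (suc d) eq = trans
  (cong₂ _xor_ (trans (cong g (sym (+-identityʳ i))) (eq 0 (s≤s z≤n)))
    (σ-reverse f g (suc i) d λ t t<d → trans (cong g (sym (+-suc i t))) (eq (suc t) (s≤s t<d))))
  (trans (Bool.xor-comm (f d) _) (sym (σ-snoc f 0 d)))

suc-% : ∀ i k → let r = i % suc k in (suc r < suc k × suc i % suc k ≡ suc r) ⊎ (suc r ≡ suc k × suc i % suc k ≡ 0)
suc-% i k with m≤n⇒m<n∨m≡n (m%n<n i (suc k))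
... | inj₁ p = inj₁ (p , trans reduce (m<n⇒m%n≡m p))
  where
  reduce : suc i % suc k ≡ suc (i % suc k) % suc k
  reduce = trans (cong (λ j → suc j % suc k) (m≡m%n+[m/n]*n i (suc k))) ([m+kn]%n≡m%n (suc (i % suc k)) (i / suc k)
      (suc k))
... | inj₂ p = inj₂ (p , trans reduce (trans (cong (_% suc k) p) (n%n≡0 (suc k))))
  where
  reduce : suc i % suc k ≡ suc (i % suc k) % suc k
  reduce = trans (cong (λ j → suc j % suc k) (m≡m%n+[m/n]*n i (suc k))) ([m+kn]%n≡m%n (suc (i % suc k)) (i / suc k)
      (suc k))

module Signed {N : ℕ} (E : Fin N → Fin N → Set) (E? : ∀ x y → Dec (E x y))
  (E-sym : ∀ {x y} → E x y → E y x) (E-irrefl : ∀ {x y} → E x y → x ≢ y)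
  (w : Fin N → Fin N → Bool) (w-sym : ∀ x y → w x y ≡ w y x) where

  private V = Fin N

  data Walk : V → V → ℕ → Bool → Set where
    nil  : ∀ {x} → Walk x x 0 false
    step : ∀ {x y z k c} → E x z → Walk z y k c → Walk x y (suc k) (w x z xor c)

  infixr 5 _++ʷ_

  _++ʷ_ : ∀ {x y z k l c d} → Walk x y k c → Walk y z l d → Walk x z (k + l) (c xor d)
  nil ++ʷ W = W
  step {x} {z = z} {c = c} e W ++ʷ W′ = subst (Walk _ _ _) (sym (Bool.xor-assoc (w x z) c _)) (step e (W ++ʷ W′))

  reverse : ∀ {x y k c} → Walk x y k c → Walk y x k c
  reverse nil = nil
  reverse (step {x} {z = z} {k} {c} e W) = subst₂ (Walk _ _) (+-comm k 1)
    (trans (cong (c xor_) (trans (Bool.xor-identityʳ _) (w-sym z x))) (Bool.xor-comm c (w x z)))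
    (reverse W ++ʷ step (E-sym e) nil)

  -- A potential on the components formed by the edges in `es`: `root` names the component, and
  -- `path` shows that each label is the weight of an actual walk, from which odd closed walks are
  -- later assembled.
  record Labelling (es : List (V × V)) : Set where
    field
      root  : V → V
      label : V → Bool
      path  : ∀ v → ∃ λ k → Walk (root v) v k (label v)
      fits  : ∀ {x y} → (x , y) ∈ es → E x y → root x ≡ root y × label x xor label y ≡ w x y

  OddWalk : Set
  OddWalk = ∃₂ λ x k → Walk x x k true

  -- An edge inside a component either agrees with the potential or closes a walk of odd weight
  -- through the root. An edge between two components merges them.
  extend : ∀ {x y es} → Labelling es → Labelling ((x , y) ∷ es) ⊎ OddWalk
  extend {x} {y} {es} L with E? x y
  ... | no ¬e = inj₁ record { root = root ; label = label ; path = path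
      ; fits = λ { (here refl) e → contradiction e ¬e ; (there p) e → fits p e } }
    where open Labelling L
  ... | yes e with Labelling.root L x ≟ Labelling.root L y
  ...   | yes same with (Labelling.label L x xor Labelling.label L y) Bool.≟ w x y
  ...     | yes ok = inj₁ record { root = root ; label = label ; path = path
      ; fits = λ { (here refl) _ → same , ok ; (there p) e → fits p e } }
    where open Labelling L
  ...     | no odd = inj₂ (root x , -, subst₂ (λ v c → Walk (root x) v _ c) (sym same)
      (bit (label x) (label y) (w x y) odd)
      (proj₂ (path x) ++ʷ step e nil ++ʷ reverse (proj₂ (path y))))
    where
    open Labelling L
    bit : ∀ a c d → ¬ a xor c ≡ d → a xor (d xor false) xor c ≡ true
    bit true true true p = refl
    bit true true false p = contradiction refl p
    bit true false true p = contradiction refl p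
    bit true false false p = refl
    bit false true true p = contradiction refl p
    bit false true false p = refl
    bit false false true p = refl
    bit false false false p = contradiction refl p
  extend {x} {y} {es} L | yes e | no differ = inj₁ record
    { root = root′ ; label = label′ ; path = path′
    ; fits = λ { (here refl) _ → new ; (there p) e → old (fits p e) } }
    where
    open Labelling L
    -- The weight of the walk from the root of x to the root of y through the new edge. Added to a
    -- whole component, it preserves all differences inside.
    flip : Bool
    flip = label x xor (w x y xor false) xor label y
    root′ : V → V
    root′ v = if does (root v ≟ root y) then root x else root v
    label′ : V → Bool
    label′ v = if does (root v ≟ root y) then flip xor label v else label v
    path′ : ∀ v → ∃ λ k → Walk (root′ v) v k (label′ v)
    path′ v with root v ≟ root y
    ... | no _ = path v
    ... | yes eq = -, (proj₂ (path x) ++ʷ step e nil ++ʷ reverse (proj₂ (path y)))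
        ++ʷ subst (λ r → Walk r v _ _) eq (proj₂ (path v))
    old : ∀ {u v} → root u ≡ root v × label u xor label v ≡ w u v →
      root′ u ≡ root′ v × label′ u xor label′ v ≡ w u v
    old {u} {v} (eq , eq′) rewrite eq with root v ≟ root y
    ... | no _ = refl , eq′
    ... | yes _ = refl , trans (xor-shift flip (label u) (label v)) eq′
    new : root′ x ≡ root′ y × label′ x xor label′ y ≡ w x y
    new with root x ≟ root y | root y ≟ root y
    ... | yes p | _ = contradiction p differ
    ... | no _ | no p = contradiction refl p
    ... | no _ | yes _ = refl , bit (label x) (w x y) (label y)
      where
      bit : ∀ a c d → a xor ((a xor (c xor false) xor d) xor d) ≡ c
      bit true true true = refl
      bit true true false = refl
      bit true false true = refl
      bit true false false = refl
      bit false true true = refl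
      bit false true false = refl
      bit false false true = refl
      bit false false false = refl

  labellings : ∀ es → Labelling es ⊎ OddWalk
  labellings [] = inj₁ record { root = id ; label = λ _ → false ; path = λ _ → -, nil ; fits = λ () }
  labellings (_ ∷ es) with labellings es
  ... | inj₁ L = extend L
  ... | inj₂ O = inj₂ O

  Labelled : Set
  Labelled = ∃ λ (label : V → Bool) → ∀ {x y} → E x y → label x xor label y ≡ w x y

  labelled-or-odd : Labelled ⊎ OddWalk
  labelled-or-odd with labellings (List.cartesianProduct (List.allFin N) (List.allFin N))
  ... | inj₁ L = inj₁ (label , λ {x} {y} e → proj₂ (fits (∈-cartesianProduct⁺ (∈-allFin x) (∈-allFin y)) e))
    where open Labelling L
  ... | inj₂ O = inj₂ O

  vertex : ∀ {x y k c} → Walk x y k c → ℕ → V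
  vertex {x} nil _ = x
  vertex {x} (step e W) zero = x
  vertex (step e W) (suc i) = vertex W i

  vertex-first : ∀ {x y k c} (W : Walk x y k c) → vertex W 0 ≡ x
  vertex-first nil = refl
  vertex-first (step e W) = refl

  vertex-last : ∀ {x y k c} (W : Walk x y k c) → vertex W k ≡ y
  vertex-last nil = refl
  vertex-last (step e W) = vertex-last W

  vertex-edge : ∀ {x y k c} (W : Walk x y k c) i → i < k → E (vertex W i) (vertex W (suc i))
  vertex-edge (step e W) zero _ = subst (E _) (sym (vertex-first W)) e
  vertex-edge (step e W) (suc i) (s≤s p) = vertex-edge W i p

  vertex-label : ∀ {x y k c} (W : Walk x y k c) → σ (λ i → w (vertex W i) (vertex W (suc i))) 0 k ≡ c
  vertex-label nil = refl
  vertex-label {x} (step {z = z} {k} e W) = cong₂ _xor_ (cong (w x) (vertex-first W))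
    (trans (shift _ 0 k) (vertex-label W))
    where
    shift : ∀ f i d → σ f (suc i) d ≡ σ (f ∘ suc) i d
    shift f i zero = refl
    shift f i (suc d) = cong (f (suc i) xor_) (shift f (suc i) d)

  -- A periodic sequence instead of a cyclic list: rotations are additions on the index, and
  -- segments may run past the period.
  record OddCycle : Set where
    field
      k      : ℕ
      x      : ℕ → V
      period : ∀ i → x (i + k) ≡ x i
      edge   : ∀ i → E (x i) (x (suc i))
      odd    : σ (λ i → w (x i) (x (suc i))) 0 k ≡ true

    label : ℕ → Bool
    label i = w (x i) (x (suc i))

    label-period : ∀ i → label (i + k) ≡ label i
    label-period i = cong₂ w (period i) (period (suc i))

    odd-at : ∀ i → σ label i k ≡ true
    odd-at i = trans (σ-rotate label k label-period i) odd

    periods : ∀ q i → x (i + q * k) ≡ x i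
    periods zero i = cong x (+-identityʳ i)
    periods (suc q) i = trans (cong x (trans (cong (i +_) (+-comm k (q * k))) (sym (+-assoc i (q * k) k))))
      (trans (period (i + q * k)) (periods q i))

    residue : ∀ i → 0 < k → ∃ λ r → r < k × (∀ d → x (i + d) ≡ x (r + d))
    residue i 0<k = go k 0<k periods
      where
      go : ∀ k → 0 < k → (∀ q i → x (i + q * k) ≡ x i) → ∃ λ r → r < k × (∀ d → x (i + d) ≡ x (r + d))
      go (suc l) _ ps = i % suc l , m%n<n i (suc l) , λ d →
        trans (cong x (trans (cong (_+ d) (m≡m%n+[m/n]*n i (suc l)))
          (lia 3 (λ a q d → [] ⊢ a :+ q :+ d :≡ a :+ d :+ q) (i % suc l) (i / suc l * suc l) d)))
        (ps (i / suc l) (i % suc l + d))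

    segment : ∀ d i j → i + d ≡ j → Walk (x i) (x j) d (σ label i d)
    segment zero i j eq = subst (λ l → Walk (x i) (x l) 0 false) (trans (sym (+-identityʳ i)) eq) nil
    segment (suc d) i j eq = step (edge i) (segment d (suc i) j (trans (sym (+-suc i d)) eq))

    segments : ∀ i d → d ≤ k →
      Walk (x i) (x (i + d)) d (σ label i d) × Walk (x (i + d)) (x i) (k ∸ d) (σ label (i + d) (k ∸ d))
    segments i d d≤k = segment d i (i + d) refl
      , subst (λ v → Walk (x (i + d)) v (k ∸ d) (σ label (i + d) (k ∸ d))) (period i)
          (segment (k ∸ d) (i + d) (i + k) (trans (+-assoc i d (k ∸ d)) (cong (i +_) (m+[n∸m]≡n d≤k))))

    segments-odd : ∀ i d → d ≤ k → σ label i d xor σ label (i + d) (k ∸ d) ≡ true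
    segments-odd i d d≤k = trans (sym (σ-split label i d (k ∸ d))) (trans (cong (σ label i) (m+[n∸m]≡n d≤k))
        (odd-at i))

  closed : ∀ {x k} → Walk x x (suc k) true → OddCycle
  closed {x} {k} W = record
    { k = K ; x = at
    ; period = λ i → cong (vertex W) ([m+n]%n≡m%n i K)
    ; edge = λ i → subst (E (at i)) (sym (next i)) (vertex-edge W (i % K) (m%n<n i K))
    ; odd = trans (σ-cong 0 K λ t t<K → trans (cong (w (at t)) (next t))
        (cong (λ j → w (vertex W j) (vertex W (suc j))) (m<n⇒m%n≡m t<K))) (vertex-label W) }
    where
    K = suc k
    at : ℕ → V
    at i = vertex W (i % K)
    next : ∀ i → at (suc i) ≡ vertex W (suc (i % K))
    next i with suc-% i k
    ... | inj₁ (_ , eq) = cong (vertex W) eq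
    ... | inj₂ (eq , eq′) = trans (cong (vertex W) eq′)
        (trans (vertex-first W) (sym (trans (cong (vertex W) eq) (vertex-last W))))

  record InducedOddCycle : Set where
    field
      cycle     : OddCycle
    open OddCycle cycle public
    field
      3≤k       : 3 ≤ k
      distinct  : ∀ i d → 1 ≤ d → d < k → x i ≢ x (i + d)
      chordless : ∀ i d → 2 ≤ d → d + 2 ≤ k → ¬ E (x i) (x (i + d))

  -- A repeated vertex or a chord splits an odd closed walk into two shorter ones, one of which is odd.
  shorten : (c : OddCycle) → let open OddCycle c in
    (∃₂ λ y l → l < k × Walk y y l true) ⊎
    ((∀ i d → 1 ≤ d → d < k → x i ≢ x (i + d)) × (∀ i d → 2 ≤ d → d + 2 ≤ k → ¬ E (x i) (x (i + d))))
  shorten c with ℕ.anyUpTo? (λ i → ℕ.anyUpTo? (λ d → (1 ℕ.≤? d) ×-dec (x i ≟ x (i + d))) k) k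
                | ℕ.anyUpTo? (λ i → ℕ.anyUpTo? (λ d → (2 ℕ.≤? d) ×-dec (d + 2 ℕ.≤? k) ×-dec E? (x i) (x (i + d))) k) k
    where open OddCycle c
  ... | yes (i , _ , d , d<k , 1≤d , eq) | _ = inj₁ (case xor-split (σ label i d) (σ label (i + d) (k ∸ d)) false
      (segments-odd i d (<⇒≤ d<k)) of λ
      { (inj₁ o) → x i , d , d<k , subst₂ (λ v → Walk (x i) v d) (sym eq) (trans (sym (Bool.xor-identityʳ _)) o)
          (proj₁ S)
      ; (inj₂ o) → x i , k ∸ d , ∸-monoʳ-< {o = 0} 1≤d (<⇒≤ d<k)
          , subst₂ (λ v → Walk v (x i) (k ∸ d)) (sym eq) (trans (sym (Bool.xor-identityʳ _)) o) (proj₂ S) })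
    where
    open OddCycle c
    S = segments i d (<⇒≤ d<k)
  ... | no _ | yes (i , _ , d , d<k , 2≤d , d+2≤k , e) = inj₁ (case xor-split (σ label i d) (σ label (i + d) (k ∸ d))
      (w (x i) (x (i + d))) (segments-odd i d (<⇒≤ d<k)) of λ
      { (inj₁ o) → x (i + d) , suc d , subst (_≤ k) (+-comm d 2) d+2≤k
          , subst (Walk _ _ _) (trans (cong (_xor σ label i d) (w-sym (x (i + d)) (x i)))
              (trans (Bool.xor-comm (w (x i) (x (i + d))) (σ label i d)) o))
              (step (E-sym e) (proj₁ S))
      ; (inj₂ o) → x i , suc (k ∸ d) , lia 3 (λ d k l → l :+ d :≡ k ∷ con 2 :≤ d ∷ [] ⊢ con 1 :+ l :< k) d k (k ∸ d)
          (m∸n+n≡m (<⇒≤ d<k)) 2≤d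
          , subst (Walk _ _ _) (trans (Bool.xor-comm (w (x i) (x (i + d))) (σ label (i + d) (k ∸ d))) o)
              (step e (proj₂ S)) })
    where
    open OddCycle c
    S = segments i d (<⇒≤ d<k)
  ... | no ¬p | no ¬q = inj₂
    ( (λ i d 1≤d d<k eq → let r , r<k , same = residue i (≤-<-trans z≤n d<k) in
        ¬p (r , r<k , d , d<k , 1≤d , trans (sym (start i r same)) (trans eq (same d))))
    , (λ i d 2≤d d+2≤k e → let d<k = <-≤-trans (m<m+n d (s≤s z≤n)) d+2≤k
                               r , r<k , same = residue i (≤-<-trans z≤n d<k) in
        ¬q (r , r<k , d , d<k , 2≤d , d+2≤k , subst₂ E (start i r same) (same d) e)))
    where
    open OddCycle c
    start : ∀ i r → (∀ d → x (i + d) ≡ x (r + d)) → x i ≡ x r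
    start i r same = trans (cong x (sym (+-identityʳ i))) (trans (same 0) (cong x (+-identityʳ r)))

  -- Length 1 is a loop, and a closed walk of length 2 uses one edge twice, so its weight is even.
  long : (c : OddCycle) → (∀ i d → 1 ≤ d → d < OddCycle.k c → OddCycle.x c i ≢ OddCycle.x c (i + d)) → 3 ≤ OddCycle.k
      c
  long c dist = go k odd period
    where
    open OddCycle c
    go : ∀ k → σ label 0 k ≡ true → (∀ i → x (i + k) ≡ x i) → 3 ≤ k
    go zero () _
    go 1 _ per = contradiction (sym (per 0)) (E-irrefl (edge 0))
    go 2 o per = contradiction
      (trans (sym o) (trans (cong (λ v → w (x 0) (x 1) xor (w (x 1) v xor false)) (per 0))
        (trans (cong (λ c → w (x 0) (x 1) xor c) (trans (Bool.xor-identityʳ _) (w-sym (x 1) (x 0))))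
            (Bool.xor-same (w (x 0) (x 1))))))
      λ ()
    go (suc (suc (suc k))) _ _ = s≤s (s≤s (s≤s z≤n))

  inducedOddCycle : OddWalk → InducedOddCycle
  inducedOddCycle (x , k , W) = <-rec (λ k → ∀ x → Walk x x k true → InducedOddCycle) go k x W
    where
    go : ∀ k → (∀ {l} → l < k → ∀ x → Walk x x l true → InducedOddCycle) → ∀ x → Walk x x k true → InducedOddCycle
    go (suc k) rec x W with shorten (closed W)
    ... | inj₁ (y , l , l<k , W′) = rec l<k y W′
    ... | inj₂ (dist , chordless) = record
      { cycle = closed W ; 3≤k = long (closed W) dist ; distinct = dist ; chordless = chordless }

  labelled-or-cycle : Labelled ⊎ InducedOddCycle
  labelled-or-cycle = Sum.map₂ inducedOddCycle labelled-or-odd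

  shiftCycle : ℕ → InducedOddCycle → InducedOddCycle
  shiftCycle s c = record
    { cycle = record
      { k = k ; x = λ i → x (s + i)
      ; period = λ i → trans (cong x (sym (+-assoc s i k))) (period (s + i))
      ; edge = λ i → subst (λ j → E (x (s + i)) (x j)) (sym (+-suc s i)) (edge (s + i))
      ; odd = trans (trans (σ-cong 0 k λ t _ → cong (w (x (s + t))) (cong x (+-suc s t)))
          (shift 0 k)) (trans (cong (λ i → σ label i k) (+-identityʳ s)) (odd-at s)) }
    ; 3≤k = 3≤k
    ; distinct = λ i d p q → subst (λ j → x (s + i) ≢ x j) (+-assoc s i d) (distinct (s + i) d p q)
    ; chordless = λ i d p q → subst (λ j → ¬ E (x (s + i)) (x j)) (+-assoc s i d) (chordless (s + i) d p q) }
    where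
    open InducedOddCycle c
    shift : ∀ i d → σ (λ t → label (s + t)) i d ≡ σ label (s + i) d
    shift i zero = refl
    shift i (suc d) = cong (label (s + i) xor_) (trans (shift (suc i) d) (cong (λ j → σ label j d) (+-suc s i)))

  -- Multiplication by k − 1 is negation modulo k.
  module Reverse (c : InducedOddCycle) where

    open InducedOddCycle c

    y : ℕ → V
    y i = x (i * (k ∸ 1))
    1≤k : 1 ≤ k
    1≤k = ≤-trans (s≤s z≤n) 3≤k
    suc-pred-k : suc (k ∸ 1) ≡ k
    suc-pred-k = m+[n∸m]≡n 1≤k
    suc-∸ : ∀ {t} → t < k → k ∸ t ≡ suc (k ∸ suc t)
    suc-∸ {t} p = +-∸-assoc 1 p
    back : ∀ i → x (suc (suc i * (k ∸ 1))) ≡ y i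
    back i = trans (cong x (trans (cong (_+ i * (k ∸ 1)) suc-pred-k) (+-comm k _))) (period (i * (k ∸ 1)))
    step-back : ∀ i d → 1 ≤ d → d ≤ k → y (i + d) ≡ x (i * (k ∸ 1) + (k ∸ d))
    step-back i (suc d) p q = trans (cong x arith) (periods d _)
      where
      open ≡-Reasoning
      arith : (i + suc d) * (k ∸ 1) ≡ i * (k ∸ 1) + (k ∸ suc d) + d * k
      arith = begin
        (i + suc d) * (k ∸ 1) ≡⟨ *-distribʳ-+ (k ∸ 1) i (suc d) ⟩
        i * (k ∸ 1) + (k ∸ 1 + d * (k ∸ 1)) ≡⟨ cong (i * (k ∸ 1) +_)
            (lia 5 (λ p dp d l k → l :+ (con 1 :+ d) :≡ k ∷ con 1 :+ p :≡ k ∷ [] ⊢ p :+ dp :≡ l :+ (d :+ dp))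
              (k ∸ 1) (d * (k ∸ 1)) d (k ∸ suc d) k (m∸n+n≡m q) suc-pred-k) ⟩
        i * (k ∸ 1) + (k ∸ suc d + (d + d * (k ∸ 1))) ≡⟨ cong (λ z → i * (k ∸ 1) + (k ∸ suc d + z))
            (trans (sym (*-suc d (k ∸ 1))) (cong (d *_) suc-pred-k)) ⟩
        i * (k ∸ 1) + (k ∸ suc d + d * k) ≡⟨ sym (+-assoc (i * (k ∸ 1)) (k ∸ suc d) (d * k)) ⟩
        i * (k ∸ 1) + (k ∸ suc d) + d * k ∎
    reverse-at : ∀ t → t ≤ k → y t ≡ x (k ∸ t)
    reverse-at zero p = sym (period 0)
    reverse-at (suc t) p = step-back 0 (suc t) (s≤s z≤n) p
    neg : ∀ t → t < k → y (suc t) ≡ x (k ∸ suc t)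
    neg t p = reverse-at (suc t) p

    reverseCycle : InducedOddCycle
    reverseCycle = record
     { cycle = record
       { k = k ; x = y
       ; period = λ i → trans (cong x (trans (*-distribʳ-+ (k ∸ 1) i k) (cong (i * (k ∸ 1) +_) (*-comm k (k ∸ 1)))))
           (periods (k ∸ 1) (i * (k ∸ 1)))
       ; edge = λ i → E-sym (subst (E (y (suc i))) (back i) (edge (suc i * (k ∸ 1))))
       ; odd = trans (σ-reverse label _ 0 k λ t t<k → trans (w-sym (y t) (y (suc t)))
           (trans (cong (w (y (suc t))) (sym (back t))) (cong₂ w (neg t t<k)
              (trans (back t) (trans (reverse-at t (<⇒≤ t<k)) (cong x (suc-∸ t<k))))))) odd }
     ; 3≤k = 3≤k
     ; distinct = λ i d p q eq → distinct (i * (k ∸ 1)) (k ∸ d) (m<n⇒0<n∸m q) (∸-monoʳ-< {o = 0} p (<⇒≤ q))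
         (trans eq (step-back i d p (<⇒≤ q)))
     ; chordless = λ i d p q e → chordless (i * (k ∸ 1)) (k ∸ d)
         (m+n≤o⇒m≤o∸n 2 (subst (_≤ k) (+-comm d 2) q))
         (lia 3 (λ d l k → l :+ d :≡ k ∷ con 2 :≤ d ∷ [] ⊢ l :+ con 2 :≤ k) d (k ∸ d) k
             (m∸n+n≡m (≤-trans (m≤m+n d 2) q)) p)
         (subst (E (y i)) (step-back i d (≤-trans (s≤s z≤n) p) (≤-trans (m≤m+n d 2) q)) e) }

-- From an induced odd cycle of arcs to a forbidden induced subgraph

module Embedding (G : Graph) (S : Fin (n G) → Bool)
  (clique : ∀ x y → x ≢ y → S x ≡ true → S y ≡ true → adj G x y ≡ true)
  (indep : ∀ x y → S x ≡ false → S y ≡ false → adj G x y ≡ false) where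

  private
    V = Fin (n G)

  splitAt-injective : ∀ p {q} {x y : Fin (p + q)} → splitAt p x ≡ splitAt p y → x ≡ y
  splitAt-injective p {q} {x} {y} eq = trans (sym (join-splitAt p q x))
      (trans (cong (join p q) eq) (join-splitAt p q y))

  -- Injectivity on the clique comes from the columns of M: equal images would have equal
  -- adjacencies to all `a j`.
  embed : ∀ p q (M : Fin q → Fin p → Bool) (c : Fin p → V) (a : Fin q → V) →
    (∀ i → S (c i) ≡ true) → (∀ j → S (a j) ≡ false) → (∀ j i → adj G (a j) (c i) ≡ M j i) →
    (∀ i i′ → (∀ j → M j i ≡ M j i′) → i ≡ i′) → (∀ {j j′} → a j ≡ a j′ → j ≡ j′) →
    InducedSub (splitGraph p q M) G
  embed p q M c a sc sa eq columns a-inj = f , f-inj , f-adj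
    where
    f : Fin (p + q) → V
    f v = [ c , a ]′ (splitAt p v)
    c-inj : ∀ {i i′} → c i ≡ c i′ → i ≡ i′
    c-inj {i} {i′} p = columns i i′ λ j → trans (sym (eq j i)) (trans (cong (adj G (a j)) p) (eq j i′))
    c≢a : ∀ {i j} → c i ≢ a j
    c≢a {i} {j} p = true≢false (sc i) (trans (cong S p) (sa j))
    f-inj : ∀ u v → f u ≡ f v → u ≡ v
    f-inj u v r with splitAt p u in eu | splitAt p v in ev
    ... | inj₁ i | inj₁ i′ = splitAt-injective _ (trans eu (trans (cong inj₁ (c-inj r)) (sym ev)))
    ... | inj₁ i | inj₂ j = contradiction r c≢a
    ... | inj₂ j | inj₁ i = contradiction (sym r) c≢a
    ... | inj₂ j | inj₂ j′ = splitAt-injective _ (trans eu (trans (cong inj₂ (a-inj r)) (sym ev)))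
    f-adj : ∀ u v → adj G (f u) (f v) ≡ splitAdj p q M u v
    f-adj u v with splitAt p u | splitAt p v
    ... | inj₁ i | inj₂ j = trans (Graph.sym G _ _) (eq j i)
    ... | inj₂ j | inj₁ i = eq j i
    ... | inj₂ j | inj₂ j′ = indep _ _ (sa j) (sa j′)
    ... | inj₁ i | inj₁ i′ with i ≟ i′
    ...   | yes refl = irrefl G (c i)
    ...   | no i≢i′ = clique _ _ (i≢i′ ∘ c-inj) (sc i) (sc i′)

  embedSequence : ∀ p q (M : Fin q → Fin p → Bool) (M′ : ℕ → ℕ → Bool) → (∀ j i → M j i ≡ M′ (toℕ j) (toℕ i)) →
    (x : ℕ → V) → (∀ i → S (x i) ≡ false) → (∀ i j → i < j → j < q → x i ≢ x j) →
    (∀ s t → s < t → t < p → ¬ (∀ j → j < q → M′ j s ≡ M′ j t)) →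
    (∀ t → t < p → ∃ λ c → S c ≡ true × (∀ j → j < q → adj G (x j) c ≡ M′ j t)) →
    InducedSub (splitGraph p q M) G
  embedSequence p q M M′ M≡ x sx dist columns point = embed p q M
    (λ i → proj₁ (point (toℕ i) (toℕ<n i))) (x ∘ toℕ) (λ i → proj₁ (proj₂ (point (toℕ i) (toℕ<n i)))) (sx ∘ toℕ)
    (λ j i → trans (proj₂ (proj₂ (point (toℕ i) (toℕ<n i))) (toℕ j) (toℕ<n j)) (sym (M≡ j i)))
    columns′ x-inj
    where
    columns′ : ∀ i i′ → (∀ j → M j i ≡ M j i′) → i ≡ i′
    columns′ i i′ eq with <-cmp (toℕ i) (toℕ i′)
    ... | tri≈ _ p _ = toℕ-injective p
    ... | tri< p _ _ = ⊥-elim (columns _ _ p (toℕ<n i′) λ j j<q →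
        subst (λ l → M′ l (toℕ i) ≡ M′ l (toℕ i′)) (toℕ-fromℕ< j<q)
          (trans (sym (M≡ (fromℕ< j<q) i)) (trans (eq (fromℕ< j<q)) (M≡ (fromℕ< j<q) i′))))
    ... | tri> _ _ p = ⊥-elim (columns _ _ p (toℕ<n i) λ j j<q →
        subst (λ l → M′ l (toℕ i′) ≡ M′ l (toℕ i)) (toℕ-fromℕ< j<q)
          (trans (sym (M≡ (fromℕ< j<q) i′)) (trans (sym (eq (fromℕ< j<q))) (M≡ (fromℕ< j<q) i))))
    x-inj : ∀ {j j′} → x (toℕ j) ≡ x (toℕ j′) → j ≡ j′
    x-inj {j} {j′} eq with <-cmp (toℕ j) (toℕ j′)
    ... | tri≈ _ p _ = toℕ-injective p
    ... | tri< p _ _ = contradiction eq (dist _ _ p (toℕ<n j′))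
    ... | tri> _ _ p = contradiction (sym eq) (dist _ _ p (toℕ<n j))

row : ℕ → ℕ → Bool
row j t = (t ≡ᵇ j) ∨ (t ≡ᵇ suc j)

≡ᵇ-true : ∀ {s t} → s ≡ t → (s ≡ᵇ t) ≡ true
≡ᵇ-true {s} refl = to Bool.T-≡ (≡⇒≡ᵇ s s refl)

≡ᵇ-false : ∀ {s t} → s ≢ t → (s ≡ᵇ t) ≡ false
≡ᵇ-false {s} {t} p = ¬true λ eq → p (≡ᵇ⇒≡ s t (from Bool.T-≡ eq))

<ᵇ-true : ∀ {s t} → s < t → (s <ᵇ t) ≡ true
<ᵇ-true p = to Bool.T-≡ (<⇒<ᵇ p)

<ᵇ-false : ∀ {s t} → t ≤ s → (s <ᵇ t) ≡ false
<ᵇ-false {s} {t} p = ¬true λ eq → <⇒≱ (<ᵇ⇒< s t (from Bool.T-≡ eq)) p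

row-self : ∀ j → row j j ≡ true
row-self j rewrite ≡ᵇ-true {j} refl = refl

row-suc : ∀ j → row j (suc j) ≡ true
row-suc j rewrite ≡ᵇ-true {suc j} refl = Bool.∨-zeroʳ _

row-false : ∀ {j t} → t ≢ j → t ≢ suc j → row j t ≡ false
row-false p q rewrite ≡ᵇ-false p | ≡ᵇ-false q = refl

row-true⇒ : ∀ {j t} → row j t ≡ true → t ≡ j ⊎ t ≡ suc j
row-true⇒ {j} {t} eq with t ℕ.≟ j | t ℕ.≟ suc j
... | yes p | _ = inj₁ p
... | _ | yes q = inj₂ q
... | no p | no q = contradiction (row-false p q) (true≢false eq)

module ForbiddenSubgraph (G : Graph) (S : Fin (n G) → Bool)
  (clique : ∀ x y → x ≢ y → S x ≡ true → S y ≡ true → adj G x y ≡ true)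
  (indep : ∀ x y → S x ≡ false → S y ≡ false → adj G x y ≡ false)
  (A : ArcModel S (adj G)) where

  open ArcModel A
  open ArcFacts A
  open Embedding G S clique indep
  open Signed Overlap overlap? overlap-sym overlap-irrefl meets meets-sym public

  private
    V = Fin (n G)
    N = adj G

  Forbidden : Set
  Forbidden = InducedSub F₀ G
    ⊎ (∃ λ k → (∃ λ m → k ≡ 2 * m) × 4 ≤ k × InducedSub (Sun k) G)
    ⊎ (∃ λ k → (∃ λ m → k ≡ suc (2 * m)) × 5 ≤ k × InducedSub (F₁ k) G)
    ⊎ (∃ λ k → (∃ λ m → k ≡ suc (2 * m)) × 5 ≤ k × InducedSub (F₂ k) G)

  Common : V → V → V → Set
  Common x y c = S c ≡ true × N x c ≡ true × N y c ≡ true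

  Meet Sub : V → V → Set
  Meet x y = ∃ (Common x y)
  Sub x y = ∀ c → S c ≡ true → N x c ≡ true → N y c ≡ true

  sub-or : ∀ x y → Sub x y ⊎ ∃ λ c → S c ≡ true × N x c ≡ true × N y c ≡ false
  sub-or x y with any? (λ c → (S c Bool.≟ true) ×-dec (N x c Bool.≟ true) ×-dec (N y c Bool.≟ false))
  ... | yes p = inj₂ p
  ... | no ¬p = inj₁ λ c sc xc → decidable-stable (N y c Bool.≟ true) λ q → ¬p (c , sc , xc , ¬true q)

  nested-of : ∀ {x y} → S x ≡ false → S y ≡ false → ¬ Overlap x y → Meet x y → Sub x y ⊎ Sub y x
  nested-of {x} {y} sx sy ¬o meet with sub-or x y | sub-or y x
  ... | inj₁ p | _ = inj₁ p
  ... | _ | inj₁ q = inj₂ q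
  ... | inj₂ (c , sc , p , q) | inj₂ (d , sd , p′ , q′) =
    contradiction (overlapping sx sy meet (c , sc , p , q) (d , sd , q′ , p′)) ¬o

  overlap-⊄ : ∀ {x y} → Overlap x y → ¬ Sub x y
  overlap-⊄ (overlapping _ _ _ (c , sc , p , q) _) s = true≢false (s c sc p) q

  overlap-⊅ : ∀ {x y} → Overlap x y → ¬ Sub y x
  overlap-⊅ o = overlap-⊄ (overlap-sym o)

  -- u and z meet inside y without overlapping, so they are nested; u inside z would put y inside z.
  -- Applied along a cycle, this spreads one containment to all arcs not adjacent to u.
  absorb : ∀ {u y z} → S u ≡ false → Overlap y z → ¬ Overlap u z → Sub y u → Sub z u
  absorb su o@(overlapping sy sz (c , sc , p , q) _ _) ¬o y⊆u
    with nested-of su sz ¬o (c , sc , y⊆u c sc p , q)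
  ... | inj₂ z⊆u = z⊆u
  ... | inj₁ u⊆z = contradiction (λ c sc p → u⊆z c sc (y⊆u c sc p)) (overlap-⊄ o)

  -- For p in the arc of x, whether the interval of x sees p only in its second lap.
  lap : V → V → Bool
  lap x p = pos p <ᵇ b x

  -- Arcs that see p in the same lap meet there. If they see it in different laps, meeting unshifted
  -- as well would be a cover of the circle.
  meets-lap : ∀ {x y p} → S x ≡ false → S y ≡ false → x ≢ y → Common x y p → meets x y ≡ not (lap x p xor lap y p)
  meets-lap {x} {y} {p} sx sy x≢y (sp , xp , yp) = go (pos p ℕ.<? b x) (pos p ℕ.<? b y)
    where
    o = pos p
    upper : ∀ {z} → Inside z p → o < e z
    upper (inj₁ (_ , q)) = q
    upper (inj₂ q) = ≤-<-trans (m≤m+n o m) q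
    second : ∀ {z} → o < b z → Inside z p → o + m < e z
    second q (inj₁ (r , _)) = contradiction q (≤⇒≯ r)
    second q (inj₂ r) = r
    ix = inside sx sp xp
    iy = inside sy sp yp
    go : Dec (o < b x) → Dec (o < b y) → meets x y ≡ not (lap x p xor lap y p)
    go (yes q) (yes r) rewrite <ᵇ-true q | <ᵇ-true r = meets-true {x} {y}
      (≤-<-trans (≤-trans (b≤m y) (m≤n+m m o)) (second q ix)) (≤-<-trans (≤-trans (b≤m x) (m≤n+m m o)) (second r iy))
    go (no q) (no r) rewrite <ᵇ-false (≮⇒≥ q) | <ᵇ-false (≮⇒≥ r) = meets-true {x} {y}
      (≤-<-trans (≮⇒≥ r) (upper ix)) (≤-<-trans (≮⇒≥ q) (upper iy))
    go (no q) (yes r) rewrite <ᵇ-false (≮⇒≥ q) | <ᵇ-true r = meets-false {x} {y} λ (s , _) →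
      q (+-cancelʳ-< m o (b x) (<-≤-trans (second r iy) (no-cover sx sy x≢y s)))
    go (yes q) (no r) rewrite <ᵇ-true q | <ᵇ-false (≮⇒≥ r) = meets-false {x} {y} λ (_ , s) →
      r (+-cancelʳ-< m o (b y) (<-≤-trans (second q ix) (no-cover sy sx (x≢y ∘ sym) s)))

  -- At a common point the three weights come, up to negation, from one potential, the lap of that
  -- point.
  meets-cocycle : ∀ {x y z p} → S x ≡ false → S y ≡ false → S z ≡ false → x ≢ y → y ≢ z → x ≢ z →
    Common x y p → N z p ≡ true → meets x z ≡ not (meets x y xor meets y z)
  meets-cocycle {x} {y} {z} {p} sx sy sz x≢y y≢z x≢z (sp , xp , yp) zp
    rewrite meets-lap sx sy x≢y (sp , xp , yp) | meets-lap sy sz y≢z (sp , yp , zp) | meets-lap sx sz x≢z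
        (sp , xp , zp)
    = bit (lap x p) (lap y p) (lap z p)
    where
    bit : ∀ a b c → not (a xor c) ≡ not (not (a xor b) xor not (b xor c))
    bit true true true = refl
    bit true true false = refl
    bit true false true = refl
    bit true false false = refl
    bit false true true = refl
    bit false true false = refl
    bit false false true = refl
    bit false false false = refl

  module Cycle (cyc : InducedOddCycle) where

    open InducedOddCycle cyc public

    sx : ∀ i → S (x i) ≡ false
    sx i = Overlap.left (edge i)

    x≢ : ∀ {i j} → i < j → j < i + k → x i ≢ x j
    x≢ {i} {j} i<j j< = subst (λ l → x i ≢ x l) (m+[n∸m]≡n (<⇒≤ i<j))
      (distinct i (j ∸ i) (m<n⇒0<n∸m i<j) (+-cancelˡ-< i (j ∸ i) k (subst (_< i + k) (sym (m+[n∸m]≡n (<⇒≤ i<j))) j<)))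

    ¬overlap : ∀ {i j} → i + 2 ≤ j → j + 2 ≤ i + k → ¬ Overlap (x i) (x j)
    ¬overlap {i} {j} p q = subst (λ l → ¬ Overlap (x i) (x l)) (m+[n∸m]≡n i≤j)
      (chordless i (j ∸ i)
        (lia 3 (λ i j d → d :+ i :≡ j ∷ i :+ con 2 :≤ j ∷ [] ⊢ con 2 :≤ d) i j (j ∸ i) (m∸n+n≡m i≤j) p)
        (lia 4 (λ i j d k → d :+ i :≡ j ∷ j :+ con 2 :≤ i :+ k ∷ [] ⊢ d :+ con 2 :≤ k) i j (j ∸ i) k (m∸n+n≡m i≤j) q))
      where
      i≤j : i ≤ j
      i≤j = ≤-trans (m≤m+n i 2) p

    -- Two such arcs that meet are nested. If the later one is inside, `absorb` carries the
    -- containment up to `x hi`, against `h₂`. If the earlier one is inside, its predecessor meets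
    -- the later arc too; this descent stops at `x lo`, against `h₁`.
    chain : ∀ lo hi → 1 ≤ lo → hi < k →
      (∀ j → lo + 2 ≤ j → j ≤ hi → ¬ Sub (x lo) (x j)) → (∀ i → lo ≤ i → i + 2 ≤ hi → ¬ Sub (x hi) (x i)) →
      ∀ i j → lo ≤ i → i + 2 ≤ j → j ≤ hi → ¬ Meet (x i) (x j)
    chain lo hi 1≤lo hi<k h₁ h₂ i j lo≤i = subst (λ i → i + 2 ≤ j → j ≤ hi → ¬ Meet (x i) (x j)) (m+[n∸m]≡n lo≤i)
        (go (i ∸ lo) j)
      where
      ¬ov : ∀ t j → lo + t + 2 ≤ j → j ≤ hi → ¬ Overlap (x (lo + t)) (x j)
      ¬ov t j p q = ¬overlap p (lia 5 (λ lo t j hi k → con 1 :≤ lo ∷ hi :< k ∷ j :≤ hi ∷ [] ⊢ j :+ con 2 :≤ lo :+ t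
          :+ k) lo t j hi k 1≤lo hi<k q)
      climb : ∀ t j → lo + t + 2 ≤ j → ∀ d → j + d ≤ hi → Sub (x j) (x (lo + t)) → Sub (x (j + d)) (x (lo + t))
      climb t j p zero q s = subst (λ l → Sub (x l) (x (lo + t))) (sym (+-identityʳ j)) s
      climb t j p (suc d) q s = subst (λ l → Sub (x l) (x (lo + t))) (sym (+-suc j d))
        (absorb (sx (lo + t)) (edge (j + d))
          (¬ov t (suc (j + d)) (≤-trans p (≤-trans (m≤m+n j (suc d)) (≤-reflexive (+-suc j d))))
              (subst (_≤ hi) (+-suc j d) q))
          (climb t j p d (≤-trans (+-monoʳ-≤ j (n≤1+n d)) q) s))
      go : ∀ t j → lo + t + 2 ≤ j → j ≤ hi → ¬ Meet (x (lo + t)) (x j)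
      go t j p q meet with nested-of (sx (lo + t)) (sx j) (¬ov t j p q) meet
      ... | inj₂ s = h₂ (lo + t) (m≤m+n lo t) (≤-trans p q)
          (subst (λ l → Sub (x l) (x (lo + t))) (m+[n∸m]≡n q) (climb t j p (hi ∸ j) (≤-reflexive (m+[n∸m]≡n q)) s))
      go zero j p q meet | inj₁ s = h₁ j (subst (λ l → l + 2 ≤ j) (+-identityʳ lo) p) q
          (subst (λ l → Sub (x l) (x j)) (+-identityʳ lo) s)
      go (suc t) j p q meet | inj₁ s with subst (λ l → Overlap (x (lo + t)) (x l)) (sym (+-suc lo t)) (edge (lo + t))
      ... | overlapping _ _ (c , sc , xc , yc) _ _ = go t j
          (≤-trans (+-monoˡ-≤ 2 (+-monoʳ-≤ lo (n≤1+n t))) p) q (c , sc , xc , s c sc yc)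

    0<k : 0 < k
    0<k = ≤-trans (s≤s z≤n) 3≤k

    last : ℕ
    last = k ∸ 1

    suc-last : suc last ≡ k
    suc-last = m+[n∸m]≡n 0<k

    last<k : last < k
    last<k = ≤-reflexive suc-last

    x-k : x k ≡ x 0
    x-k = period 0

    last-edge : Overlap (x last) (x 0)
    last-edge = subst (Overlap (x last)) (trans (cong x suc-last) x-k) (edge last)

    Disjoint : ℕ → ℕ → Set
    Disjoint i j = ¬ Meet (x i) (x j)

    outˡ : ∀ {i j c} → Disjoint i j → S c ≡ true → N (x j) c ≡ true → N (x i) c ≡ false
    outˡ d sc q = ¬true λ p → d (-, sc , p , q)

    outʳ : ∀ {i j c} → Disjoint i j → S c ≡ true → N (x i) c ≡ true → N (x j) c ≡ false
    outʳ d sc p = ¬true λ q → d (-, sc , p , q)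

    out-sub : ∀ {u v c} → Sub v u → S c ≡ true → N u c ≡ false → N v c ≡ false
    out-sub s sc q = ¬true λ p → true≢false (s _ sc p) q

    below-or-last : ∀ j → j < k → j + 2 ≤ k ⊎ j ≡ last
    below-or-last j j<k with m≤n⇒m<n∨m≡n j<k
    ... | inj₁ p = inj₁ (subst (_≤ k) (+-comm 2 j) p)
    ... | inj₂ p = inj₂ (suc-injective (trans p (sym suc-last)))

    module Nested (4≤k : 4 ≤ k) (inner : ∀ j → 2 ≤ j → j + 2 ≤ k → Sub (x j) (x 0)) where

      common₃ : ∀ j → 1 ≤ j → suc j < k → ∃ λ c → Common (x j) (x (suc j)) c × N (x 0) c ≡ true
      common₃ 1 _ p = let c , sc , q , r = Overlap.common (edge 1) in c , (sc , q , r) , inner 2 ≤-refl 4≤k c sc r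
      common₃ j@(suc (suc _)) _ p = let c , sc , q , r = Overlap.common (edge j) in
        c , (sc , q , r) , inner j (s≤s (s≤s z≤n)) (subst (_≤ k) (+-comm 2 j) p) c sc q

      -- The arcs x 0, x (j + 1), x (j + 2) have a common neighbour, so by the cocycle identity a
      -- partial sum stays a single weight, negated once per step. The closing edge cancels that
      -- weight, and the odd total becomes the parity of k.
      prefix : ∀ j → suc j < k → σ label 0 (suc j) ≡ parity (suc (suc j)) xor meets (x 0) (x (suc j))
      prefix zero _ = Bool.xor-identityʳ _
      prefix (suc j) p = trans (σ-snoc label 0 (suc j))
          (trans (cong (_xor label (suc j)) (prefix j (<-trans ≤-refl p)))
        (trans (bit (parity (suc (suc j))) (meets (x 0) (x (suc j))) (label (suc j)))
            (cong (not (parity (suc (suc j))) xor_) (sym cocycle))))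
        where
        bit : ∀ a b c → (a xor b) xor c ≡ not a xor not (b xor c)
        bit true true c = sym (Bool.not-involutive c)
        bit true false c = refl
        bit false true c = sym (Bool.not-involutive (not c))
        bit false false c = sym (Bool.not-involutive c)
        cocycle : meets (x 0) (x (suc (suc j))) ≡ not (meets (x 0) (x (suc j)) xor label (suc j))
        cocycle = let c , (sc , q , r) , s = common₃ (suc j) (s≤s z≤n) p in
          meets-cocycle (sx 0) (sx (suc j)) (sx (suc (suc j))) (x≢ (s≤s z≤n) (<-trans ≤-refl p))
            (overlap-irrefl (edge (suc j))) (x≢ (s≤s z≤n) p) (sc , s , q) r

      odd-length : parity k ≡ true
      odd-length = go last suc-last (≤-trans (s≤s z≤n) (s≤s⁻¹ (≤-trans 4≤k (≤-reflexive (sym suc-last)))))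
        where
        go : ∀ l → suc l ≡ k → 1 ≤ l → parity k ≡ true
        go (suc l) eq _ = trans (cong parity (sym eq)) (trans (sym total) (trans (cong (σ label 0) eq) odd))
          where
          total : σ label 0 (suc (suc l)) ≡ parity (suc (suc l))
          total = trans (σ-snoc label 0 (suc l)) (trans (cong₂ _xor_ (prefix l (≤-reflexive eq))
              (trans (cong (meets (x (suc l))) (trans (cong x eq) x-k)) (meets-sym (x (suc l)) (x 0))))
            (trans (Bool.xor-assoc (parity (suc (suc l))) _ _)
                (trans (cong (parity (suc (suc l)) xor_) (Bool.xor-same (meets (x 0) (x (suc l)))))
              (Bool.xor-identityʳ _))))

      5≤k : 5 ≤ k
      5≤k = ≤∧≢⇒< 4≤k λ { eq → true≢false odd-length (sym (cong parity eq)) }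

      x0⊄last : ∀ {i} → Sub (x i) (x 0) → ¬ Sub (x last) (x i)
      x0⊄last s r = overlap-⊄ last-edge λ c sc p → s c sc (r c sc p)

      -- The case of F₂: x 0 is b, and the remaining arcs form a path a₁, ..., a_(k-1) that is not
      -- closed up.
      module Separate (unlinked : Disjoint 1 last) where

        separated : ∀ i j → 1 ≤ i → i + 2 ≤ j → j ≤ last → Disjoint i j
        separated = chain 1 last ≤-refl last<k h₁ h₂
          where
          h₁ : ∀ j → 3 ≤ j → j ≤ last → ¬ Sub (x 1) (x j)
          h₁ j p q s with below-or-last j (≤-<-trans q last<k)
          ... | inj₁ r = overlap-⊅ (edge 0) λ c sc t → inner j (≤-trans (s≤s (s≤s z≤n)) p) r c sc (s c sc t)
          ... | inj₂ refl = let c , sc , _ , t = Overlap.common (edge 0) in unlinked (c , sc , t , s c sc t)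
          h₂ : ∀ i → 1 ≤ i → i + 2 ≤ last → ¬ Sub (x last) (x i)
          h₂ 1 _ _ s = let c , sc , t , _ = Overlap.common last-edge in unlinked (c , sc , s c sc t , t)
          h₂ i@(suc (suc _)) _ p s = x0⊄last (inner i (s≤s (s≤s z≤n)) (≤-trans p (<⇒≤ last<k))) s

        M : ℕ → ℕ → Bool
        M zero t = (0 <ᵇ t) ∧ (suc t <ᵇ k)
        M (suc j) t = row j t

        columns : ∀ s t → s < t → t < k → ¬ (∀ j → j < k → M j s ≡ M j t)
        columns s t s<t t<k eq with row-true⇒ {s} {t} (trans (sym (eq (suc s) (≤-<-trans s<t t<k))) (row-self s))
        ... | inj₁ refl = <-irrefl refl s<t
        columns zero .1 s<t t<k eq | inj₂ refl with () ← trans (eq 0 0<k)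
            (<ᵇ-true (≤-trans (s≤s (s≤s (s≤s z≤n))) 4≤k))
        columns (suc s) .(suc (suc s)) s<t t<k eq | inj₂ refl
          with row-true⇒ {s} {suc (suc s)} (trans (sym (eq (suc s) (<-trans s<t t<k))) (row-suc s))
        ... | inj₁ ()
        ... | inj₂ ()

        -- The two extreme clique vertices are neighbours of x 1 and of x last outside x 0; the
        -- others are shared by consecutive arcs.
        point : ∀ t → t < k → ∃ λ c → S c ≡ true × (∀ j → j < k → N (x j) c ≡ M j t)
        point zero _ with Overlap.onlyʳ (edge 0)
        ... | c , sc , p , q = c , sc , at-j
          where
          at-j : ∀ j → j < k → N (x j) c ≡ M j 0
          at-j 0 _ = p
          at-j 1 _ = q
          at-j j@(suc (suc _)) j<k with below-or-last j j<k
          ... | inj₁ r = out-sub (inner j (s≤s (s≤s z≤n)) r) sc p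
          ... | inj₂ r = subst (λ l → N (x l) c ≡ false) (sym r) (outʳ unlinked sc q)
        point (suc t) t<k with below-or-last (suc t) t<k
        ... | inj₁ r with common₃ (suc t) (s≤s z≤n) (subst (_≤ k) (+-comm (suc t) 2) r)
        ...   | c , (sc , p , q) , p₀ = c , sc , at-j
          where
          at-j : ∀ j → j < k → N (x j) c ≡ M j (suc t)
          at-j 0 _ = trans p₀ (sym (<ᵇ-true (subst (_≤ k) (+-comm (suc t) 2) r)))
          at-j (suc j) j<k with <-cmp j t
          ... | tri< j<t _ _ = trans (outˡ (separated (suc j) (suc (suc t)) (s≤s z≤n)
                  (lia 2 (λ j t → j :< t ∷ [] ⊢ con 1 :+ j :+ con 2 :≤ con 2 :+ t) j t j<t)
                  (s≤s⁻¹ (≤-trans (subst (_≤ k) (+-comm (suc t) 2) r) (≤-reflexive (sym suc-last))))) sc q)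
                (sym (row-false (>⇒≢ (<-trans j<t ≤-refl)) (>⇒≢ (s≤s j<t))))
          ... | tri≈ _ refl _ = trans p (sym (row-suc t))
          ... | tri> _ _ t<j with m≤n⇒m<n∨m≡n t<j
          ...   | inj₂ refl = trans q (sym (row-self (suc t)))
          ...   | inj₁ t+1<j = trans (outʳ (separated (suc t) (suc j) (s≤s z≤n)
                  (lia 2 (λ j t → con 1 :+ t :< j ∷ [] ⊢ con 1 :+ t :+ con 2 :≤ con 1 :+ j) j t t+1<j)
                  (s≤s⁻¹ (≤-trans j<k (≤-reflexive (sym suc-last))))) sc p)
                (sym (row-false (<⇒≢ t+1<j) (<⇒≢ (s≤s t<j))))
        point (suc t) t<k | inj₂ r with Overlap.onlyˡ last-edge
        ... | c , sc , q , p = c , sc , at-j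
          where
          at-j : ∀ j → j < k → N (x j) c ≡ M j (suc t)
          at-j 0 _ = trans p (sym (<ᵇ-false (≤-trans (≤-reflexive (sym suc-last)) (s≤s (≤-reflexive (sym r))))))
          at-j (suc j) j<k with j ℕ.≟ t
          ... | yes refl = trans (cong (λ l → N (x l) c) r) (trans q (sym (row-suc t)))
          ... | no j≢t = trans (off j j<t) (sym (row-false (>⇒≢ (<-trans j<t ≤-refl)) (>⇒≢ (s≤s j<t))))
            where
            j<t : j < t
            j<t = ≤∧≢⇒< (s≤s⁻¹ (≤-trans (s≤s⁻¹ (≤-trans j<k (≤-reflexive (sym suc-last)))) (≤-reflexive (sym r)))) j≢t
            off : ∀ j → j < t → N (x (suc j)) c ≡ false
            off zero _ = outˡ unlinked sc q
            off (suc j) j<t = out-sub (inner (suc (suc j)) (s≤s (s≤s z≤n))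
              (lia 3 (λ j t k → con 1 :+ j :< t ∷ con 1 :+ t :< k ∷ [] ⊢ con 2 :+ j :+ con 2 :≤ k) j t k j<t t<k)) sc
                  p

        forbidden : Forbidden
        forbidden = inj₂ (inj₂ (inj₂ (k , parity-true k odd-length , 5≤k ,
          embedSequence k k (NF₂ k) M (λ { zero i → refl ; (suc j) i → refl }) x sx
            (λ i j p q → x≢ p (m≤n⇒m≤o+n i q)) columns point)))

      -- The case of F₁: `absorb` extends the containment from x last down to x 3, so x 0 and x 1
      -- are the two large arcs b₁ and b₂, each missing one end of the path x 2, ..., x last.
      module Inward (last⊆1 : Sub (x last) (x 1)) where

        inner₁ : ∀ d j → j + d ≡ last → 3 ≤ j → Sub (x j) (x 1)
        inner₁ zero j eq p = subst (λ l → Sub (x l) (x 1)) (trans (sym eq) (+-identityʳ j)) last⊆1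
        inner₁ (suc d) j eq p = absorb (sx 1) (overlap-sym (edge j))
          (¬overlap p (lia 4 (λ j d l k → j :+ (con 1 :+ d) :≡ l ∷ con 1 :+ l :≡ k ∷ [] ⊢ j :+ con 2 :≤ con 1 :+ k) j
              d last k eq suc-last))
          (inner₁ d (suc j) (trans (sym (+-suc j d)) eq) (m≤n⇒m≤1+n p))

        inside₁ : ∀ j → 3 ≤ j → j ≤ last → Sub (x j) (x 1)
        inside₁ j p q = inner₁ (last ∸ j) j (m+[n∸m]≡n q) p

        separated : ∀ i j → 2 ≤ i → i + 2 ≤ j → j ≤ last → Disjoint i j
        separated = chain 2 last (s≤s z≤n) last<k
          (λ j p q s → overlap-⊅ (edge 1) λ c sc t → inside₁ j (≤-trans (s≤s (s≤s (s≤s z≤n))) p) q c sc (s c sc t))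
          (λ i p q → x0⊄last (inner i p (≤-trans q (<⇒≤ last<k))))

        M : ℕ → ℕ → Bool
        M 0 t = t <ᵇ (k ∸ 2)
        M 1 t = not (t ≡ᵇ 0)
        M (suc (suc j)) t = row j t

        columns : ∀ s t → s < t → t < last → ¬ (∀ j → j < k → M j s ≡ M j t)
        columns s t s<t t<l eq
          with row-true⇒ {s} {t} (trans (sym (eq (suc (suc s)) (≤-<-trans (≤-trans (s≤s s<t) t<l) last<k)))
              (row-self s))
        ... | inj₁ refl = <-irrefl refl s<t
        columns zero .1 s<t t<l eq | inj₂ refl with () ← eq 1 (<-trans t<l last<k)
        columns (suc s) .(suc (suc s)) s<t t<l eq | inj₂ refl
          with row-true⇒ {s} {suc (suc s)} (trans (sym (eq (suc (suc s)) (<-trans t<l last<k))) (row-suc s))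
        ... | inj₁ ()
        ... | inj₂ ()

        last≡ : suc (k ∸ 2) ≡ last
        last≡ = suc-injective (trans (m+[n∸m]≡n (≤-trans (s≤s (s≤s z≤n)) 4≤k)) (sym suc-last))

        -- The extreme clique vertices lie in x 2 but not in x 1, and in x last but not in x 0.
        point : ∀ t → t < last → ∃ λ c → S c ≡ true × (∀ j → j < k → N (x j) c ≡ M j t)
        point zero _ with Overlap.onlyʳ (edge 1)
        ... | c , sc , p , q = c , sc , at-j
          where
          at-j : ∀ j → j < k → N (x j) c ≡ M j 0
          at-j 0 _ = trans (inner 2 ≤-refl 4≤k c sc q)
              (sym (<ᵇ-true (s≤s⁻¹ (≤-trans
              (s≤s⁻¹ (≤-trans (≤-trans (s≤s (s≤s (s≤s z≤n))) 4≤k) (≤-reflexive (sym suc-last))))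
              (≤-reflexive (sym last≡))))))
          at-j 1 _ = p
          at-j 2 _ = q
          at-j j@(suc (suc (suc _))) j<k = out-sub (inside₁ j (s≤s (s≤s (s≤s z≤n)))
              (s≤s⁻¹ (≤-trans j<k (≤-reflexive (sym suc-last))))) sc p
        point (suc t) t<l with m≤n⇒m<n∨m≡n t<l
        ... | inj₁ r with Overlap.common (edge (suc (suc t)))
        ...   | c , sc , p , q = c , sc , at-j
          where
          j≤last : ∀ {j} → j < k → j ≤ last
          j≤last j<k = s≤s⁻¹ (≤-trans j<k (≤-reflexive (sym suc-last)))
          at-j : ∀ j → j < k → N (x j) c ≡ M j (suc t)
          at-j 0 _ = trans
            (inner (suc (suc t)) (s≤s (s≤s z≤n))
              (lia 3 (λ t l k → con 2 :+ t :< l ∷ con 1 :+ l :≡ k ∷ [] ⊢ con 2 :+ t :+ con 2 :≤ k) t last k r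
                  suc-last) c sc p)
            (sym (<ᵇ-true (s≤s⁻¹ (≤-trans r (≤-reflexive (sym last≡))))))
          at-j 1 _ = inside₁ (suc (suc (suc t))) (s≤s (s≤s (s≤s z≤n))) r c sc q
          at-j (suc (suc j)) j<k with <-cmp j t
          ... | tri< j<t _ _ = trans (outˡ (separated (suc (suc j)) (suc (suc (suc t))) (s≤s (s≤s z≤n))
                  (lia 2 (λ j t → j :< t ∷ [] ⊢ con 2 :+ j :+ con 2 :≤ con 3 :+ t) j t j<t) r) sc q)
                (sym (row-false (>⇒≢ (<-trans j<t ≤-refl)) (>⇒≢ (s≤s j<t))))
          ... | tri≈ _ refl _ = trans p (sym (row-suc t))
          ... | tri> _ _ t<j with m≤n⇒m<n∨m≡n t<j
          ...   | inj₂ refl = trans q (sym (row-self (suc t)))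
          ...   | inj₁ t+1<j = trans (outʳ (separated (suc (suc t)) (suc (suc j)) (s≤s (s≤s z≤n))
                  (lia 2 (λ j t → con 1 :+ t :< j ∷ [] ⊢ con 2 :+ t :+ con 2 :≤ con 2 :+ j) j t t+1<j) (j≤last j<k))
                      sc p)
                (sym (row-false (<⇒≢ t+1<j) (<⇒≢ (s≤s t<j))))
        point (suc t) t<l | inj₂ r with Overlap.onlyˡ last-edge
        ... | c , sc , q , p = c , sc , at-j
          where
          at-j : ∀ j → j < k → N (x j) c ≡ M j (suc t)
          at-j 0 _ = trans p (sym (<ᵇ-false (≤-reflexive (suc-injective (trans last≡ (sym r))))))
          at-j 1 _ = last⊆1 c sc q
          at-j (suc (suc j)) j<k with j ℕ.≟ t
          ... | yes refl = trans (cong (λ l → N (x l) c) r) (trans q (sym (row-suc t)))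
          ... | no j≢t = trans (out-sub (inner (suc (suc j)) (s≤s (s≤s z≤n))
              (lia 4 (λ j t l k → j :< t ∷ con 2 :+ t :≡ l ∷ con 1 :+ l :≡ k ∷ [] ⊢ con 2 :+ j :+ con 2 :≤ k) j t
                  last k j<t r suc-last)) sc p)
              (sym (row-false (>⇒≢ (<-trans j<t ≤-refl)) (>⇒≢ (s≤s j<t))))
            where
            j<t : j < t
            j<t = ≤∧≢⇒< (s≤s⁻¹ (s≤s⁻¹ (s≤s⁻¹ (≤-trans j<k (≤-reflexive (trans (sym suc-last) (cong suc (sym r))))))))
                j≢t

        forbidden : Forbidden
        forbidden = inj₂ (inj₂ (inj₁ (k , parity-true k odd-length , 5≤k ,
          embedSequence last k (NF₁ k) M (λ { zero i → refl ; (suc zero) i → refl ; (suc (suc j)) i → refl }) x sx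
            (λ i j p q → x≢ p (m≤n⇒m≤o+n i q)) columns point)))

    Unlinked : Set
    Unlinked = ∀ i d → 2 ≤ d → d + 2 ≤ k → Disjoint i (i + d)

    unlinked-at : Unlinked → ∀ {i j} → i + 2 ≤ j → j + 2 ≤ i + k → Disjoint i j
    unlinked-at un {i} {j} p q = subst (Disjoint i) (m+[n∸m]≡n i≤j)
      (un i (j ∸ i)
        (lia 3 (λ i j d → d :+ i :≡ j ∷ i :+ con 2 :≤ j ∷ [] ⊢ con 2 :≤ d) i j (j ∸ i) (m∸n+n≡m i≤j) p)
        (lia 4 (λ i j d k → d :+ i :≡ j ∷ j :+ con 2 :≤ i :+ k ∷ [] ⊢ d :+ con 2 :≤ k) i j (j ∸ i) k (m∸n+n≡m i≤j) q))
      where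
      i≤j : i ≤ j
      i≤j = ≤-trans (m≤m+n i 2) p

    Far : V → V → Set
    Far y z = b z + m < e y

    near-or-far : ∀ i → Precedes (x i) (x (suc i)) →
      (b (x i) < b (x (suc i)) × label i ≡ true) ⊎ (Far (x i) (x (suc i)) × label i ≡ false)
    near-or-far i (near p q r) = inj₁ (p , meets-true {x i} {x (suc i)} q (<-trans (<-trans p q) r))
    near-or-far i (far p q r) = inj₂ (q , meets-false {x i} {x (suc i)} λ (_ , t) →
      far-b (sx i) (sx (suc i)) (overlap-irrefl (edge i)) q t)

    far-wraps : ∀ {y z} → Far y z → m < e y
    far-wraps {y} {z} p = ≤-<-trans (m≤n+m m (b z)) p

    nonempty : ∀ i → b (x i) < e (x i)
    nonempty i = let c , sc , p , _ = Overlap.common (edge i) in inside-nonempty (inside (sx i) sc p)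

    -- After two such steps in a row the second arc would wrap as well, and so meet the first one
    -- unshifted too, against `far-b`.
    ¬far-far : ∀ i {j l} → suc i ≡ j ⊎ x (suc i) ≡ x j → Far (x i) (x (suc i)) → ¬ Far (x j) (x l)
    ¬far-far i (inj₁ refl) p q = far-b (sx i) (sx (suc i)) (overlap-irrefl (edge i)) p
        (<-trans (b< (nonempty i)) (far-wraps q))
    ¬far-far i {j} {l} (inj₂ eq) p q = far-b (sx i) (sx (suc i)) (overlap-irrefl (edge i)) p
      (<-trans (b< (nonempty i)) (subst (λ v → m < e v) (sym eq) (far-wraps q)))

    wraps-meet : ∀ i j → m < e (x i) → m < e (x j) → Meet (x i) (x j)
    wraps-meet i j p q =
      let c , sc , eq = at 0 (≤-<-trans z≤n (b< (nonempty i)))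
          zero-in : ∀ {v} → S v ≡ false → m < e v → N v c ≡ true
          zero-in sv r = from (member sv sc) (inj₂ (subst (λ o → o + m < _) (sym eq) r))
      in c , sc , zero-in (sx i) p , zero-in (sx j) q

    -- If every arc is followed by the next one, the starting points increase except that the circle is closed
    -- up exactly once.
    winding : (∀ i → Precedes (x i) (x (suc i))) → Unlinked → parity k ≡ false
    winding follows un = case search last of λ
      { (inj₁ (i , p , q)) → once i p q
      ; (inj₂ p) → contradiction (subst (λ v → b (x 0) < b v) (trans (cong x suc-last) x-k) p) (<-irrefl refl) }
      where
      search : ∀ j → (∃ λ i → Far (x i) (x (suc i)) × label i ≡ false) ⊎ b (x 0) < b (x (suc j))
      search zero with near-or-far 0 (follows 0)
      ... | inj₁ (p , _) = inj₂ p
      ... | inj₂ p = inj₁ (0 , p)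
      search (suc j) with search j | near-or-far (suc j) (follows (suc j))
      ... | inj₁ p | _ = inj₁ p
      ... | inj₂ p | inj₁ (q , _) = inj₂ (<-trans p q)
      ... | inj₂ _ | inj₂ q = inj₁ (suc j , q)
      -- One step has weight 0. Another far step would be adjacent to it, against `¬far-far`, or its
      -- arc would share position 0 with x i. So the other k - 1 weights are 1, and k - 1 is odd.
      once : ∀ i → Far (x i) (x (suc i)) → label i ≡ false → parity k ≡ false
      once i p q = trans (cong parity (sym suc-last)) (cong not (trans (sym (σ-true label (suc i) last rest))
        (trans (cong (_xor σ label (suc i) last) (sym q)) (trans (cong (σ label i) suc-last) (odd-at i)))))
        where
        rest : ∀ t → t < last → label (suc i + t) ≡ true
        rest t t<l with near-or-far (suc i + t) (follows (suc i + t))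
        ... | inj₁ (_ , r) = r
        rest zero t<l | inj₂ (r , _) = contradiction r (¬far-far i (inj₁ (cong suc (sym (+-identityʳ i)))) p)
        rest (suc t) t<l | inj₂ (r , _) with m≤n⇒m<n∨m≡n t<l
        ... | inj₁ s = contradiction (wraps-meet i (suc i + suc t) (far-wraps p) (far-wraps r))
            (unlinked-at un
              (lia 2 (λ i t → [] ⊢ i :+ con 2 :≤ con 1 :+ i :+ (con 1 :+ t)) i t)
              (lia 4 (λ i t l k → con 2 :+ t :< l ∷ con 1 :+ l :≡ k ∷ [] ⊢ con 1 :+ i :+ (con 1 :+ t) :+ con 2 :≤ i
                  :+ k) i t last k s suc-last))
        ... | inj₂ s = contradiction p (¬far-far (suc i + suc t) (inj₂ (trans (cong x
            (lia 4 (λ i t l k → con 2 :+ t :≡ l ∷ con 1 :+ l :≡ k ∷ [] ⊢ con 1 :+ (con 1 :+ i :+ (con 1 :+ t)) :≡ i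
                :+ k) i t last k s suc-last))
            (period i))) r)

    -- If the direction changed at x (i + 1), both of its neighbours in the cycle would contain its
    -- starting point, although they are disjoint.
    follow : Unlinked → 4 ≤ k → Precedes (x 0) (x 1) → ∀ i → Precedes (x i) (x (suc i))
    follow un 4≤k p zero = p
    follow un 4≤k p (suc i) with overlap⇒precedes (edge (suc i)) | follow un 4≤k p i
    ... | inj₁ q | _ = q
    ... | inj₂ q | r =
      let c , C = startVertex (nonemptyʳ r)
          sc = proj₁ C
      in contradiction
        (c , sc , from (member (sx i) sc) (startʳ-inˡ (sx i) (sx (suc i)) (overlap-irrefl (edge i)) r C)
               , from (member (sx (suc (suc i))) sc)
                   (startʳ-inˡ (sx (suc (suc i))) (sx (suc i)) (overlap-irrefl (edge (suc i)) ∘ sym) q C))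
        (unlinked-at un (≤-reflexive (+-comm i 2)) (lia 2 (λ i k → con 4 :≤ k ∷ [] ⊢ con 2 :+ i :+ con 2 :≤ i :+ k) i
            k 4≤k))

    module Sparse (4≤k : 4 ≤ k) (un : Unlinked) where

      M : ℕ → ℕ → Bool
      M j t = (t ≡ᵇ j) ∨ (t ≡ᵇ suc j) ∨ ((t ≡ᵇ 0) ∧ (suc j ≡ᵇ k))

      M-true : ∀ {j t} → t ≡ j ⊎ t ≡ suc j → M j t ≡ true
      M-true {j} (inj₁ refl) rewrite ≡ᵇ-true {j} refl = refl
      M-true {j} (inj₂ refl) rewrite ≡ᵇ-true {suc j} refl = Bool.∨-zeroʳ _

      M-false : ∀ {j t} → t ≢ j → t ≢ suc j → ¬ (t ≡ 0 × suc j ≡ k) → M j t ≡ false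
      M-false {j} {zero} p q r rewrite ≡ᵇ-false p | ≡ᵇ-false (λ eq → r (refl , eq)) = refl
      M-false {j} {suc t} p q r rewrite ≡ᵇ-false p | ≡ᵇ-false q = refl

      columns : ∀ s t → s < t → t < k → ¬ (∀ j → j < k → M j s ≡ M j t)
      columns s t s<t t<k eq with t ℕ.≟ suc s
      ... | no ¬p = true≢false (M-true {s} {s} (inj₁ refl))
          (trans (eq s (<-trans s<t t<k)) (M-false (>⇒≢ s<t) ¬p λ { (refl , _) → case s<t of λ () }))
      ... | yes refl = true≢false (M-true {t} {t} (inj₁ refl))
          (trans (sym (eq t t<k)) (M-false (<⇒≢ s<t) (<⇒≢ (<-trans s<t ≤-refl))
            λ { (refl , q) → <⇒≢ (≤-trans (s≤s (s≤s (s≤s z≤n))) 4≤k) q }))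

      -- The clique vertices of the sun are common neighbours of cyclically consecutive arcs;
      -- disjointness of all other pairs gives the zeros.
      point : ∀ t → t < k → ∃ λ c → S c ≡ true × (∀ j → j < k → N (x j) c ≡ M j t)
      point zero _ with Overlap.common last-edge
      ... | c , sc , p , q = c , sc , at-j
        where
        at-j : ∀ j → j < k → N (x j) c ≡ M j 0
        at-j 0 _ = q
        at-j 1 _ = trans (outˡ (unlinked-at un {1} {last}
            (lia 2 (λ l k → con 1 :+ l :≡ k ∷ con 4 :≤ k ∷ [] ⊢ con 3 :≤ l) last k suc-last 4≤k)
            (lia 2 (λ l k → con 1 :+ l :≡ k ∷ [] ⊢ l :+ con 2 :≤ con 1 :+ k) last k suc-last)) sc p)
          (sym (M-false {1} {0} (λ ()) (λ ()) λ (_ , eq) → <⇒≢ (≤-trans (s≤s (s≤s (s≤s z≤n))) 4≤k) eq))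
        at-j j@(suc (suc i)) j<k with below-or-last j j<k
        ... | inj₁ r = trans (outʳ (unlinked-at un {0} {j} (s≤s (s≤s z≤n)) r) sc q)
            (sym (M-false {j} {0} (λ ()) (λ ()) λ (_ , eq) → <⇒≢ (<-≤-trans (m<m+n (suc j) (s≤s z≤n))
                (≤-trans (≤-reflexive (sym (+-suc j 1))) r)) eq))
        ... | inj₂ r = trans (cong (λ l → N (x l) c) r) (trans p (sym (≡ᵇ-true (trans (cong suc r) suc-last))))
      point (suc t) t<k with Overlap.common (edge t)
      ... | c , sc , p , q = c , sc , at-j
        where
        ¬0 : ∀ {j} → ¬ (suc t ≡ 0 × suc j ≡ k)
        ¬0 ()
        at-j : ∀ j → j < k → N (x j) c ≡ M j (suc t)
        at-j j j<k with <-cmp j t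
        ... | tri≈ _ refl _ = trans p (sym (M-true {j} {suc j} (inj₂ refl)))
        ... | tri< j<t _ _ = trans off (sym (M-false (>⇒≢ (<-trans j<t ≤-refl)) (>⇒≢ (s≤s j<t)) ¬0))
          where
          off : N (x j) c ≡ false
          off with m≤n⇒m<n∨m≡n j<t
          ... | inj₁ r = outˡ (unlinked-at un {j} {t} (subst (_≤ t) (+-comm 2 j) r)
                (lia 3 (λ j t k → con 1 :+ t :< k ∷ [] ⊢ t :+ con 2 :≤ j :+ k) j t k t<k)) sc p
          ... | inj₂ refl = outˡ (unlinked-at un {j} {suc t} (≤-reflexive (+-comm j 2))
                (lia 2 (λ j k → con 4 :≤ k ∷ [] ⊢ con 2 :+ j :+ con 2 :≤ j :+ k) j k 4≤k)) sc q
        ... | tri> _ _ t<j with m≤n⇒m<n∨m≡n t<j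
        ...   | inj₂ refl = trans q (sym (M-true {suc t} {suc t} (inj₁ refl)))
        ...   | inj₁ t+1<j = trans off (sym (M-false (<⇒≢ t+1<j) (<⇒≢ (<-trans t+1<j ≤-refl)) ¬0))
          where
          off : N (x j) c ≡ false
          off with m≤n⇒m<n∨m≡n t+1<j
          ... | inj₁ r = outʳ (unlinked-at un {suc t} {j}
              (≤-trans (≤-reflexive (lia 1 (λ t → [] ⊢ con 1 :+ t :+ con 2 :≡ con 3 :+ t) t)) r)
                (lia 3 (λ j t k → j :< k ∷ [] ⊢ j :+ con 2 :≤ con 1 :+ t :+ k) j t k j<k)) sc q
          ... | inj₂ refl = outʳ (unlinked-at un {t} {j} (≤-reflexive (+-comm t 2))
                (lia 2 (λ t k → con 4 :≤ k ∷ [] ⊢ con 2 :+ t :+ con 2 :≤ t :+ k) t k 4≤k)) sc p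

      forbidden : parity k ≡ false → Forbidden
      forbidden even = inj₂ (inj₁ (k , parity-false k even , 4≤k ,
        embedSequence k k (NSun k) M (λ j i → refl) x sx (λ i j p q → x≢ p (m≤n⇒m≤o+n i q)) columns point))

  open Cycle

  -- The clique of F₀ consists of the starting points of z, x, y, in the roles 0, c₂, c₃, and the
  -- last points of z and y, in the roles c₁, c₄.
  triangle : ∀ {x y z} → S x ≡ false → S y ≡ false → S z ≡ false → x ≢ y → y ≢ z → x ≢ z →
    Precedes x y → Precedes y z → Precedes x z → InducedSub F₀ G
  triangle {x} {y} {z} sx sy sz x≢y y≢z x≢z xy yz xz = embed 5 3 NF₀ c a
    (λ { zero → sc₀ ; (suc zero) → sc₁ ; (suc (suc zero)) → sc₂ ; (suc (suc (suc zero))) →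
        sc₃ ; (suc (suc (suc (suc zero)))) → sc₄ })
    (λ { zero → sx ; (suc zero) → sy ; (suc (suc zero)) → sz })
    (λ { zero zero → on sx C₀ (startʳ-inˡ sx sz x≢z xz C₀)
       ; zero (suc zero) → off sx C₁ (lastʳ-outˡ sx sz x≢z xz C₁)
       ; zero (suc (suc zero)) → on sx C₂ (start-in (nonemptyˡ xy) C₂)
       ; zero (suc (suc (suc zero))) → on sx C₃ (startʳ-inˡ sx sy x≢y xy C₃)
       ; zero (suc (suc (suc (suc zero)))) → off sx C₄ (lastʳ-outˡ sx sy x≢y xy C₄)
       ; (suc zero) zero → on sy C₀ (startʳ-inˡ sy sz y≢z yz C₀)
       ; (suc zero) (suc zero) → off sy C₁ (lastʳ-outˡ sy sz y≢z yz C₁)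
       ; (suc zero) (suc (suc zero)) → off sy C₂ (startˡ-outʳ sx sy x≢y xy C₂)
       ; (suc zero) (suc (suc (suc zero))) → on sy C₃ (start-in (nonemptyʳ xy) C₃)
       ; (suc zero) (suc (suc (suc (suc zero)))) → on sy C₄ (last-in (nonemptyʳ xy) C₄)
       ; (suc (suc zero)) zero → on sz C₀ (start-in (nonemptyʳ yz) C₀)
       ; (suc (suc zero)) (suc zero) → on sz C₁ (last-in (nonemptyʳ yz) C₁)
       ; (suc (suc zero)) (suc (suc zero)) → off sz C₂ (startˡ-outʳ sx sz x≢z xz C₂)
       ; (suc (suc zero)) (suc (suc (suc zero))) → off sz C₃ (startˡ-outʳ sy sz y≢z yz C₃)
       ; (suc (suc zero)) (suc (suc (suc (suc zero)))) → on sz C₄ (lastˡ-inʳ sy sz y≢z yz C₄) })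
    columns a-inj
    where
    start₀ = startVertex (nonemptyʳ xz)
    last₁ = lastVertex (nonemptyʳ xz)
    start₂ = startVertex (nonemptyˡ xy)
    start₃ = startVertex (nonemptyʳ xy)
    last₄ = lastVertex (nonemptyʳ xy)
    C₀ = proj₂ start₀
    C₁ = proj₂ last₁
    C₂ = proj₂ start₂
    C₃ = proj₂ start₃
    C₄ = proj₂ last₄
    sc₀ = proj₁ C₀
    sc₁ = proj₁ C₁
    sc₂ = proj₁ C₂
    sc₃ = proj₁ C₃
    sc₄ = proj₁ C₄
    on : ∀ {v c} {P : Set} → S v ≡ false → S c ≡ true × P → Inside v c → N v c ≡ true
    on sv (sc , _) = from (member sv sc)
    off : ∀ {v c} {P : Set} → S v ≡ false → S c ≡ true × P → ¬ Inside v c → N v c ≡ false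
    off sv (sc , _) p = ¬true (p ∘ to (member sv sc))
    c : Fin 5 → V
    c zero = proj₁ start₀
    c (suc zero) = proj₁ last₁
    c (suc (suc zero)) = proj₁ start₂
    c (suc (suc (suc zero))) = proj₁ start₃
    c (suc (suc (suc (suc zero)))) = proj₁ last₄
    a : Fin 3 → V
    a zero = x
    a (suc zero) = y
    a (suc (suc zero)) = z
    a-inj : ∀ {i j} → a i ≡ a j → i ≡ j
    a-inj {zero} {zero} _ = refl
    a-inj {zero} {suc zero} p = contradiction p x≢y
    a-inj {zero} {suc (suc zero)} p = contradiction p x≢z
    a-inj {suc zero} {zero} p = contradiction (sym p) x≢y
    a-inj {suc zero} {suc zero} _ = refl
    a-inj {suc zero} {suc (suc zero)} p = contradiction p y≢z
    a-inj {suc (suc zero)} {zero} p = contradiction (sym p) x≢z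
    a-inj {suc (suc zero)} {suc zero} p = contradiction (sym p) y≢z
    a-inj {suc (suc zero)} {suc (suc zero)} _ = refl
    columns : ∀ i i′ → (∀ j → NF₀ j i ≡ NF₀ j i′) → i ≡ i′
    columns i i′ eq = decidable-stable (i ≟ i′) (table i i′ (eq zero) (eq (suc zero)) (eq (suc (suc zero))))
      where
      table : ∀ i i′ → NF₀ zero i ≡ NF₀ zero i′ → NF₀ (suc zero) i ≡ NF₀ (suc zero) i′ →
        NF₀ (suc (suc zero)) i ≡ NF₀ (suc (suc zero)) i′ → ¬ i ≢ i′
      table = toWitness {a? = all? λ i → all? λ i′ → (NF₀ zero i Bool.≟ NF₀ zero i′) →-dec
        (NF₀ (suc zero) i Bool.≟ NF₀ (suc zero) i′) →-dec
        (NF₀ (suc (suc zero)) i Bool.≟ NF₀ (suc (suc zero)) i′) →-dec ¬? (¬? (i ≟ i′))} tt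

  module _ (cyc : InducedOddCycle) where

    open Reverse cyc using (reverseCycle; reverse-at; step-back)

    -- If the three arcs followed each other cyclically, `winding` would make 3 even. So the order
    -- of precedence is transitive, in one of six ways.
    fromTriangle : k cyc ≡ 3 → InducedSub F₀ G
    fromTriangle k≡3 = orient (overlap⇒precedes (edge cyc 0)) (overlap⇒precedes (edge cyc 1))
        (overlap⇒precedes (subst (Overlap (x cyc 2)) x3 (edge cyc 2)))
      where
      s₀ = sx cyc 0
      s₁ = sx cyc 1
      s₂ = sx cyc 2
      x3 : x cyc 3 ≡ x cyc 0
      x3 = trans (cong (x cyc) (sym k≡3)) (x-k cyc)
      0≢1 : x cyc 0 ≢ x cyc 1
      0≢1 = overlap-irrefl (edge cyc 0)
      1≢2 : x cyc 1 ≢ x cyc 2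
      1≢2 = overlap-irrefl (edge cyc 1)
      2≢0 : x cyc 2 ≢ x cyc 0
      2≢0 eq = overlap-irrefl (edge cyc 2) (trans eq (sym x3))
      ¬odd : (c : InducedOddCycle) → k c ≡ 3 → Precedes (x c 0) (x c 1) → Precedes (x c 1) (x c 2) → Precedes (x c 2)
          (x c 0) → ⊥
      ¬odd c eq p q r = true≢false (trans (cong parity eq) refl) (winding c follows λ i d u v →
          contradiction (≤-trans (≤-trans (+-monoˡ-≤ 2 u) v) (≤-reflexive eq)) λ { (s≤s (s≤s (s≤s ()))) })
        where
        per : ∀ i → x c (3 + i) ≡ x c i
        per i = trans (cong (x c) (trans (+-comm 3 i) (cong (i +_) (sym eq)))) (period c i)
        follows : ∀ i → Precedes (x c i) (x c (suc i))
        follows 0 = p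
        follows 1 = q
        follows 2 = subst (Precedes (x c 2)) (sym (per 0)) r
        follows (suc (suc (suc i))) = subst₂ Precedes (sym (per i)) (sym (per (suc i))) (follows i)
      y1 : x reverseCycle 1 ≡ x cyc 2
      y1 = trans (reverse-at 1 (0<k cyc)) (cong (λ k → x cyc (k ∸ 1)) k≡3)
      y2 : x reverseCycle 2 ≡ x cyc 1
      y2 = trans (reverse-at 2 (≤-trans (s≤s (s≤s z≤n)) (3≤k cyc))) (cong (λ k → x cyc (k ∸ 2)) k≡3)
      orient : Precedes (x cyc 0) (x cyc 1) ⊎ Precedes (x cyc 1) (x cyc 0) →
        Precedes (x cyc 1) (x cyc 2) ⊎ Precedes (x cyc 2) (x cyc 1) →
        Precedes (x cyc 2) (x cyc 0) ⊎ Precedes (x cyc 0) (x cyc 2) → InducedSub F₀ G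
      orient (inj₁ p) (inj₁ q) (inj₁ r) = ⊥-elim (¬odd cyc k≡3 p q r)
      orient (inj₂ p) (inj₂ q) (inj₂ r) = ⊥-elim (¬odd reverseCycle k≡3
        (subst (Precedes (x cyc 0)) (sym y1) r) (subst₂ Precedes (sym y1) (sym y2) q)
            (subst (λ v → Precedes v (x cyc 0)) (sym y2) p))
      orient (inj₁ p) (inj₁ q) (inj₂ r) = triangle s₀ s₁ s₂ 0≢1 1≢2 (2≢0 ∘ sym) p q r
      orient (inj₁ p) (inj₂ q) (inj₁ r) = triangle s₂ s₀ s₁ 2≢0 0≢1 (1≢2 ∘ sym) r p q
      orient (inj₁ p) (inj₂ q) (inj₂ r) = triangle s₀ s₂ s₁ (2≢0 ∘ sym) (1≢2 ∘ sym) 0≢1 r q p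
      orient (inj₂ p) (inj₁ q) (inj₁ r) = triangle s₁ s₂ s₀ 1≢2 2≢0 (0≢1 ∘ sym) q r p
      orient (inj₂ p) (inj₁ q) (inj₂ r) = triangle s₁ s₀ s₂ (0≢1 ∘ sym) (2≢0 ∘ sym) 1≢2 p r q
      orient (inj₂ p) (inj₂ q) (inj₁ r) = triangle s₂ s₁ s₀ (1≢2 ∘ sym) (0≢1 ∘ sym) 2≢0 q p r

    -- Absorption in both directions puts all arcs but the two neighbours of x 0 inside x 0. These
    -- neighbours are disjoint or nested; reversing the cycle exchanges them.
    fromNested : 4 ≤ k cyc → ∀ d → 2 ≤ d → d + 2 ≤ k cyc → Sub (x cyc d) (x cyc 0) → Forbidden
    fromNested 4≤k d 2≤d d+2≤k d⊆0 = case nested-or-not of λ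
      { (inj₁ (inj₁ s)) → Nested.Inward.forbidden reverseCycle 4≤k inner′
          (subst₂ Sub (sym y-last) (sym (reverse-at 1 (0<k cyc))) s)
      ; (inj₁ (inj₂ s)) → Nested.Inward.forbidden cyc 4≤k inner s
      ; (inj₂ un) → Nested.Separate.forbidden cyc 4≤k inner un }
      where
      l = last cyc
      up : ∀ e → d + e + 2 ≤ k cyc → Sub (x cyc (d + e)) (x cyc 0)
      up zero _ = subst (λ i → Sub (x cyc i) (x cyc 0)) (sym (+-identityʳ d)) d⊆0
      up (suc e) p = subst (λ i → Sub (x cyc i) (x cyc 0)) (sym (+-suc d e))
        (absorb (sx cyc 0) (edge cyc (d + e)) (¬overlap cyc {0} {suc (d + e)}
            (≤-trans 2≤d (≤-trans (m≤m+n d e) (n≤1+n _))) q)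
          (up e (≤-trans (n≤1+n _) q)))
        where
        q : suc (d + e) + 2 ≤ k cyc
        q = subst (λ i → i + 2 ≤ k cyc) (+-suc d e) p
      down : ∀ e j → j + e ≡ d → 2 ≤ j → Sub (x cyc j) (x cyc 0)
      down zero j eq _ = subst (λ i → Sub (x cyc i) (x cyc 0)) (trans (sym eq) (+-identityʳ j)) d⊆0
      down (suc e) j eq 2≤j = absorb (sx cyc 0) (overlap-sym (edge cyc j))
        (¬overlap cyc {0} {j} 2≤j (≤-trans (+-monoˡ-≤ 2 (≤-trans (m≤m+n j (suc e)) (≤-reflexive eq))) d+2≤k))
        (down e (suc j) (trans (sym (+-suc j e)) eq) (m≤n⇒m≤1+n 2≤j))
      inner : ∀ j → 2 ≤ j → j + 2 ≤ k cyc → Sub (x cyc j) (x cyc 0)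
      inner j p q with ≤-total j d
      ... | inj₁ r = down (d ∸ j) j (m+[n∸m]≡n r) p
      ... | inj₂ r = subst (λ i → Sub (x cyc i) (x cyc 0)) (m+[n∸m]≡n r)
          (up (j ∸ d) (subst (λ i → i + 2 ≤ k cyc) (sym (m+[n∸m]≡n r)) q))
      inner′ : ∀ j → 2 ≤ j → j + 2 ≤ k cyc → Sub (x reverseCycle j) (x reverseCycle 0)
      inner′ j p q = subst (λ v → Sub v (x cyc 0)) (sym (reverse-at j j≤k))
        (inner (k cyc ∸ j) (m+n≤o⇒m≤o∸n 2 (subst (_≤ k cyc) (+-comm j 2) q))
          (lia 3 (λ d l k → l :+ d :≡ k ∷ con 2 :≤ d ∷ [] ⊢ l :+ con 2 :≤ k) j (k cyc ∸ j) (k cyc) (m∸n+n≡m j≤k) p))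
        where
        j≤k : j ≤ k cyc
        j≤k = ≤-trans (m≤m+n j 2) q
      y-last : x reverseCycle l ≡ x cyc 1
      y-last = trans (reverse-at l (<⇒≤ (last<k cyc))) (cong (x cyc)
        (trans (cong (_∸ l) (sym (suc-last cyc))) (m+n∸n≡m 1 l)))
      nested-or-not : (Sub (x cyc 1) (x cyc l) ⊎ Sub (x cyc l) (x cyc 1)) ⊎ Disjoint cyc 1 l
      nested-or-not with any? (λ c → (S c Bool.≟ true) ×-dec (N (x cyc 1) c Bool.≟ true) ×-dec
          (N (x cyc l) c Bool.≟ true))
      ... | no ¬p = inj₂ ¬p
      ... | yes p = inj₁ (nested-of (sx cyc 1) (sx cyc l) (¬overlap cyc {1} {l}
          (lia 2 (λ l k → con 1 :+ l :≡ k ∷ con 4 :≤ k ∷ [] ⊢ con 3 :≤ l) l (k cyc) (suc-last cyc) 4≤k)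
          (lia 2 (λ l k → con 1 :+ l :≡ k ∷ [] ⊢ l :+ con 2 :≤ con 1 :+ k) l (k cyc) (suc-last cyc))) p)

    -- The cycle is traversed in the direction in which x 0 precedes the next arc; `follow` then
    -- orients all other steps.
    fromUnlinked : 4 ≤ k cyc → Unlinked cyc → Forbidden
    fromUnlinked 4≤k un with overlap⇒precedes (edge cyc 0)
    ... | inj₁ p = Sparse.forbidden cyc 4≤k un (winding cyc (follow cyc un 4≤k p) un)
    ... | inj₂ p = Sparse.forbidden cyc 4≤k un (winding reverseCycle (follow reverseCycle un′ 4≤k first) un′)
      where
      l = last cyc
      un′ : Unlinked reverseCycle
      un′ i d p q = subst (λ v → ¬ Meet (x reverseCycle i) v) (sym (step-back i d (≤-trans (s≤s z≤n) p) d≤k))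
        (un (i * l) (k cyc ∸ d) (m+n≤o⇒m≤o∸n 2 (subst (_≤ k cyc) (+-comm d 2) q))
          (lia 3 (λ d l k → l :+ d :≡ k ∷ con 2 :≤ d ∷ [] ⊢ l :+ con 2 :≤ k) d (k cyc ∸ d) (k cyc) (m∸n+n≡m d≤k) p))
        where
        d≤k : d ≤ k cyc
        d≤k = ≤-trans (m≤m+n d 2) q
      first : Precedes (x cyc 0) (x reverseCycle 1)
      first = subst (Precedes (x cyc 0)) (sym (reverse-at 1 (0<k cyc))) (case overlap⇒precedes (last-edge cyc) of λ
        { (inj₂ q) → q
        ; (inj₁ q) → let c , C = startVertex (nonemptyʳ q)
                         sc = proj₁ C in ⊥-elim (unlinked-at cyc un {1} {l}
            (lia 2 (λ l k → con 1 :+ l :≡ k ∷ con 4 :≤ k ∷ [] ⊢ con 3 :≤ l) l (k cyc) (suc-last cyc) 4≤k)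
            (lia 2 (λ l k → con 1 :+ l :≡ k ∷ [] ⊢ l :+ con 2 :≤ con 1 :+ k) l (k cyc) (suc-last cyc))
            (c , sc , from (member (sx cyc 1) sc) (startʳ-inˡ (sx cyc 1) (sx cyc 0) (overlap-irrefl (edge cyc 0) ∘
                sym) p C)
                    , from (member (sx cyc l) sc) (startʳ-inˡ (sx cyc l) (sx cyc 0) (overlap-irrefl (last-edge cyc))
                        q C))) })

  forbidden-from-cycle : InducedOddCycle → Forbidden
  forbidden-from-cycle cyc with m≤n⇒m<n∨m≡n (3≤k cyc)
  ... | inj₂ eq = inj₁ (fromTriangle cyc (sym eq))
  ... | inj₁ 4≤k with ℕ.anyUpTo? (λ i → ℕ.anyUpTo? (λ d → (2 ℕ.≤? d) ×-dec (d + 2 ℕ.≤? k cyc) ×-dec sub?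
      (x cyc (i + d)) (x cyc i)) (k cyc)) (k cyc)
    where
    sub? : ∀ u v → Dec (Sub u v)
    sub? u v with sub-or u v
    ... | inj₁ p = yes p
    ... | inj₂ (c , sc , p , q) = no λ s → true≢false (s c sc p) q
  ...   | yes (i , _ , d , _ , 2≤d , d+2≤k , s) = fromNested (shiftCycle i cyc) 4≤k d 2≤d d+2≤k
            (subst (λ l → Sub (x cyc (i + d)) (x cyc l)) (sym (+-identityʳ i)) s)
  ...   | no ¬p = fromUnlinked cyc 4≤k λ i d 2≤d d+2≤k meet →
    let d<k = <-≤-trans (m<m+n d (s≤s z≤n)) d+2≤k
        not-sub : ∀ i d → 2 ≤ d → d + 2 ≤ k cyc → ¬ Sub (x cyc (i + d)) (x cyc i)
        not-sub i d p q s =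
          let r , r<k , same = residue cyc i (0<k cyc) in
          ¬p (r , r<k , d , <-≤-trans (m<m+n d (s≤s z≤n)) q , p , q
             , subst₂ Sub (same d) (trans (cong (x cyc) (sym (+-identityʳ i)))
                 (trans (same 0) (cong (x cyc) (+-identityʳ r)))) s)
    in case nested-of (sx cyc i) (sx cyc (i + d)) (chordless cyc i d 2≤d d+2≤k) meet of λ
      { (inj₂ s) → not-sub i d 2≤d d+2≤k s
      -- From x (i + d) another k - d steps lead back to x i, so this containment is the other one
      -- in rotated position.
      ; (inj₁ s) → not-sub (i + d) (k cyc ∸ d) (m+n≤o⇒m≤o∸n 2 (subst (_≤ k cyc) (+-comm d 2) d+2≤k))
          (lia 3 (λ d l k → l :+ d :≡ k ∷ con 2 :≤ d ∷ [] ⊢ l :+ con 2 :≤ k) d (k cyc ∸ d) (k cyc)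
              (m∸n+n≡m (<⇒≤ d<k)) 2≤d)
          (subst (λ v → Sub v (x cyc (i + d))) (sym (trans (cong (x cyc)
            (trans (+-assoc i d _) (cong (i +_) (m+[n∸m]≡n (<⇒≤ d<k))))) (period cyc i))) s) }

-- Chord diagrams of 2-uniform words

Cross : (ℕ → ℕ) → (ℕ → ℕ) → Set
Cross u v = u 0 < v 0 × v 0 < u 1 × u 1 < v 1

-- A letter occurring twice is the chord between its occurrences, and alternation is crossing.
-- Indices are natural numbers, constrained only below p and q, so that cyclic index arithmetic
-- avoids `Fin`.
record ChordDiagram (p q : ℕ) (M : ℕ → ℕ → Bool) : Set where
  field
    c a     : ℕ → ℕ → ℕ
    c<      : ∀ {t} → t < p → c t 0 < c t 1
    a<      : ∀ {j} → j < q → a j 0 < a j 1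
    clique  : ∀ {s t} → s < p → t < p → s ≢ t → Cross (c s) (c t) ⊎ Cross (c t) (c s)
    indep   : ∀ {i j} → i < q → j < q → i ≢ j → ¬ Cross (a i) (a j)
    crosses : ∀ {j t} → j < q → t < p → (M j t ≡ true) ⇔ (Cross (a j) (c t) ⊎ Cross (c t) (a j))
    ends≢   : ∀ {j t} i i′ → i < 2 → i′ < 2 → j < q → t < p → a j i ≢ c t i′
    ends≢′  : ∀ {j j′} i i′ → i < 2 → i′ < 2 → j < q → j′ < q → j ≢ j′ → a j i ≢ a j′ i′

Between : ℕ → ℕ → ℕ → Set
Between l z r = (l < z × z < r) ⊎ (r < z × z < l)

module Sides {p q M} (D : ChordDiagram p q M) where

  open ChordDiagram D

  side : ℕ → ℕ → Bool
  side j z = (a j 0 <ᵇ z) ∧ (z <ᵇ a j 1)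

  side-true : ∀ {j z} → a j 0 < z → z < a j 1 → side j z ≡ true
  side-true r s rewrite <ᵇ-true r | <ᵇ-true s = refl

  side-falseˡ : ∀ {j z} → z ≤ a j 0 → side j z ≡ false
  side-falseˡ r rewrite <ᵇ-false r = refl

  side-falseʳ : ∀ {j z} → a j 1 ≤ z → side j z ≡ false
  side-falseʳ {j} {z} r rewrite <ᵇ-false r = Bool.∧-zeroʳ _

  side⇒ : ∀ {j z} → side j z ≡ true → a j 0 < z × z < a j 1
  side⇒ {j} {z} eq with a j 0 ℕ.<? z | z ℕ.<? a j 1
  ... | yes r | yes s = r , s
  ... | no r | _ = contradiction (side-falseˡ (≮⇒≥ r)) (true≢false eq)
  ... | _ | no s = contradiction (side-falseʳ {j} {z} (≮⇒≥ s)) (true≢false eq)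

  convex : ∀ {j y z w} → side j y ≡ true → side j w ≡ true → y < z → z < w → side j z ≡ true
  convex {j} y∈ w∈ y<z z<w = side-true {j} (<-trans (proj₁ (side⇒ {j} y∈)) y<z) (<-trans z<w (proj₂ (side⇒ {j} w∈)))

  fst snd : ℕ → ℕ → Bool
  fst j t = side j (c t 0)
  snd j t = side j (c t 1)

  cross⇒ : ∀ {j t} → j < q → t < p → Cross (a j) (c t) ⊎ Cross (c t) (a j) → fst j t xor snd j t ≡ true
  cross⇒ {j} {t} j<q t<p (inj₁ (r , s , u)) = cong₂ _xor_ (side-true {j} r s) (side-falseʳ {j} (<⇒≤ u))
  cross⇒ {j} {t} j<q t<p (inj₂ (r , s , u)) = cong₂ _xor_ (side-falseˡ {j} (<⇒≤ r)) (side-true {j} s u)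

  ⇒cross : ∀ {j t} → j < q → t < p → fst j t xor snd j t ≡ true → Cross (a j) (c t) ⊎ Cross (c t) (a j)
  ⇒cross {j} {t} j<q t<p eq with fst j t in e₁ | snd j t in e₂
  ... | true | false = let r , s = side⇒ {j} e₁ in inj₁ (r , s , ≤∧≢⇒<
        (≮⇒≥ λ u → true≢false (side-true {j} (<-trans r (c< t<p)) u) e₂) (ends≢ 1 1 ≤-refl ≤-refl j<q t<p))
  ... | false | true = let r , s = side⇒ {j} e₂ in inj₂ (≤∧≢⇒<
        (≮⇒≥ λ u → true≢false (side-true {j} u (<-trans (c< t<p) s)) e₁) (ends≢ 0 0 (s≤s z≤n) (s≤s z≤n) j<q t<p ∘
            sym) , r , s)

  ∈-sides : ∀ {j t} → j < q → t < p → M j t ≡ true → snd j t ≡ not (fst j t)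
  ∈-sides j<q t<p eq = bit _ _ (cross⇒ j<q t<p (to (crosses j<q t<p) eq))
    where
    bit : ∀ x y → x xor y ≡ true → y ≡ not x
    bit true y eq = trans (sym (Bool.not-involutive y)) (cong not eq)
    bit false y eq = eq

  ∉-sides : ∀ {j t} → j < q → t < p → M j t ≡ false → snd j t ≡ fst j t
  ∉-sides {j} {t} j<q t<p eq = bit _ _ λ e → true≢false (from (crosses j<q t<p) (⇒cross j<q t<p e)) eq
    where
    bit : ∀ x y → ¬ x xor y ≡ true → y ≡ x
    bit true true _ = refl
    bit true false n = contradiction refl n
    bit false true n = contradiction refl n
    bit false false _ = refl

  ordered : ∀ {s t} → s < p → t < p → c s 0 < c t 0 → c t 0 < c s 1 × c s 1 < c t 1
  ordered s<p t<p r with clique s<p t<p (λ { refl → <-irrefl refl r })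
  ... | inj₁ (_ , u , v) = u , v
  ... | inj₂ (u , _) = contradiction u (<-asym r)

  fst-injective : ∀ {s t} → s < p → t < p → c s 0 ≡ c t 0 → s ≡ t
  fst-injective {s} {t} s<p t<p eq with s ℕ.≟ t
  ... | yes e = e
  ... | no ne with clique s<p t<p ne
  ...   | inj₁ (r , _) = contradiction eq (<⇒≢ r)
  ...   | inj₂ (r , _) = contradiction (sym eq) (<⇒≢ r)

  private
    agree : ∀ {j s t} → j < q → s < p → t < p → c s 0 < c t 0 → M j s ≡ false → M j t ≡ false → fst j s ≡ fst j t
    agree {j} {s} {t} j<q s<p t<p r es et with ordered s<p t<p r
    ... | u , v with fst j s in e₁ | fst j t in e₂
    ...   | true | true = refl
    ...   | false | false = refl
    ...   | true | false = contradiction e₂ (true≢false (convex {j} e₁ (trans (∉-sides j<q s<p es) e₁) r u))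
    ...   | false | true = contradiction (trans (∉-sides j<q s<p es) e₁)
            (true≢false (convex {j} e₂ (trans (∉-sides j<q t<p et) e₂) u v))

  -- Clique chords cross each other, which chords on opposite sides of chord j cannot do.
  outside-same : ∀ {j s t} → j < q → s < p → t < p → M j s ≡ false → M j t ≡ false → fst j s ≡ fst j t
  outside-same {j} {s} {t} j<q s<p t<p es et with <-cmp (c s 0) (c t 0)
  ... | tri≈ _ r _ = cong (side j) r
  ... | tri< r _ _ = agree j<q s<p t<p r es et
  ... | tri> _ _ r = sym (agree j<q t<p s<p r et es)

  Implies : ℕ → ℕ → Set
  Implies i j = ∀ z → side i z ≡ true → side j z ≡ true

  Exclusive : ℕ → ℕ → Set
  Exclusive i j = ∀ z → side i z ≡ true → side j z ≡ false

  private
    positions< : ∀ {i j} → i < q → j < q → i ≢ j → a i 0 < a j 0 → Implies j i ⊎ Exclusive i j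
    positions< {i} {j} i<q j<q i≢j r with a j 0 ℕ.<? a i 1
    ... | no s = inj₂ λ z e → side-falseˡ {j} (≤-trans (<⇒≤ (proj₂ (side⇒ {i} e))) (≮⇒≥ s))
    ... | yes s = inj₁ λ z e → let u , v = side⇒ {j} e in side-true {i} (<-trans r u) (<-≤-trans v
          (≮⇒≥ λ w → indep i<q j<q i≢j (r , s , w)))

  positions : ∀ {i j} → i < q → j < q → i ≢ j → Implies i j ⊎ Implies j i ⊎ Exclusive i j
  positions {i} {j} i<q j<q i≢j with <-cmp (a i 0) (a j 0)
  ... | tri< r _ _ = inj₂ (positions< i<q j<q i≢j r)
  ... | tri≈ _ r _ = contradiction r (ends≢′ 0 0 (s≤s z≤n) (s≤s z≤n) i<q j<q i≢j)
  ... | tri> _ _ r with positions< j<q i<q (i≢j ∘ sym) r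
  ...   | inj₁ s = inj₁ s
  ...   | inj₂ s = inj₂ (inj₂ λ z e → ¬true λ e′ → true≢false e (s z e′))

  private
    implies-same : ∀ {i j t} → i < q → j < q → t < p → M i t ≡ true → M j t ≡ true → Implies i j → fst i t ≡ fst j t
    implies-same {i} {j} {t} i<q j<q t<p mi mj s with fst i t in e₁ | fst j t in e₂
    ... | true | true = refl
    ... | false | false = refl
    ... | true | false = contradiction e₂ (true≢false (s _ e₁))
    ... | false | true = contradiction (trans (∈-sides j<q t<p mj) (cong not e₂))
            (true≢false (s _ (trans (∈-sides i<q t<p mi) (cong not e₁))))

    exclusive-opposite : ∀ {i j t} → i < q → j < q → t < p → M i t ≡ true → M j t ≡ true → Exclusive i j → fst i t ≡
        not (fst j t)
    exclusive-opposite {i} {j} {t} i<q j<q t<p mi mj s with fst i t in e₁ | fst j t in e₂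
    ... | true | false = refl
    ... | false | true = refl
    ... | true | true = contradiction (s _ e₁) (true≢false e₂)
    ... | false | false = contradiction (s _ (trans (∈-sides i<q t<p mi) (cong not e₁)))
            (true≢false (trans (∈-sides j<q t<p mj) (cong not e₂)))

    outside-implied : ∀ {i j t} → i < q → j < q → t < p → M i t ≡ false → M j t ≡ true → Implies i j → fst i t ≡ false
    outside-implied {i} {j} {t} i<q j<q t<p mi mj s = ¬true λ e → true≢false (s _ (trans (∉-sides i<q t<p mi) e))
      (trans (∈-sides j<q t<p mj) (cong not (s _ e)))

    outside-implying : ∀ {i j t} → i < q → j < q → t < p → M i t ≡ true → M j t ≡ false → Implies i j → fst j t ≡ true
    outside-implying {i} {j} {t} i<q j<q t<p mi mj s with fst i t in e
    ... | true = s _ e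
    ... | false = trans (sym (∉-sides j<q t<p mj)) (s _ (trans (∈-sides i<q t<p mi) (cong not e)))

    outside-exclusive : ∀ {i j t} → i < q → j < q → t < p → M i t ≡ true → M j t ≡ false → Exclusive i j → fst j t ≡
        false
    outside-exclusive {i} {j} {t} i<q j<q t<p mi mj s with fst i t in e
    ... | true = s _ e
    ... | false = trans (sym (∉-sides j<q t<p mj)) (s _ (trans (∈-sides i<q t<p mi) (cong not e)))

    exclusive-sym : ∀ {i j} → Exclusive i j → Exclusive j i
    exclusive-sym s z e = ¬true λ e′ → true≢false e (s z e′)

  -- Whether a chord crossing both i and j starts on equal or opposite sides is decided by i and j
  -- alone: equal if their insides are nested, opposite if they are disjoint.
  sign : ∀ {i j s t} → i < q → j < q → i ≢ j → s < p → t < p → M i s ≡ true → M j s ≡ true → M i t ≡ true →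
      M j t ≡ true →
    fst i s xor fst j s ≡ fst i t xor fst j t
  sign {i} {j} {s} {t} i<q j<q i≢j s<p t<p is js it jt with positions i<q j<q i≢j
  ... | inj₁ r rewrite implies-same i<q j<q s<p is js r | implies-same i<q j<q t<p it jt r =
        trans (Bool.xor-same (fst j s)) (sym (Bool.xor-same (fst j t)))
  ... | inj₂ (inj₁ r) rewrite implies-same j<q i<q s<p js is r | implies-same j<q i<q t<p jt it r =
        trans (Bool.xor-same (fst i s)) (sym (Bool.xor-same (fst i t)))
  ... | inj₂ (inj₂ r) rewrite exclusive-opposite i<q j<q s<p is js r | exclusive-opposite i<q j<q t<p it jt r =
        trans (opp (fst j s)) (sym (opp (fst j t)))
    where
    opp : ∀ b → not b xor b ≡ true
    opp true = refl
    opp false = refl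

  -- Of two non-crossing chords i and j with incomparable neighbourhoods, a common neighbour starts on the side of
  -- exactly one of them that contains no non-neighbour.
  link : ∀ {i j t s s′} → i < q → j < q → t < p → s < p → s′ < p → M i t ≡ true → M j t ≡ true →
    M i s ≡ true → M j s ≡ false → M i s′ ≡ false → M j s′ ≡ true →
    fst i t xor fst i s′ ≡ not (fst j t xor fst j s)
  link {i} {j} {t} {s} {s′} i<q j<q t<p s<p s′<p it jt is js is′ js′
    with positions i<q j<q (λ { refl → true≢false is js })
  ... | inj₁ r rewrite implies-same i<q j<q t<p it jt r | outside-implied i<q j<q s′<p is′ js′ r
        | outside-implying i<q j<q s<p is js r = bit (fst j t)
    where
    bit : ∀ b → b xor false ≡ not (b xor true)
    bit true = refl
    bit false = refl
  ... | inj₂ (inj₁ r) rewrite implies-same j<q i<q t<p jt it r | outside-implied j<q i<q s<p js is r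
        | outside-implying j<q i<q s′<p js′ is′ r = bit (fst i t)
    where
    bit : ∀ b → b xor true ≡ not (b xor false)
    bit true = refl
    bit false = refl
  ... | inj₂ (inj₂ r) rewrite exclusive-opposite i<q j<q t<p it jt r | outside-exclusive i<q j<q s<p is js r
        | outside-exclusive j<q i<q s′<p js′ is′ (exclusive-sym r) = bit (fst j t)
    where
    bit : ∀ b → not b xor false ≡ not (b xor false)
    bit true = refl
    bit false = refl

  -- If s and t started on the same side, convexity would put both ends of d inside chord j, and
  -- with them an end of s or t caught between that has to be outside.
  separated : ∀ {j s d t} → j < q → s < p → d < p → t < p → M j s ≡ true → M j d ≡ false → M j t ≡ true →
    c s 0 < c d 0 → c d 0 < c t 0 → fst j s xor fst j t ≡ true
  separated {j} {s} {d} {t} j<q s<p d<p t<p js jd jt s<d d<t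
    with ordered s<p d<p s<d | ordered d<p t<p d<t | ordered s<p t<p (<-trans s<d d<t)
  ... | sd , sd′ | dt , dt′ | st , st′ with fst j s in e₁ | fst j t in e₂
  ...   | true | false = refl
  ...   | false | true = refl
  ...   | true | true =
          let d∈ = convex {j} e₁ e₂ s<d d<t in
          contradiction (trans (∈-sides j<q s<p js) (cong not e₁))
              (true≢false (convex {j} d∈ (trans (∉-sides j<q d<p jd) d∈) sd sd′))
  ...   | false | false =
          let s∈ = trans (∈-sides j<q s<p js) (cong not e₁)
              t∈ = trans (∈-sides j<q t<p jt) (cong not e₂)
              d∈ = convex {j} s∈ t∈ sd′ dt′ in
          contradiction e₂ (true≢false (convex {j} (trans (sym (∉-sides j<q d<p jd)) d∈) d∈ d<t dt))

  private
    between< : ∀ {j s d t} → j < q → s < p → d < p → t < p → M j s ≡ true → M j d ≡ false → M j t ≡ true →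
      c s 0 < c t 0 → fst j s xor fst j t ≡ true → c s 0 < c d 0 × c d 0 < c t 0
    between< {j} {s} {d} {t} j<q s<p d<p t<p js jd jt r δ with ordered s<p t<p r | fst j s in e₁ | fst j t in e₂
    ... | _ | true | false = contradiction e₂ (true≢false (convex {j} e₁ (trans (∈-sides j<q t<p jt) (cong not e₂)) r
        (c< t<p)))
    ... | st , st′ | false | true = left , right
      where
      s∈ = trans (∈-sides j<q s<p js) (cong not e₁)
      t∉ = trans (∈-sides j<q t<p jt) (cong not e₂)
      d≡ = ∉-sides j<q d<p jd
      left : c s 0 < c d 0
      left with <-cmp (c s 0) (c d 0)
      ... | tri< u _ _ = u
      ... | tri≈ _ u _ = contradiction jd (true≢false (subst (λ l → M j l ≡ true) (fst-injective s<p d<p u) js))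
      ... | tri> _ _ u with ordered d<p s<p u | ordered d<p t<p (<-trans u r) | fst j d in e₃
      ...   | _ | _ | true = contradiction e₁ (true≢false (convex {j} e₃ e₂ u r))
      ...   | _ , ds | dt , _ | false = contradiction (trans d≡ e₃) (true≢false (convex {j} e₂ s∈ dt ds))
      right : c d 0 < c t 0
      right with <-cmp (c d 0) (c t 0)
      ... | tri< u _ _ = u
      ... | tri≈ _ u _ = contradiction jd (true≢false (subst (λ l → M j l ≡ true) (sym (fst-injective d<p t<p u)) jt))
      ... | tri> _ _ u with ordered t<p d<p u | ordered s<p d<p (<-trans r u) | fst j d in e₃
      ...   | _ , td | _ | true = contradiction t∉ (true≢false (convex {j} s∈ (trans d≡ e₃) st′ td))
      ...   | _ | sd , _ | false = contradiction e₃ (true≢false (convex {j} e₂ s∈ u sd))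

  -- Converse of `separated`: the two bits tell whether the non-neighbours start between s and t or
  -- beyond them.
  between : ∀ {j s d t} → j < q → s < p → d < p → t < p → M j s ≡ true → M j d ≡ false → M j t ≡ true →
    fst j s xor fst j t ≡ true → Between (c s 0) (c d 0) (c t 0)
  between {j} {s} {d} {t} j<q s<p d<p t<p js jd jt δ with <-cmp (c s 0) (c t 0)
  ... | tri≈ _ eq _ = contradiction (trans (cong (fst j s xor_) (cong (side j) (sym eq))) (Bool.xor-same (fst j s)))
      (true≢false δ)
  ... | tri< r _ _ = inj₁ (between< j<q s<p d<p t<p js jd jt r δ)
  ... | tri> _ _ r = inj₂ (between< j<q t<p d<p s<p jt jd js r (trans (Bool.xor-comm (fst j t) (fst j s)) δ))

-- None of the forbidden graphs has a chord diagram

xor-exchange : ∀ a a′ r t t′ z → t xor a ≡ t′ xor a′ → (a xor r) xor (t xor z) ≡ (a′ xor r) xor (t′ xor z)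
xor-exchange a a′ r t t′ z eq = trans (regroup a r t z) (trans (cong (_xor (r xor z)) eq) (sym (regroup a′ r t′ z)))
  where
  regroup : ∀ a r t z → (a xor r) xor (t xor z) ≡ (t xor a) xor (r xor z)
  regroup true true true z = refl
  regroup true true false true = refl
  regroup true true false false = refl
  regroup true false true true = refl
  regroup true false true false = refl
  regroup true false false z = refl
  regroup false true true true = refl
  regroup false true true false = refl
  regroup false true false z = refl
  regroup false false true z = refl
  regroup false false false z = refl

module F₀-diagram (M : ℕ → ℕ → Bool) (M≡ : ∀ j t → NF₀ j t ≡ M (toℕ j) (toℕ t)) (D : ChordDiagram 5 3 M) where

  open Sides D

  private
    0<3 : 0 < 3
    0<3 = s≤s z≤n
    1<3 : 1 < 3
    1<3 = s≤s (s≤s z≤n)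
    0<5 : 0 < 5
    0<5 = s≤s z≤n
    1<5 : 1 < 5
    1<5 = s≤s (s≤s z≤n)
    2<5 : 2 < 5
    2<5 = s≤s (s≤s (s≤s z≤n))
    3<5 : 3 < 5
    3<5 = s≤s (s≤s (s≤s (s≤s z≤n)))
    a₁ a₂ a₃ : Fin 3
    a₁ = zero
    a₂ = suc zero
    a₃ = suc (suc zero)
    c₀ c₁ c₂ c₃ c₄ : Fin 5
    c₀ = zero
    c₁ = suc zero
    c₂ = suc (suc zero)
    c₃ = suc (suc (suc zero))
    c₄ = suc (suc (suc (suc zero)))
    m : ∀ j t → M (toℕ j) (toℕ t) ≡ NF₀ j t
    m j t = sym (M≡ j t)

  -- The three links force three bits to be pairwise different.
  impossible : ⊥
  impossible = bits _ _ _
    (link 0<3 1<3 0<5 2<5 ≤-refl (m a₁ c₀) (m a₂ c₀) (m a₁ c₂) (m a₂ c₂) (m a₁ c₄) (m a₂ c₄))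
    (trans (cong (fst 1 0 xor_) (outside-same 1<3 2<5 1<5 (m a₂ c₂) (m a₂ c₁)))
      (link 1<3 ≤-refl 0<5 3<5 1<5 (m a₂ c₀) (m a₃ c₀) (m a₂ c₃) (m a₃ c₃) (m a₂ c₁) (m a₃ c₁)))
    (trans (cong (fst 0 0 xor_) (outside-same 0<3 ≤-refl 1<5 (m a₁ c₄) (m a₁ c₁)))
      (trans (link 0<3 ≤-refl 0<5 2<5 1<5 (m a₁ c₀) (m a₃ c₀) (m a₁ c₂) (m a₃ c₂) (m a₁ c₁) (m a₃ c₁))
        (cong (λ b → not (fst 2 0 xor b)) (outside-same ≤-refl 2<5 3<5 (m a₃ c₂) (m a₃ c₃)))))
    where
    bits : ∀ x y z → x ≡ not y → y ≡ not z → x ≡ not z → ⊥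
    bits true true z ()
    bits true false true _ _ ()
    bits true false false _ () _
    bits false true true _ () _
    bits false true false _ _ ()
    bits false false z ()

module F₂-diagram (k : ℕ) (5≤k : 5 ≤ k) (odd : parity k ≡ true) (M : ℕ → ℕ → Bool)
  (M₀ : ∀ t → M 0 t ≡ (0 <ᵇ t) ∧ (suc t <ᵇ k)) (M₊ : ∀ j t → M (suc j) t ≡ row j t) (D : ChordDiagram k k M) where

  open Sides D

  private
    in₀ : ∀ t → suc (suc t) < k → M 0 (suc t) ≡ true
    in₀ t r = trans (M₀ (suc t)) (<ᵇ-true r)

    0∉ : M 0 0 ≡ false
    0∉ = M₀ 0

    self : ∀ j → M (suc j) j ≡ true
    self j = trans (M₊ j j) (row-self j)

    next : ∀ j → M (suc j) (suc j) ≡ true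
    next j = trans (M₊ j (suc j)) (row-suc j)

    off : ∀ j {t} → t ≢ j → t ≢ suc j → M (suc j) t ≡ false
    off j r s = trans (M₊ j _) (row-false r s)

    <k : ∀ {i} → i ≤ 4 → i < k
    <k r = <-≤-trans (s≤s r) 5≤k

  private
    -- Each bracket asks whether clique chord j starts away from the non-neighbours, of a_(j+1) and
    -- of b respectively. Passing to the next chord, `link` negates the first bracket, and `sign`
    -- moves both to the next common neighbour.
    Alternates : ℕ → Set
    Alternates j = ∀ r → r < k → M (suc j) r ≡ false →
      (fst (suc j) j xor fst (suc j) r) xor (fst 0 j xor fst 0 0) ≡ parity (suc j)

    alternates : ∀ j → suc (suc j) < k → Alternates (suc j)
    alternates zero _ r r<k r∉ =
        trans (cong (_xor τ) (trans (cong (fst 2 1 xor_) (outside-same (<k (s≤s (s≤s z≤n))) r<k (<k z≤n) r∉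
        (off 1 (λ ()) (λ ()))))
        (sym eq))) (Bool.xor-same τ)
      where
      τ = fst 0 1 xor fst 0 0
      eq : τ ≡ fst 2 1 xor fst 2 0
      eq = trans (link (<k z≤n) (<k (s≤s z≤n)) (<k (s≤s z≤n)) (<k (s≤s (s≤s z≤n))) (<k z≤n)
                   (in₀ 0 (<k (s≤s (s≤s z≤n)))) (next 0) (in₀ 1 (<k (s≤s (s≤s (s≤s z≤n))))) (off 0 (λ ()) (λ ())) 0∉
                       (self 0))
           (trans (cong not (link (<k (s≤s z≤n)) (<k (s≤s (s≤s z≤n))) (<k (s≤s z≤n)) (<k z≤n) (<k (s≤s (s≤s z≤n)))
                   (next 0) (self 1) (self 0) (off 1 (λ ()) (λ ())) (off 0 (λ ()) (λ ())) (next 1)))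
             (Bool.not-involutive _))
    alternates (suc j) j< r r<k r∉ = trans
      (cong (_xor (fst 0 (2 + j) xor fst 0 0))
          (trans (cong (fst (3 + j) (2 + j) xor_) (outside-same 3+j< r<k 1+j< r∉
          (off (2 + j) (<⇒≢ ≤-refl) (<⇒≢ (s≤s (n≤1+n _))))))
        (trans (sym (Bool.not-involutive _))
            (cong not (sym (link 2+j< 3+j< 2+j< 1+j< 3+j< (next (1 + j)) (self (2 + j)) (self (1 + j))
          (off (2 + j) (<⇒≢ ≤-refl) (<⇒≢ (s≤s (n≤1+n _)))) (off (1 + j) (>⇒≢ (s≤s (n≤1+n _))) (>⇒≢ ≤-refl))
              (next (2 + j))))))))
      (trans (sym (Bool.not-distribˡ-xor (fst (2 + j) (2 + j) xor fst (2 + j) (3 + j)) _))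
        (cong not (trans (xor-exchange (fst (2 + j) (2 + j)) (fst (2 + j) (1 + j)) (fst (2 + j) (3 + j))
            (fst 0 (2 + j)) (fst 0 (1 + j)) (fst 0 0)
            (sign (<k z≤n) 2+j< (λ ()) 2+j< 1+j< (in₀ (1 + j) j<) (next (1 + j)) (in₀ j 2+j<) (self (1 + j))))
          (alternates j 2+j< (3 + j) 3+j< (off (1 + j) (>⇒≢ (s≤s (n≤1+n _))) (>⇒≢ ≤-refl))))))
      where
      3+j< : 3 + j < k
      3+j< = j<
      2+j< : 2 + j < k
      2+j< = <-trans ≤-refl j<
      1+j< : 1 + j < k
      1+j< = <-trans ≤-refl 2+j<

  -- The last clique vertex is no neighbour of b, so b can be linked directly with the last chord.
  -- Then the two brackets differ, and k - 1 would be odd.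
  impossible : ⊥
  impossible = go (k ∸ 3) (trans (+-comm 3 (k ∸ 3)) (m∸n+n≡m (≤-trans (s≤s (s≤s (s≤s z≤n))) 5≤k)))
    where
    go : ∀ l → 3 + l ≡ k → ⊥
    go zero eq = <⇒≢ (≤-trans (s≤s (s≤s (s≤s (s≤s z≤n)))) 5≤k) eq
    go (suc l) eq = true≢false (trans (cong parity eq) odd)
      (trans (cong not (sym (alternates (suc l) L< 0 (<k z≤n) (off (2 + l) (λ ()) (λ ())))))
        (trans (cong (λ b → not ((fst (3 + l) (2 + l) xor b) xor (fst 0 (2 + l) xor fst 0 0)))
            (outside-same L< (<k z≤n) (<k (s≤s z≤n)) (off (2 + l) (λ ()) (λ ())) 1∉))
        (trans (cong (λ b → not ((fst (3 + l) (2 + l) xor fst (3 + l) 1) xor b)) τ≡)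
            (bit (fst (3 + l) (2 + l) xor fst (3 + l) 1)))))
      where
      L< : 3 + l < k
      L< = ≤-reflexive eq
      1∉ : M (3 + l) 1 ≡ false
      1∉ = off (2 + l) (λ ()) (λ ())
      l∉ : M 0 (3 + l) ≡ false
      l∉ = trans (M₀ (3 + l)) (<ᵇ-false (≤-reflexive (sym eq)))
      τ≡ : fst 0 (2 + l) xor fst 0 0 ≡ not (fst (3 + l) (2 + l) xor fst (3 + l) 1)
      τ≡ = trans (cong (fst 0 (2 + l) xor_) (outside-same (<k z≤n) (<k z≤n) L< 0∉ l∉))
        (link (<k z≤n) L< (<-trans ≤-refl L<) (<k (s≤s z≤n)) L< (in₀ (1 + l) L<) (self (2 + l))
            (in₀ 0 (<k (s≤s (s≤s z≤n)))) 1∉ l∉ (next (2 + l)))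
      bit : ∀ b → not (b xor not b) ≡ false
      bit true = refl
      bit false = refl

-- the graph F₁ k with k = l + 2
module F₁-diagram (l : ℕ) (3≤l : 3 ≤ l) (odd : parity l ≡ true) (M : ℕ → ℕ → Bool)
  (M₀ : ∀ t → M 0 t ≡ (t <ᵇ l)) (M₁ : ∀ t → M 1 t ≡ not (t ≡ᵇ 0)) (M₊ : ∀ j t → M (2 + j) t ≡ row j t)
  (D : ChordDiagram (1 + l) (2 + l) M) where

  open Sides D

  private
    in₀ : ∀ {t} → t < l → M 0 t ≡ true
    in₀ r = trans (M₀ _) (<ᵇ-true r)

    l∉ : M 0 l ≡ false
    l∉ = trans (M₀ l) (<ᵇ-false {l} ≤-refl)

    self : ∀ j → M (2 + j) j ≡ true
    self j = trans (M₊ j j) (row-self j)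

    next : ∀ j → M (2 + j) (suc j) ≡ true
    next j = trans (M₊ j (suc j)) (row-suc j)

    off : ∀ j {t} → t ≢ j → t ≢ suc j → M (2 + j) t ≡ false
    off j r s = trans (M₊ j _) (row-false r s)

    before : ∀ j → M (3 + j) j ≡ false
    before j = off (suc j) (<⇒≢ ≤-refl) (<⇒≢ (s≤s (n≤1+n j)))

    after : ∀ j → M (2 + j) (2 + j) ≡ false
    after j = off j (>⇒≢ (s≤s (n≤1+n j))) (>⇒≢ ≤-refl)

    p< : ∀ {t} → t ≤ l → t < 1 + l
    p< = s≤s

    q< : ∀ {j} → j ≤ l → j < 2 + l
    q< r = s≤s (m≤n⇒m≤1+n r)

    0≤l : 0 ≤ l
    0≤l = z≤n
    1≤l : 1 ≤ l
    1≤l = ≤-trans (s≤s z≤n) 3≤l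
    2≤l : 2 ≤ l
    2≤l = ≤-trans (s≤s (s≤s z≤n)) 3≤l

    -- As for F₂, with b₁ in the role of b and its only non-neighbour l as reference. The induction
    -- starts by passing from b₁ through b₂ to the chord a₁.
    Alternates : ℕ → Set
    Alternates j = ∀ r → r ≤ l → M (2 + j) r ≡ false →
      (fst (2 + j) (1 + j) xor fst (2 + j) r) xor (fst 0 (1 + j) xor fst 0 l) ≡ parity j

    alternates : ∀ j → 2 + j ≤ l → Alternates j
    alternates zero _ r r≤l r∉ =
        trans (cong (_xor τ) (trans (cong (fst 2 1 xor_) (outside-same (q< 2≤l) (p< r≤l) (p< 2≤l) r∉ (after 0)))
        (sym eq)))
        (Bool.xor-same τ)
      where
      τ = fst 0 1 xor fst 0 l
      l≢0 : (l ≡ᵇ 0) ≡ false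
      l≢0 = ≡ᵇ-false (>⇒≢ 1≤l)
      eq : τ ≡ fst 2 1 xor fst 2 2
      eq = trans (link (q< 0≤l) (q< 1≤l) (p< 1≤l) (p< 0≤l) (p< ≤-refl) (in₀ 2≤l) (M₁ 1) (in₀ 1≤l) (M₁ 0) l∉
          (trans (M₁ l) (cong not l≢0)))
        (trans (cong not (link (q< 1≤l) (q< 2≤l) (p< 1≤l) (p< 2≤l) (p< 0≤l) (M₁ 1) (next 0) (M₁ 2) (after 0) (M₁ 0)
            (self 0)))
          (Bool.not-involutive _))
    alternates (suc j) j< r r≤l r∉ = trans
      (cong (_xor τ′) (cong (fst (3 + j) (2 + j) xor_) (outside-same 3+j (p< r≤l) (p< j≤) r∉ (before j))))
      (trans (sym (xor-exchange (fst (3 + j) (1 + j)) (fst (3 + j) (2 + j)) (fst (3 + j) j) (fst 0 (1 + j))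
          (fst 0 (2 + j)) (fst 0 l)
          (sign (q< 0≤l) 3+j (λ ()) (p< 1+j≤) (p< 2+j≤) (in₀ 2+j≤) (self (1 + j)) (in₀ j<) (next (1 + j)))))
        (trans (cong (_xor τ) (trans (sym (Bool.not-involutive _)) (cong not (sym
            (link 2+j 3+j (p< 1+j≤) (p< j≤) (p< 2+j≤) (next j) (self (1 + j)) (self j) (before j) (after j)
                (next (1 + j)))))))
          (trans (sym (Bool.not-distribˡ-xor (fst (2 + j) (1 + j) xor fst (2 + j) (2 + j)) τ))
            (cong not (alternates j 2+j≤ (2 + j) 2+j≤ (after j))))))
      where
      τ τ′ : Bool
      τ = fst 0 (1 + j) xor fst 0 l
      τ′ = fst 0 (2 + j) xor fst 0 l
      2+j≤ : 2 + j ≤ l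
      2+j≤ = <⇒≤ j<
      1+j≤ : 1 + j ≤ l
      1+j≤ = <⇒≤ 2+j≤
      j≤ : j ≤ l
      j≤ = <⇒≤ 1+j≤
      2+j : 2 + j < 2 + l
      2+j = q< 2+j≤
      3+j : 3 + j < 2 + l
      3+j = q< j<

  -- The last chord is linked with its predecessor and with b₁. The two negations cancel, so the
  -- brackets of the predecessor and of b₁ agree, and l - 2 would be even.
  impossible : ⊥
  impossible = go (l ∸ 3) (trans (+-comm 3 (l ∸ 3)) (m∸n+n≡m 3≤l))
    where
    go : ∀ i → 3 + i ≡ l → ⊥
    go i eq = true≢false (trans (trans (sym (Bool.not-involutive _)) (cong parity eq)) odd)
      (trans (sym (alternates (suc i) L≤ (3 + i) L≤ (after (1 + i)))) (trans (cong (_xor τ) W≡τ) (Bool.xor-same τ)))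
      where
      L≤ : 3 + i ≤ l
      L≤ = ≤-reflexive eq
      i≤ : 1 + i ≤ l
      i≤ = ≤-trans (n≤1+n _) (≤-trans (n≤1+n _) L≤)
      τ = fst 0 (2 + i) xor fst 0 l
      last∉ : M 0 (3 + i) ≡ false
      last∉ = subst (λ t → M 0 t ≡ false) (sym eq) l∉
      4+i : 4 + i < 2 + l
      4+i = s≤s (s≤s L≤)
      W≡τ : fst (3 + i) (2 + i) xor fst (3 + i) (3 + i) ≡ τ
      W≡τ = trans (link (q< L≤) 4+i (p< (<⇒≤ L≤)) (p< i≤) (p< L≤) (next (1 + i)) (self (2 + i)) (self (1 + i))
          (before (1 + i)) (after (1 + i)) (next (2 + i)))
        (trans (cong (λ b → not (fst (4 + i) (2 + i) xor b)) (outside-same 4+i (p< i≤) (p< 0≤l) (before (1 + i))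
            (off (2 + i) (λ ()) (λ ()))))
        (trans (sym (link (q< 0≤l) 4+i (p< (<⇒≤ L≤)) (p< 0≤l) (p< L≤) (in₀ L≤) (self (2 + i)) (in₀ 1≤l)
            (off (2 + i) (λ ()) (λ ())) last∉ (next (2 + i))))
          (cong (λ t → fst 0 (2 + i) xor fst 0 t) eq)))

module Sun-diagram (k : ℕ) (4≤k : 4 ≤ k) (even : parity k ≡ false) (M : ℕ → ℕ → Bool)
  (M≡ : ∀ j t → M j t ≡ (t ≡ᵇ j) ∨ (t ≡ᵇ suc j) ∨ ((t ≡ᵇ 0) ∧ (suc j ≡ᵇ k))) (D : ChordDiagram k k M) where

  open Sides D
  open ChordDiagram D using (c)

  private
    instance
      k≢0 : NonZero k
      k≢0 = >-nonZero (≤-trans (s≤s z≤n) 4≤k)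

    X : ℕ → ℕ → Bool
    X i t = fst (i % k) (t % k)

    F : ℕ → ℕ
    F t = c (t % k) 0

    A : ℕ → ℕ → Bool
    A i t = M (i % k) (t % k)

    <k : ∀ i → i % k < k
    <k i = m%n<n i k

    reduce : ∀ i d → (i + d) % k ≡ (i % k + d) % k
    reduce i d = trans (cong (λ z → (z + d) % k) (m≡m%n+[m/n]*n i k))
      (trans (cong (_% k) (lia 3 (λ a q d → [] ⊢ a :+ q :+ d :≡ a :+ d :+ q) (i % k) (i / k * k) d))
          ([m+kn]%n≡m%n (i % k + d) (i / k) k))

    wrap : ∀ i d → d ≤ k → k ≤ i % k + d → (i + d) % k ≡ i % k + d ∸ k
    wrap i d d≤k p = trans (reduce i d) (trans (cong (_% k) (sym (m∸n+n≡m p))) (trans ([m+n]%n≡m%n (i % k + d ∸ k) k)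
      (m<n⇒m%n≡m (lia 4 (λ a d k z → z :+ k :≡ a :+ d ∷ a :< k ∷ d :≤ k ∷ [] ⊢ z :< k) (i % k) d k (i % k + d ∸ k)
          (m∸n+n≡m p) (<k i) d≤k))))

    nowrap : ∀ i d → i % k + d < k → (i + d) % k ≡ i % k + d
    nowrap i d p = trans (reduce i d) (m<n⇒m%n≡m p)

    here∈ : ∀ i → A i i ≡ true
    here∈ i rewrite M≡ (i % k) (i % k) | ≡ᵇ-true {i % k} refl = refl

    next∈ : ∀ i → A i (suc i) ≡ true
    next∈ i rewrite +-comm 1 i with i % k + 1 ℕ.<? k
    ... | yes p rewrite nowrap i 1 p | M≡ (i % k) (i % k + 1) | +-comm (i % k) 1 | ≡ᵇ-true {suc (i % k)} refl =
        Bool.∨-zeroʳ _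
    ... | no ¬p = subst (λ z → M (i % k) z ≡ true)
        (sym (trans (wrap i 1 (≤-trans (s≤s z≤n) 4≤k) (≮⇒≥ ¬p)) (m≤n⇒m∸n≡0 (≤-reflexive last)))) edge
      where
      last : i % k + 1 ≡ k
      last = ≤-antisym (subst (_≤ k) (+-comm 1 (i % k)) (<k i)) (≮⇒≥ ¬p)
      edge : M (i % k) 0 ≡ true
      edge rewrite M≡ (i % k) 0 | ≡ᵇ-true (trans (+-comm 1 (i % k)) last) = Bool.∨-zeroʳ _

    M-off : ∀ {j t} → t ≢ j → t ≢ suc j → ¬ (t ≡ 0 × suc j ≡ k) → M j t ≡ false
    M-off {j} {zero} r s u rewrite M≡ j 0 | ≡ᵇ-false r | ≡ᵇ-false (λ eq → u (refl , eq)) = refl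
    M-off {j} {suc t} r s u rewrite M≡ j (suc t) | ≡ᵇ-false r | ≡ᵇ-false s = refl

    far∉ : ∀ i d → 2 ≤ d → d < k → A i (i + d) ≡ false
    far∉ i d 2≤d d<k with i % k + d ℕ.<? k
    ... | yes p rewrite nowrap i d p = M-off
        (λ eq → lia 2 (λ a d → a :+ d :≡ a ∷ con 2 :≤ d ∷ [] ⊢ :⊥) (i % k) d eq 2≤d)
        (λ eq → lia 2 (λ a d → a :+ d :≡ con 1 :+ a ∷ con 2 :≤ d ∷ [] ⊢ :⊥) (i % k) d eq 2≤d)
        (λ (eq , _) → lia 2 (λ a d → a :+ d :≡ con 0 ∷ con 2 :≤ d ∷ [] ⊢ :⊥) (i % k) d eq 2≤d)
    ... | no ¬p rewrite wrap i d (<⇒≤ d<k) (≮⇒≥ ¬p) = M-off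
        (λ eq → lia 4 (λ a d k z → z :+ k :≡ a :+ d ∷ z :≡ a ∷ d :< k ∷ [] ⊢ :⊥) (i % k) d k z z≡ eq d<k)
        (λ eq → lia 4 (λ a d k z → z :+ k :≡ a :+ d ∷ z :≡ con 1 :+ a ∷ d :< k ∷ [] ⊢ :⊥) (i % k) d k z z≡ eq d<k)
        (λ (eq , last) → lia 4 (λ a d k z → z :+ k :≡ a :+ d ∷ z :≡ con 0 ∷ con 1 :+ a :≡ k ∷ con 2 :≤ d ∷ [] ⊢ :⊥)
            (i % k) d k z z≡ eq last 2≤d)
      where
      z = i % k + d ∸ k
      z≡ : z + k ≡ i % k + d
      z≡ = m∸n+n≡m (≮⇒≥ ¬p)

    A-periodʳ : ∀ i t → A i (t + k) ≡ A i t
    A-periodʳ i t = cong (M (i % k)) ([m+n]%n≡m%n t k)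

    -- i ≡ i + 1 + (k − 1)
    prev∉ : ∀ i → A (suc i) i ≡ false
    prev∉ i = trans (sym (A-periodʳ (suc i) i))
        (trans (cong (A (suc i)) (lia 3 (λ i k l → l :+ con 1 :≡ k ∷ [] ⊢ i :+ k :≡ con 1 :+ i :+ l) i k (k ∸ 1)
        (m∸n+n≡m (≤-trans (s≤s z≤n) 4≤k))))
      (far∉ (suc i) (k ∸ 1) (m+n≤o⇒m≤o∸n 2 (≤-trans (s≤s (s≤s (s≤s z≤n))) 4≤k)) (∸-monoʳ-< {o = 0} (s≤s z≤n)
          (≤-trans (s≤s z≤n) 4≤k))))

    next∉ : ∀ i → A i (2 + i) ≡ false
    next∉ i = trans (cong (A i) (+-comm 2 i)) (far∉ i 2 ≤-refl (≤-trans (s≤s (s≤s (s≤s z≤n))) 4≤k))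

    -- `δ i`: the two neighbours of chord i start on different sides of it. `h i`: the first
    -- neighbour starts away from the non-neighbours.
    δ h : ℕ → Bool
    δ i = X i i xor X i (suc i)
    h i = X i i xor X i (2 + i)

    -- The `link` of chords i and i + 1 at their common neighbour. Summed around the cycle the
    -- right-hand sides telescope, so `δ` is false an even number of times.
    transfer : ∀ i → not (δ i) ≡ h i xor h (suc i)
    transfer i = trans (bit (X i i) (X i (suc i)) (X i (2 + i))) (cong (h i xor_) (trans (cong not
        (trans (link (<k i) (<k (suc i)) (<k (suc i)) (<k i) (<k (2 + i)) (next∈ i) (here∈ (suc i)) (here∈ i)
            (prev∉ i) (next∉ i) (next∈ (suc i)))
          (cong (λ b → not (X (suc i) (suc i) xor b)) (outside-same (<k (suc i)) (<k i) (<k (3 + i)) (prev∉ i)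
              (next∉ (suc i))))))
        (Bool.not-involutive _)))
      where
      bit : ∀ a b c → not (a xor b) ≡ (a xor c) xor not (b xor c)
      bit true true true = refl
      bit true true false = refl
      bit true false true = refl
      bit true false false = refl
      bit false true true = refl
      bit false true false = refl
      bit false false true = refl
      bit false false false = refl

    X-period : ∀ i t → X (i + k) (t + k) ≡ X i t
    X-period i t = cong₂ fst ([m+n]%n≡m%n i k) ([m+n]%n≡m%n t k)

    h-period : ∀ i → h (i + k) ≡ h i
    h-period i = cong₂ _xor_ (X-period i i) (X-period i (2 + i))

    δ-period : ∀ i → δ (i + k) ≡ δ i
    δ-period i = cong₂ _xor_ (X-period i i) (X-period i (suc i))

    telescope : ∀ i d → σ (not ∘ δ) i d ≡ h i xor h (i + d)
    telescope i zero = trans (sym (Bool.xor-same (h i))) (cong (λ j → h i xor h j) (sym (+-identityʳ i)))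
    telescope i (suc d) = trans (cong₂ _xor_ (transfer i) (telescope (suc i) d))
      (trans (bit (h i) (h (suc i)) (h (suc i + d))) (cong (λ j → h i xor h j) (sym (+-suc i d))))
      where
      bit : ∀ a b c → (a xor b) xor (b xor c) ≡ a xor c
      bit a b c = trans (Bool.xor-assoc a b (b xor c))
          (cong (a xor_) (trans (sym (Bool.xor-assoc b b c)) (cong (_xor c) (Bool.xor-same b))))

    F-injective : ∀ {s t} → F s ≡ F t → s % k ≡ t % k
    F-injective {s} {t} = fst-injective (<k s) (<k t)

    argmax : ∀ n → ∃ λ t → ∀ s → s ≤ n → F s ≤ F t
    argmax zero = 0 , λ { .0 z≤n → ≤-refl }
    argmax (suc n) with argmax n
    ... | t , best with F (suc n) ℕ.≤? F t
    ...   | yes p = t , λ s s≤ → case m≤n⇒m<n∨m≡n s≤ of λ { (inj₁ (s≤s q)) → best s q ; (inj₂ refl) → p }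
    ...   | no ¬p = suc n , λ s s≤ → case m≤n⇒m<n∨m≡n s≤ of λ
            { (inj₁ (s≤s q)) → ≤-trans (best s q) (<⇒≤ (≰⇒> ¬p)) ; (inj₂ refl) → ≤-refl }

    -- Next to the clique chord that starts last, one of the two arcs meets the cut of the circle.
    exists : ∃ λ i → δ i ≡ true
    exists with argmax k
    ... | t , best = go (<-cmp (F i₀) (F (2 + i₀)))
      where
      i₀ = t + (k ∸ 1)
      1≤k : 1 ≤ k
      1≤k = ≤-trans (s≤s z≤n) 4≤k
      top : F (suc i₀) ≡ F t
      top = cong (λ z → c z 0) (trans (cong (_% k) (trans (sym (+-suc t (k ∸ 1))) (cong (t +_) (m+[n∸m]≡n 1≤k))))
          ([m+n]%n≡m%n t k))
      F≤ : ∀ s → F s ≤ F (suc i₀)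
      F≤ s = subst₂ _≤_ (cong (λ z → c z 0) (m<n⇒m%n≡m (<k s) )) (sym top) (best (s % k) (<⇒≤ (<k s)))
      strict : ∀ {s} → s % k ≢ suc i₀ % k → F s < F (suc i₀)
      strict {s} ne = ≤∧≢⇒< (F≤ s) (ne ∘ F-injective {s} {suc i₀})
      ∈≢∉ : ∀ {i s t} → A i s ≡ true → A i t ≡ false → s % k ≢ t % k
      ∈≢∉ {i} p q eq = true≢false (subst (λ z → M (i % k) z ≡ true) eq p) q
      before : F i₀ < F (suc i₀)
      before = strict λ eq → ∈≢∉ {suc i₀} {suc i₀} {i₀} (here∈ (suc i₀)) (prev∉ i₀) (sym eq)
      after : F (2 + i₀) < F (suc i₀)
      after = strict λ eq → ∈≢∉ {i₀} {suc i₀} {2 + i₀} (next∈ i₀) (next∉ i₀) (sym eq)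
      go : Tri (F i₀ < F (2 + i₀)) (F i₀ ≡ F (2 + i₀)) (F (2 + i₀) < F i₀) → ∃ λ i → δ i ≡ true
      go (tri≈ _ eq _) = contradiction (F-injective {i₀} {2 + i₀} eq) (∈≢∉ {i₀} (here∈ i₀) (next∉ i₀))
      go (tri< r _ _) = i₀ , separated (<k i₀) (<k i₀) (<k (2 + i₀)) (<k (suc i₀)) (here∈ i₀) (next∉ i₀) (next∈ i₀) r
          after
      go (tri> _ _ r) = suc i₀ , trans (Bool.xor-comm (X (suc i₀) (suc i₀)) _)
        (separated (<k (suc i₀)) (<k (2 + i₀)) (<k i₀) (<k (suc i₀)) (next∈ (suc i₀)) (prev∉ i₀) (here∈ (suc i₀)) r
            before)

    spread : ∀ i d → δ i ≡ true → A i d ≡ false → Between (F i) (F d) (F (suc i))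
    spread i d p q = between (<k i) (<k i) (<k d) (<k (suc i)) (here∈ i) q (next∈ i) p

    ¬consecutive : ∀ i → δ i ≡ true → ¬ δ (suc i) ≡ true
    ¬consecutive i p q with spread i (2 + i) p (next∉ i) | spread (suc i) i q (prev∉ i)
    ... | inj₁ (r , s) | inj₁ (u , v) = <-asym (<-trans r s) u
    ... | inj₁ (r , s) | inj₂ (u , v) = <-asym r u
    ... | inj₂ (r , s) | inj₁ (u , v) = <-asym s v
    ... | inj₂ (r , s) | inj₂ (u , v) = <-asym (<-trans r s) v

    ¬crossed : ∀ {a b c d} → Between a c b → Between a d b → Between c a d → ¬ Between c b d
    ¬crossed (inj₁ (r , s)) (inj₁ (u , v)) (inj₁ (x , y)) _ = <-asym r x
    ¬crossed (inj₁ (r , s)) (inj₁ (u , v)) (inj₂ (x , y)) _ = <-asym u x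
    ¬crossed (inj₁ (r , s)) (inj₂ (u , v)) _ _ = <-asym (<-trans r s) (<-trans u v)
    ¬crossed (inj₂ (r , s)) (inj₁ (u , v)) _ _ = <-asym (<-trans r s) (<-trans u v)
    ¬crossed (inj₂ (r , s)) (inj₂ (u , v)) (inj₁ (x , y)) _ = <-asym v y
    ¬crossed (inj₂ (r , s)) (inj₂ (u , v)) (inj₂ (x , y)) _ = <-asym s y

    -- By `spread`, a pair with `δ` true encloses all other clique vertices in the order of first
    -- ends. Two different pairs cannot enclose each other.
    unique : ∀ i t → 1 ≤ t → t < k → δ i ≡ true → ¬ δ (i + t) ≡ true
    unique i (suc zero) _ _ p q = ¬consecutive i p (subst (λ j → δ j ≡ true) (+-comm i 1) q)
    unique i t@(suc (suc t′)) _ t<k p q with m≤n⇒m<n∨m≡n t<k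
    ... | inj₂ eq = ¬consecutive (i + t) q (trans (cong δ (trans (sym (+-suc i t)) (cong (i +_) eq)))
        (trans (δ-period i) p))
    ... | inj₁ t+1<k = ¬crossed {F i} {F (suc i)} {F (i + t)} {F (suc (i + t))}
        (spread i (i + t) p (far∉ i t (s≤s (s≤s z≤n)) t<k))
        (spread i (suc (i + t)) p (trans (cong (A i) (sym (+-suc i t))) (far∉ i (suc t) (s≤s (s≤s z≤n)) t+1<k)))
        (spread (i + t) i q (nonadjacent i (k ∸ t) (lia 3 (λ i t l → [] ⊢ i :+ (t :+ l) :≡ i :+ t :+ l) i t (k ∸ t))
            2≤k∸t (<-trans ≤-refl shorter)))
        (spread (i + t) (suc i) q (nonadjacent (suc i) (suc (k ∸ t))
          (lia 3 (λ i t l → [] ⊢ con 1 :+ i :+ (t :+ l) :≡ i :+ t :+ (con 1 :+ l)) i t (k ∸ t)) (m≤n⇒m≤1+n 2≤k∸t)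
              shorter))
      where
      k≡ : t + (k ∸ t) ≡ k
      k≡ = m+[n∸m]≡n (<⇒≤ t<k)
      2≤k∸t : 2 ≤ k ∸ t
      2≤k∸t = m+n≤o⇒m≤o∸n 2 t+1<k
      shorter : suc (k ∸ t) < k
      shorter = lia 3 (λ t l k → con 2 :+ t :+ l :≡ k ∷ [] ⊢ con 1 :+ l :< k) t′ (k ∸ t) k k≡
      nonadjacent : ∀ j d → j + (t + (k ∸ t)) ≡ i + t + d → 2 ≤ d → d < k → A (i + t) j ≡ false
      nonadjacent j d eq 2≤d d<k = trans (sym (A-periodʳ (i + t) j)) (trans (cong (λ z → A (i + t) (j + z)) (sym k≡))
        (trans (cong (A (i + t)) eq) (far∉ (i + t) d 2≤d d<k)))

  -- `δ` is true exactly once per period and false an even number of times, so k - 1 would be even.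
  impossible : ⊥
  impossible with exists
  ... | i , p = true≢false (trans (cong parity (sym 1+[k-1])) (cong not (sym window))) even
    where
    1+[k-1] : suc (k ∸ 1) ≡ k
    1+[k-1] = m+[n∸m]≡n (≤-trans (s≤s z≤n) 4≤k)
    closed : σ (not ∘ δ) i k ≡ false
    closed = trans (telescope i k) (trans (cong (h i xor_) (h-period i)) (Bool.xor-same (h i)))
    rest : ∀ t → t < k ∸ 1 → not (δ (suc i + t)) ≡ true
    rest t t< = cong not (¬true λ q → unique i (suc t) (s≤s z≤n) (subst (suc t <_) 1+[k-1] (s≤s t<)) p
      (subst (λ j → δ j ≡ true) (sym (+-suc i t)) q))
    window : false ≡ parity (k ∸ 1)
    window = trans (sym closed) (trans (cong (σ (not ∘ δ) i) (sym 1+[k-1]))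
      (trans (cong (λ b → not b xor σ (not ∘ δ) (suc i) (k ∸ 1)) p) (σ-true (not ∘ δ) (suc i) (k ∸ 1) rest)))

-- Induced subgraphs of a represented graph, and the conclusion

-- Reduction modulo n makes the map total on ℕ, as the indices of a chord diagram require; below n
-- it is the inverse of `toℕ`.
index : ∀ {n} → 0 < n → ℕ → Fin n
index {suc n} _ t = fromℕ< (m%n<n t (suc n))

toℕ-index : ∀ {n} (h : 0 < n) {t} → t < n → toℕ (index h t) ≡ t
toℕ-index {suc n} _ {t} t<n = trans (toℕ-fromℕ< (m%n<n t (suc n))) (m<n⇒m%n≡m t<n)

index-toℕ : ∀ {n} (h : 0 < n) (i : Fin n) → index h (toℕ i) ≡ i
index-toℕ h i = toℕ-injective (toℕ-index h (toℕ<n i))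

cliqueAdj-≢ : ∀ {p} {i j : Fin p} → i ≢ j → cliqueAdj i j ≡ true
cliqueAdj-≢ {i = i} {j} i≢j with i ≟ j
... | yes eq = contradiction eq i≢j
... | no _ = refl

module Represented (G : Graph) (w : Word (n G)) (rep : Represents G w)
  (p q : ℕ) (M : Fin q → Fin p → Bool) (sub : InducedSub (splitGraph p q M) G) where

  private
    emb : Fin (p + q) → Fin (n G)
    emb = proj₁ sub

    v : Fin p → Fin (n G)
    v i = emb (i ↑ˡ q)

    x : Fin q → Fin (n G)
    x j = emb (p ↑ʳ j)

    v-inj : ∀ {i i′} → v i ≡ v i′ → i ≡ i′
    v-inj eq = ↑ˡ-injective q _ _ (proj₁ (proj₂ sub) _ _ eq)

    x-inj : ∀ {j j′} → x j ≡ x j′ → j ≡ j′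
    x-inj eq = ↑ʳ-injective p _ _ (proj₁ (proj₂ sub) _ _ eq)

    adj-vv : ∀ i i′ → adj G (v i) (v i′) ≡ cliqueAdj i i′
    adj-vv i i′ = trans (proj₂ (proj₂ sub) _ _) eq
      where
      eq : splitAdj p q M (i ↑ˡ q) (i′ ↑ˡ q) ≡ cliqueAdj i i′
      eq rewrite splitAt-↑ˡ p i q | splitAt-↑ˡ p i′ q = refl

    adj-xv : ∀ j i → adj G (x j) (v i) ≡ M j i
    adj-xv j i = trans (proj₂ (proj₂ sub) _ _) eq
      where
      eq : splitAdj p q M (p ↑ʳ j) (i ↑ˡ q) ≡ M j i
      eq rewrite splitAt-↑ʳ p q j | splitAt-↑ˡ p i q = refl

    adj-xx : ∀ j j′ → adj G (x j) (x j′) ≡ false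
    adj-xx j j′ = trans (proj₂ (proj₂ sub) _ _) eq
      where
      eq : splitAdj p q M (p ↑ʳ j) (p ↑ʳ j′) ≡ false
      eq rewrite splitAt-↑ʳ p q j | splitAt-↑ʳ p q j′ = refl

    x≢v : ∀ {j i} → x j ≢ v i
    x≢v {j} {i} eq with () ← trans (sym (splitAt-↑ʳ p q j))
      (trans (cong (splitAt p) (proj₁ (proj₂ sub) _ _ eq)) (splitAt-↑ˡ p i q))

  -- When every letter occurs once, any two letters alternate, but two vertices of the independent
  -- set are not adjacent.
  ¬1-uniform : 2 ≤ q → ¬ Uniform 1 w
  ¬1-uniform 2≤q uni = case <-cmp (time a 0) (time b 0) of λ
    { (tri< r _ _) → clash (inj₁ (first r)) ; (tri> _ _ r) → clash (inj₂ (first r))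
    ; (tri≈ _ r _) → a≢b (apart 0 0 ≤-refl ≤-refl r) }
    where
    open Timing (timing w 1 uni)
    0<q : 0 < q
    0<q = ≤-trans (s≤s z≤n) 2≤q
    a b : Fin (n G)
    a = x (index 0<q 0)
    b = x (index 0<q 1)
    a≢b : a ≢ b
    a≢b eq with () ← trans (sym (toℕ-index 0<q 0<q)) (trans (cong toℕ (x-inj eq)) (toℕ-index 0<q 2≤q))
    first : ∀ {u v : ℕ → ℕ} → u 0 < v 0 → Interleave 1 u v
    first r = (λ { 0 _ → r ; (suc _) (s≤s ()) }) , λ { i (s≤s ()) }
    clash : Interleave 1 (time a) (time b) ⊎ Interleave 1 (time b) (time a) → ⊥
    clash s = true≢false (from (rep a b a≢b) (from (alternate a b a≢b) s)) (adj-xx _ _)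

  chordDiagram : 0 < p → 0 < q → Uniform 2 w → (M′ : ℕ → ℕ → Bool) → (∀ j t → M j t ≡ M′ (toℕ j) (toℕ t)) →
    ChordDiagram p q M′
  chordDiagram 0<p 0<q uni M′ M≡ = record
    { c = λ t → time (v (ip t)) ; a = λ j → time (x (iq j))
    ; c< = λ _ → incr _ 0 1 (s≤s z≤n) ≤-refl
    ; a< = λ _ → incr _ 0 1 (s≤s z≤n) ≤-refl
    ; clique = λ s<p t<p s≢t → let ne = λ eq → s≢t (trans (sym (toℕ-index 0<p s<p)) (trans (cong toℕ eq) (toℕ-index 0<p t<p))) in
        to (cross⇔ (ne ∘ v-inj)) (trans (adj-vv _ _) (cliqueAdj-≢ ne))
    ; indep = λ i<q j<q i≢j s → true≢false (from (cross⇔ (x≢x i<q j<q i≢j)) (inj₁ s)) (adj-xx _ _)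
    ; crosses = λ {j} {t} j<q t<p → subst (λ b → (b ≡ true) ⇔ (Cross (time (x (iq j))) (time (v (ip t))) ⊎ Cross
        (time (v (ip t))) (time (x (iq j)))))
        (trans (adj-xv (iq j) (ip t)) (trans (M≡ (iq j) (ip t)) (cong₂ M′ (toℕ-index 0<q j<q) (toℕ-index 0<p t<p))))
            (cross⇔ x≢v)
    ; ends≢ = λ i i′ i< i′< _ _ eq → x≢v (apart i i′ i< i′< eq)
    ; ends≢′ = λ i i′ i< i′< j<q j′<q j≢j′ eq → x≢x j<q j′<q j≢j′ (apart i i′ i< i′< eq) }
    where
    open Timing (timing w 2 uni)
    ip : ℕ → Fin p
    ip = index 0<p
    iq : ℕ → Fin q
    iq = index 0<q
    x≢x : ∀ {i j} → i < q → j < q → i ≢ j → x (iq i) ≢ x (iq j)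
    x≢x i<q j<q i≢j eq = i≢j (trans (sym (toℕ-index 0<q i<q)) (trans (cong toℕ (x-inj eq)) (toℕ-index 0<q j<q)))
    cross : ∀ {a b} → Interleave 2 (time a) (time b) ⇔ Cross (time a) (time b)
    cross = mk⇔ (λ (r , s) → r 0 (s≤s z≤n) , s 0 ≤-refl , r 1 ≤-refl)
      (λ (r , s , t) → (λ { 0 _ → r ; 1 _ → t ; (suc (suc _)) (s≤s (s≤s ())) }) ,
          λ { 0 _ → s ; (suc _) (s≤s (s≤s ())) })
    cross⇔ : ∀ {a b} → a ≢ b → (adj G a b ≡ true) ⇔ (Cross (time a) (time b) ⊎ Cross (time b) (time a))
    cross⇔ {a} {b} a≢b = rep a b a≢b ⇔∘ alternate a b a≢b ⇔∘
      mk⇔ (Sum.map (to (cross {a} {b})) (to (cross {b} {a}))) (Sum.map (from (cross {a} {b})) (from (cross {b} {a})))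

parity-suc-2* : ∀ m → parity (suc (2 * m)) ≡ true
parity-suc-2* m = cong not (parity-2* m)

¬2-uniform-F₀ : ∀ G → InducedSub F₀ G → ∀ w → Represents G w → ¬ Uniform 2 w
¬2-uniform-F₀ G sub w rep uni = F₀-diagram.impossible M M≡
  (Represented.chordDiagram G w rep 5 3 NF₀ sub (s≤s z≤n) (s≤s z≤n) uni M M≡)
  where
  M : ℕ → ℕ → Bool
  M j t = NF₀ (index (s≤s z≤n) j) (index (s≤s z≤n) t)
  M≡ : ∀ j t → NF₀ j t ≡ M (toℕ j) (toℕ t)
  M≡ j t = sym (cong₂ NF₀ (index-toℕ (s≤s z≤n) j) (index-toℕ (s≤s z≤n) t))

¬2-uniform-Sun : ∀ G k → parity k ≡ false → 4 ≤ k → InducedSub (Sun k) G → ∀ w → Represents G w → ¬ Uniform 2 w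
¬2-uniform-Sun G k even 4≤k sub w rep uni = Sun-diagram.impossible k 4≤k even _ (λ j t → refl)
  (Represented.chordDiagram G w rep k k (NSun k) sub 0<k 0<k uni
    (λ j t → (t ≡ᵇ j) ∨ (t ≡ᵇ suc j) ∨ ((t ≡ᵇ 0) ∧ (suc j ≡ᵇ k))) (λ j t → refl))
  where
  0<k : 0 < k
  0<k = ≤-trans (s≤s z≤n) 4≤k

¬2-uniform-F₁ : ∀ G k → parity k ≡ true → 5 ≤ k → InducedSub (F₁ k) G → ∀ w → Represents G w → ¬ Uniform 2 w
¬2-uniform-F₁ G (suc (suc l)) odd (s≤s (s≤s 3≤l)) sub w rep uni =
  F₁-diagram.impossible l 3≤l (trans (sym (Bool.not-involutive (parity l))) odd) M (λ t → refl) (λ t → refl)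
      (λ j t → refl)
    (Represented.chordDiagram G w rep (suc l) (suc (suc l)) (NF₁ (suc (suc l))) sub (s≤s z≤n) (s≤s z≤n) uni M
      (λ { zero t → refl ; (suc zero) t → refl ; (suc (suc j)) t → refl }))
  where
  M : ℕ → ℕ → Bool
  M 0 t = t <ᵇ l
  M 1 t = not (t ≡ᵇ 0)
  M (suc (suc j)) t = row j t

¬2-uniform-F₂ : ∀ G k → parity k ≡ true → 5 ≤ k → InducedSub (F₂ k) G → ∀ w → Represents G w → ¬ Uniform 2 w
¬2-uniform-F₂ G k odd 5≤k sub w rep uni = F₂-diagram.impossible k 5≤k odd M (λ t → refl) (λ j t → refl)
  (Represented.chordDiagram G w rep k k (NF₂ k) sub 0<k 0<k uni M (λ { zero t → refl ; (suc j) t → refl }))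
  where
  0<k : 0 < k
  0<k = ≤-trans (s≤s z≤n) 5≤k
  M : ℕ → ℕ → Bool
  M zero t = (0 <ᵇ t) ∧ (suc t <ᵇ k)
  M (suc j) t = row j t

theorem6 : (G : Graph) → IsSplit G → WordRepresentable G →
    RepNumberIs G 3 ⇔
    (InducedSub F₀ G
    ⊎ (∃ λ k → (∃ λ m → k ≡ 2 * m) × 4 ≤ k × InducedSub (Sun k) G)
    ⊎ (∃ λ k → (∃ λ m → k ≡ suc (2 * m)) × 5 ≤ k × InducedSub (F₁ k) G)
    ⊎ (∃ λ k → (∃ λ m → k ≡ suc (2 * m)) × 5 ≤ k × InducedSub (F₂ k) G))
theorem6 G (S , clique , indep) (w , occurs , rep) = mk⇔
  (λ (_ , _ , minimal) → case labelled-or-cycle of λ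
    { (inj₁ (colour , proper)) → ⊥-elim (minimal 2 (s≤s z≤n) ≤-refl (TwoUniform.twoUniform G S clique indep A colour
        proper))
    ; (inj₂ cycle) → forbidden-from-cycle cycle })
  (λ
    { (inj₁ sub) → exactly3
        (λ (v , uni , r) → Represented.¬1-uniform G v r 5 3 NF₀ sub (s≤s (s≤s z≤n)) uni)
        (λ (v , uni , r) → ¬2-uniform-F₀ G sub v r uni)
    ; (inj₂ (inj₁ (k , (m , eq) , 4≤k , sub))) → exactly3
        (λ (v , uni , r) → Represented.¬1-uniform G v r k k (NSun k) sub (≤-trans (s≤s (s≤s z≤n)) 4≤k) uni)
        (λ (v , uni , r) → ¬2-uniform-Sun G k (trans (cong parity eq) (parity-2* m)) 4≤k sub v r uni)
    ; (inj₂ (inj₂ (inj₁ (k , (m , eq) , 5≤k , sub)))) → exactly3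
        (λ (v , uni , r) → Represented.¬1-uniform G v r (k ∸ 1) k (NF₁ k) sub (≤-trans (s≤s (s≤s z≤n)) 5≤k) uni)
        (λ (v , uni , r) → ¬2-uniform-F₁ G k (trans (cong parity eq) (parity-suc-2* m)) 5≤k sub v r uni)
    ; (inj₂ (inj₂ (inj₂ (k , (m , eq) , 5≤k , sub)))) → exactly3
        (λ (v , uni , r) → Represented.¬1-uniform G v r k k (NF₂ k) sub (≤-trans (s≤s (s≤s z≤n)) 5≤k) uni)
        (λ (v , uni , r) → ¬2-uniform-F₂ G k (trans (cong parity eq) (parity-suc-2* m)) 5≤k sub v r uni) })
  where
  A : ArcModel S (adj G)
  A = FromWord.arcModel G S clique indep w occurs rep
  open ForbiddenSubgraph G S clique indep A
  Uniformly : ℕ → Set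
  Uniformly j = Σ (Word (n G)) λ v → Uniform j v × Represents G v
  exactly3 : ¬ Uniformly 1 → ¬ Uniformly 2 → RepNumberIs G 3
  exactly3 ¬1 ¬2 = s≤s z≤n , ThreeUniform.threeUniform G S clique indep A , λ
    { 1 _ _ → ¬1 ; 2 _ _ → ¬2 ; (suc (suc (suc j))) _ (s≤s (s≤s (s≤s ()))) }
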